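{- Let $G=(V,E)$ be an unweighted undirected graph with $n=|V|$ and $m=|E|$. The subgraph $H$ produced by the construction described in the context is a $5$-additive spanner of $G$, i.e. $\mathrm{dist}_H(u,v)\le \mathrm{dist}_G(u,v)+5$ for all $u,v\in V$.
   Context: A $k$-additive spanner of an unweighted undirected graph $G=(V,E)$ is a subgraph $H=(V,E')$, $E'\subseteq E$, with $\mathrm{dist}_H(u,v)\le\mathrm{dist}_G(u,v)+k$ for all $u,v$. A set $S$ dominates a set $X$ of vertices if every vertex of $X$ is in $S$ or adjacent to a vertex of $S$; dominating sets are computed by the greedy algorithm (repeatedly select the vertex covering the largest number of currently undominated target vertices until all targets are dominated). The construction: initialize $G'=(V',E')=(V,E)$ and $H=(V,\emptyset)$. Step 1: while the vertex $v\in V'$ of largest degree satisfies $\deg_{G'}(v)\ge n^{3/5}/\log^{3/5}n$, add a BFS tree of $G'$ rooted at $v$ to $H$ and remove $v$ and all its neighbors from $G'$. Afterwards a vertex $v\in V'$ is heavy if $\deg_{G'}(v)\ge n^{2/5}\log^{3/5}n$ and light otherwise. Step 2: for each light $u\in V'$, add all edges of $G'$ incident to $u$ to $H$. Step 3: compute (greedily) $S_1\subseteq V'$ dominating all heavy vertices in $G'$, and for each heavy vertex add to $H$ an edge connecting it to some vertex of $S_1$. Step 4: for each $v\in S_1$, compute a BFS tree $T_v$ of $G'$ rooted at $v$ such that for every $u\in V'$ the tree path from $v$ to $u$ minimizes the total vertex degree (in $G'$) along the path; let $p_{v,u}$ be the parent of $u$ in $T_v$, set $f_{v,v}=\deg_{G'}(v)$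 and $f_{v,u}=f_{v,p_{v,u}}+\deg_{G'}(u)$, and let $s_{v,u}$ be the sum of $G'$-degrees of vertices in the subtree of $T_v$ rooted at $u$. Step 5: build a bipartite graph $B=(L,R,C)$ with $L=V'$: for each $v\in S_1$ and $u\in V'$ with $f_{v,u}>n^{3/5}\log^{2/5}n$, $f_{v,p_{v,u}}\le n^{3/5}\log^{2/5}n$ and $s_{v,u}>3n^{3/5}\log^{2/5}n$, put a node $(v,u)$ in $R$ and join it in $C$ to every $x\in V'$ adjacent (in $G'$) to some vertex on the $v$--$u$ path in $T_v$. Step 6: compute (greedily) $S_2\subseteq L$ dominating all vertices of $R$ in $B$, and for each $x\in S_2$ add a BFS tree of $G'$ rooted at $x$ to $H$. Step 7: for each $v,u\in S_1$ with $f_{v,u}\le 5n^{3/5}\log^{2/5}n$, add the $v$--$u$ path in $T_v$ to $H$. -}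

module Defs where

open import Data.Nat using (ℕ; zero; suc; _+_; _*_; _^_; _≤_; _<_)
open import Data.Fin using (Fin; zero; suc; _≟_)
open import Data.Bool using (Bool; true; false; _∧_; not; T; if_then_else_)
open import Data.Product using (Σ; _×_; _,_; proj₁; proj₂)
open import Data.Sum using (_⊎_)
open import Data.Empty using (⊥)
open import Data.List using (List; []; _∷_; map)
open import Data.Nat.ListAction using (sum)
open import Data.List.Membership.Propositional using (_∈_)
open import Data.List.Relation.Unary.Unique.Propositional using (Unique)
open import Relation.Binary.PropositionalEquality using (_≡_)
open import Relation.Nullary using (¬_)
open import Relation.Nullary.Decidable using (⌊_⌋)

record Graph (n : ℕ) : Set where
  field
    adj        : Fin n → Fin n → Bool
    adj-sym    : ∀ u v → adj u v ≡ adj v u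
    adj-irrefl : ∀ v → adj v v ≡ false
open Graph public

VSet : ℕ → Set
VSet n = Fin n → Bool

allV : ∀ {n} → VSet n
allV _ = true

Edges : ℕ → Set₁
Edges n = Fin n → Fin n → Set

Sym : ∀ {n} → Edges n → Edges n
Sym E u v = E u v ⊎ E v u

adjIn : ∀ {n} → Graph n → VSet n → Fin n → Fin n → Bool
adjIn G V' u v = V' u ∧ (V' v ∧ adj G u v)

GE : ∀ {n} → Graph n → VSet n → Edges n
GE G V' u v = T (adjIn G V' u v)

count : ∀ {n} → (Fin n → Bool) → ℕ
count {zero}  p = 0
count {suc n} p = (if p zero then 1 else 0) + count (λ i → p (suc i))

deg : ∀ {n} → Graph n → VSet n → Fin n → ℕ
deg G V' v = count (λ w → adjIn G V' v w)

data Walk {n} (E : Edges n) : Fin n → Fin n → ℕ → Set where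
  wnil  : ∀ {u} → Walk E u u 0
  wcons : ∀ {u w v ℓ} → E u w → Walk E w v ℓ → Walk E u v (suc ℓ)

data WWalk {n} (E : Edges n) (wt : Fin n → ℕ) : Fin n → Fin n → ℕ → ℕ → Set where
  wwnil  : ∀ {u} → WWalk E wt u u 0 (wt u)
  wwcons : ∀ {u w v ℓ s} → E u w → WWalk E wt w v ℓ s → WWalk E wt u v (suc ℓ) (wt u + s)

IsDist : ∀ {n} → Edges n → Fin n → Fin n → ℕ → Set
IsDist E u v d = Walk E u v d × (∀ ℓ → Walk E u v ℓ → d ≤ ℓ)

-- H is a k-additive spanner of G: H ⊆ E(G) and dist_H(u,v) ≤ dist_G(u,v) + k
-- (if dist_G(u,v) = ∞ the inequality is vacuous).
IsAdditiveSpanner : ∀ {n} → Graph n → Edges n → ℕ → Set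
IsAdditiveSpanner G H k =
  (∀ u v → H u v → T (adj G u v)) ×
  (∀ u v d → IsDist (GE G allV) u v d →
     Σ ℕ λ d' → IsDist (Sym H) u v d' × d' ≤ d + k)

-- Comparisons of naturals with real numbers B·(log₂ n)^k, encoded exactly
-- through rational approximations p/q of log₂ n  (p/q ≤ log₂ n ⇔ 2^p ≤ n^q).

-- A ≤ B·(log₂ n)^k
LeMulLog : ℕ → ℕ → ℕ → ℕ → Set
LeMulLog n A B k = ∀ p q → 0 < q → B * p ^ k < A * q ^ k → 2 ^ p ≤ n ^ q

-- A < B·(log₂ n)^k
LtMulLog : ℕ → ℕ → ℕ → ℕ → Set
LtMulLog n A B k = Σ ℕ λ p → Σ ℕ λ q → 0 < q × A * q ^ k < B * p ^ k × 2 ^ p < n ^ q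

-- B·(log₂ n)^k ≤ A
MulLogLe : ℕ → ℕ → ℕ → ℕ → Set
MulLogLe n B A k = ∀ p q → 0 < q → 2 ^ p ≤ n ^ q → B * p ^ k ≤ A * q ^ k

-- B·(log₂ n)^k < A
MulLogLt : ℕ → ℕ → ℕ → ℕ → Set
MulLogLt n B A k = Σ ℕ λ p → Σ ℕ λ q → 0 < q × n ^ q < 2 ^ p × B * p ^ k < A * q ^ k

SumOver : {A : Set} → (A → Set) → (A → ℕ) → ℕ → Set
SumOver {A} P wt s =
  Σ (List A) λ xs → Unique xs × (∀ a → (a ∈ xs → P a) × (P a → a ∈ xs)) × sum (map wt xs) ≡ s

Card : {A : Set} → (A → Set) → ℕ → Set
Card P c = SumOver P (λ _ → 1) c

-- Greedy dominating set: candidates Cand, targets Tgt, x covers a iff Cov x a.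
-- Greedy ... D xs : starting with the already-dominated targets D, the greedy
-- algorithm may select exactly the sequence xs.

data Greedy {n} {A : Set} (Cand : Fin n → Set) (Tgt : A → Set) (Cov : Fin n → A → Set)
     : (A → Set) → List (Fin n) → Set₁ where
  done : ∀ {D} → (∀ a → Tgt a → D a) → Greedy Cand Tgt Cov D []
  pick : ∀ {D xs} (x : Fin n) (c : ℕ)
       → ¬ (∀ a → Tgt a → D a)
       → Cand x
       → Card (λ a → Tgt a × ¬ D a × Cov x a) c
       → (∀ y c' → Cand y → Card (λ a → Tgt a × ¬ D a × Cov y a) c' → c' ≤ c)
       → Greedy Cand Tgt Cov (λ a → D a ⊎ Cov x a) xs
       → Greedy Cand Tgt Cov D (x ∷ xs)

IsBFS : ∀ {n} → Edges n → Fin n → (Fin n → Fin n) → Set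
IsBFS E r par = ∀ u d → IsDist E r u (suc d) → E (par u) u × IsDist E r (par u) d

BFSEdge : ∀ {n} → Edges n → Fin n → (Fin n → Fin n) → Edges n
BFSEdge E r par x y = Σ ℕ λ d → IsDist E r y (suc d) × x ≡ par y

data Anc {n} (E : Edges n) (r : Fin n) (par : Fin n → Fin n) (a : Fin n) : Fin n → Set where
  here  : Anc E r par a a
  there : ∀ {w d} → IsDist E r w (suc d) → Anc E r par a (par w) → Anc E r par a w

remove : ∀ {n} → Graph n → VSet n → Fin n → VSet n
remove G V' v w = V' w ∧ (not ⌊ w ≟ v ⌋ ∧ not (adj G v w))

-- Step1 G V' E Vf : running step 1 from the current vertex set V' may add the
-- edge set E to H and end with the vertex set Vf.
-- Threshold: deg ≥ n^{3/5}/log^{3/5} n  ⇔  n³ ≤ deg⁵·(log₂ n)³.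
data Step1 {n} (G : Graph n) : VSet n → Edges n → VSet n → Set₁ where
  stop : ∀ {V'} → (∀ v → T (V' v) → MulLogLt n (deg G V' v ^ 5) (n ^ 3) 3)
       → Step1 G V' (λ _ _ → ⊥) V'
  grow : ∀ {V' E Vf} (v : Fin n) (par : Fin n → Fin n)
       → T (V' v)
       → (∀ w → T (V' w) → deg G V' w ≤ deg G V' v)
       → LeMulLog n (n ^ 3) (deg G V' v ^ 5) 3
       → IsBFS (GE G V') v par
       → Step1 G (remove G V' v) E Vf
       → Step1 G V' (λ x y → BFSEdge (GE G V') v par x y ⊎ E x y) Vf

-- heavy: deg ≥ n^{2/5} log^{3/5} n ⇔ n²(log₂ n)³ ≤ deg⁵ ; light otherwise
Heavy : ∀ {n} → Graph n → VSet n → Fin n → Set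
Heavy {n} G V' v = MulLogLe n (n ^ 2) (deg G V' v ^ 5) 3

Light : ∀ {n} → Graph n → VSet n → Fin n → Set
Light {n} G V' v = LtMulLog n (deg G V' v ^ 5) (n ^ 2) 3

-- Step 5: nodes of R  (X = n^{3/5} log^{2/5} n, so f > X ⇔ n³(log₂ n)² < f⁵ etc.)
RNode : ∀ {n} → Graph n → VSet n → List (Fin n) → (Fin n → Fin n → Fin n)
      → (Fin n → Fin n → ℕ) → (Fin n → Fin n → ℕ) → Fin n × Fin n → Set
RNode {n} G V' S1 par f s (v , u) =
  v ∈ S1 × T (V' u) × (Σ ℕ λ d → IsDist (GE G V') v u (suc d)) ×
  MulLogLt n (n ^ 3) (f v u ^ 5) 2 ×
  LeMulLog n (f v (par v u) ^ 5) (n ^ 3) 2 ×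
  MulLogLt n (3 ^ 5 * n ^ 3) (s v u ^ 5) 2

CAdj : ∀ {n} → Graph n → VSet n → (Fin n → Fin n → Fin n) → Fin n → Fin n × Fin n → Set
CAdj {n} G V' par x (v , u) =
  T (V' x) × Σ (Fin n) λ w → Anc (GE G V') v (par v) w u × GE G V' x w

-- A complete run of the construction (all tie-breaking choices recorded).

record Run {n} (G : Graph n) : Set₁ where
  field
    E1     : Edges n
    V'     : VSet n
    step1  : Step1 G allV E1 V'
    S1      : List (Fin n)
    greedy1 : Greedy (λ x → T (V' x)) (λ h → T (V' h) × Heavy G V' h)
                     (λ x h → x ≡ h ⊎ GE G V' x h) (λ _ → ⊥) S1
    dom1    : Fin n → Fin n
    dom1-ok : ∀ h → T (V' h) → Heavy G V' h → dom1 h ∈ S1 × (dom1 h ≡ h ⊎ GE G V' h (dom1 h))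
    par4   : Fin n → Fin n → Fin n
    f      : Fin n → Fin n → ℕ
    s      : Fin n → Fin n → ℕ
    bfs4   : ∀ v → v ∈ S1 → IsBFS (GE G V') v (par4 v)
    f-root : ∀ v → v ∈ S1 → f v v ≡ deg G V' v
    f-step : ∀ v → v ∈ S1 → ∀ u d → IsDist (GE G V') v u (suc d)
           → f v u ≡ f v (par4 v u) + deg G V' u
    f-min  : ∀ v → v ∈ S1 → ∀ u ℓ w → IsDist (GE G V') v u ℓ
           → WWalk (GE G V') (deg G V') v u ℓ w → f v u ≤ w
    s-def  : ∀ v → v ∈ S1 → ∀ u d → IsDist (GE G V') v u d
           → SumOver (λ w → (Σ ℕ λ e → IsDist (GE G V') v w e) × Anc (GE G V') v (par4 v) u w)
                     (deg G V') (s v u)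
    S2      : List (Fin n)
    greedy2 : Greedy (λ x → T (V' x)) (RNode G V' S1 par4 f s) (CAdj G V' par4) (λ _ → ⊥) S2
    par6    : Fin n → Fin n → Fin n
    bfs6    : ∀ x → x ∈ S2 → IsBFS (GE G V') x (par6 x)

spannerOf : ∀ {n} {G : Graph n} → Run G → Edges n
spannerOf {n} {G} run x y =
    E1 x y
  ⊎ (T (V' x) × Light G V' x × GE G V' x y)
  ⊎ (T (V' x) × Heavy G V' x × y ≡ dom1 x × GE G V' x y)
  ⊎ (Σ (Fin n) λ r → r ∈ S2 × BFSEdge (GE G V') r (par6 r) x y)
  ⊎ (Σ (Fin n) λ v → Σ (Fin n) λ u → v ∈ S1 × u ∈ S1 ×
       (Σ ℕ λ d → IsDist (GE G V') v u d) ×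
       LeMulLog n (f v u ^ 5) (5 ^ 5 * n ^ 3) 2 ×
       Anc (GE G V') v (par4 v) y u ×
       BFSEdge (GE G V') v (par4 v) x y)
  where open Run run

{-# OPTIONS --safe #-}
-- If step 1 removes a vertex of a shortest path, the tree grown at that moment costs at most +2.
-- Otherwise the path lies in V'; its light edges are in H, so only the stretch between its first
-- and last heavy vertices a and b matters.  Let a' and b' dominate them, and write X for
-- n^(3/5) (log n)^(2/5).  If f(a',b') ≤ 5X, step 7 gives +4.  If not, and b' is no further from a'
-- than b, the tree path from a' to b' meets a node of R and the hub next to it gives +5.  If b' is
-- further, then f(a',b) > 4X because deg b' ≤ X, and a hub on the path from a' to b gives +4.
--
-- Constructively this needs a decision of deg⁵ against n² (log n)³ and of f⁵ against 5⁵ n³ (log n)²,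
-- that is, an effective lower bound for |log n − α| with α quadratic or cubic over ℚ: the real case
-- of the Gelfond–Schneider theorem.  Suppose log n and α = β/B agree to very high precision, with
-- βᵏ = m an integer.  By the pigeonhole principle there is a nonzero P ∈ ℤ[x,y] with small
-- coefficients such that P(Bz, 2ᶻ) is tiny for 0 ≤ z ≤ R, because the Newton series of this function
-- has few significant terms.  At z = i + jα one has y ≈ 2ⁱnʲ, so P(Bi + jβ, 2ⁱnʲ) ∈ ℤ[β] is tiny
-- and vanishes by taking norms.  Eliminating the powers of y one by one leaves a nonzero polynomial
-- in x with more roots Bi + jβ than its degree.
module Submission where

open import Data.Nat using (ℕ)
open import Defs


-- The statement asks for an actual distance in H, a least walk length, and constructively this
-- requires that the edges of H can be decided; the same decisions drive the case distinctions on
-- heaviness and on f. A strict comparison with log n is witnessed by a separating fraction, so a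
-- decision needs a lower bound on the gap that is known in advance. If the root in question is
-- rational, say t/s, comparing 2ᵗ with nˢ settles the matter, equality included; only an irrational
-- root needs transcendence. No real number occurs: natural logarithms are replaced by exponents of
-- the base 1 + 1/Q, which squeezes log n between pₙ/(p₂ + 1) and (pₙ + 1)/p₂, and the exponential
-- function becomes (1 + 1/Q)ᵖ, whose Newton series in p is a finite exact identity over ℚ. All
-- degrees, heights and grid sizes are independent of Q; Q is chosen last, so large that rounding
-- errors of order 1/Q disappear in the Liouville inequality. One test at this Q then decides the
-- comparison, without a search.

module OrderedField where

  open import Algebra using (CommutativeRing; IsCommutativeRing)
  open import Algebra.Bundles.Raw using (RawRing)
  open import Data.Empty using (⊥-elim)
  open import Data.Integer as ℤ using (ℤ; +_; -[1+_])
  import Data.Integer.Properties as ℤP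
  open import Data.Maybe using (Maybe; just; nothing)
  open import Data.Nat as ℕ using (ℕ; zero; suc)
  import Data.Nat.Properties as ℕP
  open import Data.Product using (Σ; _×_; _,_; proj₁; proj₂)
  open import Data.Sum using (_⊎_; inj₁; inj₂)
  open import Level using (0ℓ)
  open import Relation.Binary.PropositionalEquality
  open import Relation.Nullary using (¬_; Dec; yes; no)
  import Algebra.Solver.Ring as RS
  import Algebra.Solver.Ring.AlmostCommutativeRing as ACR

  -- Commutative rings with propositional equality, and ordered fields.

  record CRing : Set₁ where
    infixl 6 _+_
    infixl 7 _*_
    infix  8 -_
    field
      Carrier : Set
      _+_ _*_ : Carrier → Carrier → Carrier
      -_      : Carrier → Carrier
      0# 1#   : Carrier
      isCommutativeRing : IsCommutativeRing _≡_ _+_ _*_ -_ 0# 1#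

  module CRingTheory (R : CRing) where
    open CRing R public
    open IsCommutativeRing isCommutativeRing public
      using (+-assoc; +-comm; +-identityˡ; +-identityʳ; -‿inverseˡ; -‿inverseʳ;
             *-assoc; *-comm; *-identityˡ; *-identityʳ; distribˡ; distribʳ; zeroˡ; zeroʳ)

    commutativeRing : CommutativeRing 0ℓ 0ℓ
    commutativeRing = record { isCommutativeRing = isCommutativeRing }

    import Algebra.Properties.Ring (CommutativeRing.ring commutativeRing) as RP

    infixl 6 _-_
    _-_ : Carrier → Carrier → Carrier
    x - y = x + - y

    fromℕ : ℕ → Carrier
    fromℕ zero    = 0#
    fromℕ (suc n) = 1# + fromℕ n

    fromℤ : ℤ → Carrier
    fromℤ (+ n)      = fromℕ n
    fromℤ -[1+ n ]   = - fromℕ (suc n)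

    fromℕ-+ : ∀ m n → fromℕ (m ℕ.+ n) ≡ fromℕ m + fromℕ n
    fromℕ-+ zero    n = sym (+-identityˡ _)
    fromℕ-+ (suc m) n = trans (cong (_+_ 1#) (fromℕ-+ m n)) (sym (+-assoc _ _ _))

    fromℕ-* : ∀ m n → fromℕ (m ℕ.* n) ≡ fromℕ m * fromℕ n
    fromℕ-* zero    n = sym (zeroˡ _)
    fromℕ-* (suc m) n = trans (fromℕ-+ n (m ℕ.* n))
      (trans (cong₂ _+_ (sym (*-identityˡ _)) (fromℕ-* m n)) (sym (distribʳ _ _ _)))

    fromℕ-1 : fromℕ 1 ≡ 1#
    fromℕ-1 = +-identityʳ _

    -0≡0 : - 0# ≡ 0#
    -0≡0 = RP.-0#≈0#

    neg-+ : ∀ x y → - (x + y) ≡ - x + - y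
    neg-+ x y = sym (RP.-‿+-comm x y)

    fromℤ-neg : ∀ i → fromℤ (ℤ.- i) ≡ - fromℤ i
    fromℤ-neg (+ zero)  = sym -0≡0
    fromℤ-neg (+ suc n) = refl
    fromℤ-neg -[1+ n ]  = sym (RP.-‿involutive _)

    fromℤ-⊖ : ∀ m n → fromℤ (m ℤ.⊖ n) ≡ fromℕ m - fromℕ n
    fromℤ-⊖ zero    zero    = sym (-‿inverseʳ _)
    fromℤ-⊖ zero    (suc n) = sym (+-identityˡ _)
    fromℤ-⊖ (suc m) zero    = sym (trans (cong (_+_ _) -0≡0) (+-identityʳ _))
    fromℤ-⊖ (suc m) (suc n) = trans (cong fromℤ (ℤP.[1+m]⊖[1+n]≡m⊖n m n)) (trans (fromℤ-⊖ m n) (sym lem))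
      where
      open ≡-Reasoning
      a = fromℕ m
      b = fromℕ n
      lem : (1# + a) + - (1# + b) ≡ a + - b
      lem = begin
        (1# + a) + - (1# + b)     ≡⟨ cong₂ _+_ (+-comm _ _) (neg-+ _ _) ⟩
        (a + 1#) + (- 1# + - b)   ≡⟨ +-assoc _ _ _ ⟩
        a + (1# + (- 1# + - b))   ≡⟨ cong (_+_ a) (sym (+-assoc _ _ _)) ⟩
        a + ((1# + - 1#) + - b)   ≡⟨ cong (λ t → a + (t + - b)) (-‿inverseʳ _) ⟩
        a + (0# + - b)            ≡⟨ cong (_+_ a) (+-identityˡ _) ⟩
        a + - b ∎

    fromℤ-+ : ∀ i j → fromℤ (i ℤ.+ j) ≡ fromℤ i + fromℤ j
    fromℤ-+ (+ m)    (+ n)    = fromℕ-+ m n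
    fromℤ-+ (+ m)    -[1+ n ] = fromℤ-⊖ m (suc n)
    fromℤ-+ -[1+ m ] (+ n)    = trans (fromℤ-⊖ n (suc m)) (+-comm _ _)
    fromℤ-+ -[1+ m ] -[1+ n ] = trans (cong -_ (trans (cong fromℕ (cong suc (sym (ℕP.+-suc m n)))) (fromℕ-+ (suc m) (suc n)))) (neg-+ _ _)

    fromℤ-*ℕ : ∀ m n → fromℤ (+ m ℤ.* + n) ≡ fromℕ m * fromℕ n
    fromℤ-*ℕ m n = trans (cong fromℤ (sym (ℤP.pos-* m n))) (fromℕ-* m n)

    fromℤ-* : ∀ i j → fromℤ (i ℤ.* j) ≡ fromℤ i * fromℤ j
    fromℤ-* (+ m)    (+ n)    = fromℤ-*ℕ m n
    fromℤ-* (+ m)    -[1+ n ] = begin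
      fromℤ (+ m ℤ.* -[1+ n ])         ≡⟨ cong fromℤ (sym (ℤP.neg-distribʳ-* (+ m) (+ suc n))) ⟩
      fromℤ (ℤ.- (+ m ℤ.* + suc n))    ≡⟨ fromℤ-neg (+ m ℤ.* + suc n) ⟩
      - fromℤ (+ m ℤ.* + suc n)        ≡⟨ cong -_ (fromℤ-*ℕ m (suc n)) ⟩
      - (fromℕ m * fromℕ (suc n))      ≡⟨ RP.-‿distribʳ-* _ _ ⟩
      fromℕ m * - fromℕ (suc n)        ∎
      where open ≡-Reasoning
    fromℤ-* -[1+ m ] (+ n)    = begin
      fromℤ (-[1+ m ] ℤ.* + n)         ≡⟨ cong fromℤ (sym (ℤP.neg-distribˡ-* (+ suc m) (+ n))) ⟩
      fromℤ (ℤ.- (+ suc m ℤ.* + n))    ≡⟨ fromℤ-neg (+ suc m ℤ.* + n) ⟩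
      - fromℤ (+ suc m ℤ.* + n)        ≡⟨ cong -_ (fromℤ-*ℕ (suc m) n) ⟩
      - (fromℕ (suc m) * fromℕ n)      ≡⟨ RP.-‿distribˡ-* _ _ ⟩
      - fromℕ (suc m) * fromℕ n        ∎
      where open ≡-Reasoning
    fromℤ-* -[1+ m ] -[1+ n ] = trans (fromℕ-* (suc m) (suc n)) (sym lem)
      where
      lem : ∀ {a b} → - a * - b ≡ a * b
      lem {a} {b} = trans (sym (RP.-‿distribˡ-* a (- b))) (trans (cong -_ (sym (RP.-‿distribʳ-* a b))) (RP.-‿involutive _))

    private
      ring : ACR.AlmostCommutativeRing 0ℓ 0ℓ
      ring = ACR.fromCommutativeRing commutativeRing

      ℤring : RawRing 0ℓ 0ℓ
      ℤring = CommutativeRing.rawRing ℤP.+-*-commutativeRing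

      morphism : ℤring ACR.-Raw-AlmostCommutative⟶ ring
      morphism = record
        { ⟦_⟧ = fromℤ ; +-homo = fromℤ-+ ; *-homo = fromℤ-* ; -‿homo = fromℤ-neg
        ; 0-homo = refl ; 1-homo = fromℕ-1 }

      dec : (i j : ℤ) → Maybe (fromℤ i ≡ fromℤ j)
      dec i j with i ℤP.≟ j
      ... | yes p = just (cong fromℤ p)
      ... | no  _ = nothing

    -- Coefficients of normal forms are integers, so the solver works over every `CRing`, including
    -- those whose own equality is not known to be decidable.
    module Solver = RS ℤring ring morphism dec

    infixr 8 _^_
    _^_ : Carrier → ℕ → Carrier
    x ^ zero  = 1#
    x ^ suc n = x * x ^ n

    ^-+ : ∀ x m n → x ^ (m ℕ.+ n) ≡ x ^ m * x ^ n
    ^-+ x zero    n = sym (*-identityˡ _)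
    ^-+ x (suc m) n = trans (cong (_*_ x) (^-+ x m n)) (sym (*-assoc _ _ _))

    ^-distrib-* : ∀ x y n → (x * y) ^ n ≡ x ^ n * y ^ n
    ^-distrib-* x y zero    = sym (*-identityˡ _)
    ^-distrib-* x y (suc n) = trans (cong (_*_ (x * y)) (^-distrib-* x y n))
      (solve 4 (λ a b c d → (a :* b) :* (c :* d) := (a :* c) :* (b :* d)) refl x y (x ^ n) (y ^ n))
      where open Solver

    1^ : ∀ n → 1# ^ n ≡ 1#
    1^ zero    = refl
    1^ (suc n) = trans (*-identityˡ _) (1^ n)

    ^-^ : ∀ x m n → (x ^ m) ^ n ≡ x ^ (m ℕ.* n)
    ^-^ x zero    n = 1^ n
    ^-^ x (suc m) n = trans (^-distrib-* x (x ^ m) n) (trans (cong (_*_ (x ^ n)) (^-^ x m n)) (sym (^-+ x n (m ℕ.* n))))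

    fromℕ-^ : ∀ m n → fromℕ (m ℕ.^ n) ≡ fromℕ m ^ n
    fromℕ-^ m zero    = fromℕ-1
    fromℕ-^ m (suc n) = trans (fromℕ-* m (m ℕ.^ n)) (cong (_*_ (fromℕ m)) (fromℕ-^ m n))

    sum : ℕ → (ℕ → Carrier) → Carrier
    sum zero    f = 0#
    sum (suc n) f = sum n f + f n

    sum-cong : ∀ n {f g} → (∀ i → i ℕ.< n → f i ≡ g i) → sum n f ≡ sum n g
    sum-cong zero    h = refl
    sum-cong (suc n) h = cong₂ _+_ (sum-cong n (λ i i<n → h i (ℕP.m<n⇒m<1+n i<n))) (h n ℕP.≤-refl)

    sum-+ : ∀ n f g → sum n (λ i → f i + g i) ≡ sum n f + sum n g
    sum-+ zero    f g = sym (+-identityˡ _)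
    sum-+ (suc n) f g = trans (cong (_+ (f n + g n)) (sum-+ n f g))
      (solve 4 (λ a b c d → (a :+ b) :+ (c :+ d) := (a :+ c) :+ (b :+ d)) refl (sum n f) (sum n g) (f n) (g n))
      where open Solver

    sum-* : ∀ n c f → sum n (λ i → c * f i) ≡ c * sum n f
    sum-* zero    c f = sym (zeroʳ c)
    sum-* (suc n) c f = trans (cong (_+ (c * f n)) (sum-* n c f)) (sym (distribˡ _ _ _))

    sum-0 : ∀ n → sum n (λ _ → 0#) ≡ 0#
    sum-0 zero    = refl
    sum-0 (suc n) = trans (+-identityʳ _) (sum-0 n)

    sum-neg : ∀ n f → sum n (λ i → - f i) ≡ - sum n f
    sum-neg zero    f = sym -0≡0
    sum-neg (suc n) f = trans (cong (_+ (- f n)) (sum-neg n f)) (sym (neg-+ _ _))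

    sum-swap : ∀ m n (f : ℕ → ℕ → Carrier) → sum m (λ i → sum n (f i)) ≡ sum n (λ j → sum m (λ i → f i j))
    sum-swap zero    n f = sym (sum-0 n)
    sum-swap (suc m) n f = trans (cong (_+ sum n (f m)) (sum-swap m n f)) (sym (sum-+ n _ _))

    sum-split : ∀ m n f → sum (m ℕ.+ n) f ≡ sum m f + sum n (λ i → f (m ℕ.+ i))
    sum-split m zero    f = trans (cong (λ t → sum t f) (ℕP.+-identityʳ m)) (sym (+-identityʳ _))
    sum-split m (suc n) f = trans (cong (λ t → sum t f) (ℕP.+-suc m n))
      (trans (cong (_+ f (m ℕ.+ n)) (sum-split m n f)) (+-assoc _ _ _))

    sum-suc : ∀ n f → sum (suc n) f ≡ f 0 + sum n (λ i → f (suc i))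
    sum-suc zero    f = trans (+-identityˡ _) (sym (+-identityʳ _))
    sum-suc (suc n) f = trans (cong (_+ f (suc n)) (sum-suc n f)) (+-assoc _ _ _)

  -- Strict inequality is expressed as the negation of the reversed `_≤_`. Decidability of the order
  -- is what integer parts and the pigeonhole argument will rest on.
  record OField : Set₁ where
    field
      cring : CRing
    open CRing cring public
    infix 4 _≤_
    field
      _≤_      : Carrier → Carrier → Set
      ≤-refl   : ∀ {x} → x ≤ x
      ≤-trans  : ∀ {x y z} → x ≤ y → y ≤ z → x ≤ z
      ≤-total  : ∀ x y → x ≤ y ⊎ y ≤ x
      _≤?_     : ∀ x y → Dec (x ≤ y)
      +-monoˡ  : ∀ {x y} z → x ≤ y → x + z ≤ y + z
      *-nonNeg : ∀ {x y} → 0# ≤ x → 0# ≤ y → 0# ≤ x * y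
      1≰0      : ¬ (1# ≤ 0#)
      inverse  : ∀ x → ¬ (x ≤ 0#) → Σ Carrier λ y → x * y ≡ 1#

  module OFieldTheory (F : OField) where
    open OField F public using (_≤_; ≤-refl; ≤-trans; ≤-total; _≤?_; +-monoˡ; *-nonNeg; 1≰0; inverse)
    open CRingTheory (OField.cring F) public

    ≤-reflexive : ∀ {x y} → x ≡ y → x ≤ y
    ≤-reflexive refl = ≤-refl

    infixr 2 _≤⟨_⟩_ _≡⟨_⟩'_
    infix  3 _□
    _≤⟨_⟩_ : ∀ x {y z} → x ≤ y → y ≤ z → x ≤ z
    _ ≤⟨ p ⟩ q = ≤-trans p q
    _≡⟨_⟩'_ : ∀ x {y z} → x ≡ y → y ≤ z → x ≤ z
    _ ≡⟨ p ⟩' q = ≤-trans (≤-reflexive p) q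
    _□ : ∀ x → x ≤ x
    _ □ = ≤-refl

    +-monoʳ : ∀ {x y} z → x ≤ y → z + x ≤ z + y
    +-monoʳ {x} {y} z p = subst₂ _≤_ (+-comm x z) (+-comm y z) (+-monoˡ z p)

    +-mono : ∀ {x y u v} → x ≤ y → u ≤ v → x + u ≤ y + v
    +-mono p q = ≤-trans (+-monoˡ _ p) (+-monoʳ _ q)

    x-y≥0 : ∀ {x y} → y ≤ x → 0# ≤ x - y
    x-y≥0 {x} {y} p = subst (_≤ x - y) (-‿inverseʳ y) (+-monoˡ (- y) p)

    x-y≥0⁻¹ : ∀ {x y} → 0# ≤ x - y → y ≤ x
    x-y≥0⁻¹ {x} {y} p = subst₂ _≤_ (+-identityˡ y) lem (+-monoˡ y p)
      where
      lem : x - y + y ≡ x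
      lem = solve 2 (λ x y → x :- y :+ y := x) refl x y
        where open Solver

    neg-mono : ∀ {x y} → x ≤ y → - y ≤ - x
    neg-mono {x} {y} p = x-y≥0⁻¹ (subst (0# ≤_) (solve 2 (λ x y → y :- x := :- x :- (:- y)) refl x y) (x-y≥0 p))
      where open Solver

    *-monoˡ : ∀ {x y} z → 0# ≤ z → x ≤ y → x * z ≤ y * z
    *-monoˡ {x} {y} z 0≤z p = x-y≥0⁻¹
      (subst (0# ≤_) (solve 3 (λ x y z → (y :- x) :* z := y :* z :- x :* z) refl x y z) (*-nonNeg (x-y≥0 p) 0≤z))
      where open Solver

    *-monoʳ : ∀ {x y} z → 0# ≤ z → x ≤ y → z * x ≤ z * y
    *-monoʳ {x} {y} z 0≤z p = subst₂ _≤_ (*-comm x z) (*-comm y z) (*-monoˡ z 0≤z p)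

    *-mono : ∀ {x y u v} → 0# ≤ x → 0# ≤ u → x ≤ y → u ≤ v → x * u ≤ y * v
    *-mono 0≤x 0≤u p q = ≤-trans (*-monoˡ _ 0≤u p) (*-monoʳ _ (≤-trans 0≤x p) q)

    0≤1 : 0# ≤ 1#
    0≤1 with ≤-total 0# 1#
    ... | inj₁ p = p
    ... | inj₂ p = ⊥-elim (1≰0 p)

    +-nonNeg : ∀ {x y} → 0# ≤ x → 0# ≤ y → 0# ≤ x + y
    +-nonNeg p q = subst (_≤ _) (+-identityˡ 0#) (+-mono p q)

    fromℕ-nonNeg : ∀ n → 0# ≤ fromℕ n
    fromℕ-nonNeg zero    = ≤-refl
    fromℕ-nonNeg (suc n) = +-nonNeg 0≤1 (fromℕ-nonNeg n)

    fromℕ-mono : ∀ {m n} → m ℕ.≤ n → fromℕ m ≤ fromℕ n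
    fromℕ-mono {n = n} ℕ.z≤n = fromℕ-nonNeg n
    fromℕ-mono (ℕ.s≤s p)     = +-monoʳ 1# (fromℕ-mono p)

    1+≰ : ∀ {x} → ¬ (1# + x ≤ x)
    1+≰ {x} p = 1≰0 (subst₂ _≤_ (solve 2 (λ o x → o :+ x :- x := o) refl 1# x) (-‿inverseʳ x) (+-monoˡ (- x) p))
      where open Solver

    fromℕ-cancel : ∀ {m n} → fromℕ m ≤ fromℕ n → m ℕ.≤ n
    fromℕ-cancel {m} {n} p with m ℕP.≤? n
    ... | yes q = q
    ... | no ¬q = ⊥-elim (1+≰ (≤-trans (fromℕ-mono (ℕP.≰⇒> ¬q)) p))

    ≰⇒≥ : ∀ {x y} → ¬ (x ≤ y) → y ≤ x
    ≰⇒≥ {x} {y} p with ≤-total x y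
    ... | inj₁ q = ⊥-elim (p q)
    ... | inj₂ q = q

    ^-nonNeg : ∀ {x} n → 0# ≤ x → 0# ≤ x ^ n
    ^-nonNeg zero    p = 0≤1
    ^-nonNeg (suc n) p = *-nonNeg p (^-nonNeg n p)

    ^-mono : ∀ {x y} n → 0# ≤ x → x ≤ y → x ^ n ≤ y ^ n
    ^-mono zero    p q = ≤-refl
    ^-mono (suc n) p q = *-mono p (^-nonNeg n p) q (^-mono n p q)

    1≤^ : ∀ {x} n → 1# ≤ x → 1# ≤ x ^ n
    1≤^ {x} n p = subst (_≤ x ^ n) (1^ n) (^-mono n 0≤1 p)

    sum-mono : ∀ n {f g} → (∀ i → i ℕ.< n → f i ≤ g i) → sum n f ≤ sum n g
    sum-mono zero    h = ≤-refl
    sum-mono (suc n) h = +-mono (sum-mono n (λ i i<n → h i (ℕP.m<n⇒m<1+n i<n))) (h n ℕP.≤-refl)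

    sum-nonNeg : ∀ n {f} → (∀ i → i ℕ.< n → 0# ≤ f i) → 0# ≤ sum n f
    sum-nonNeg n {f} h = subst (_≤ sum n f) (sum-0 n) (sum-mono n h)

    sum-const : ∀ n c → sum n (λ _ → c) ≡ fromℕ n * c
    sum-const zero    c = sym (zeroˡ c)
    sum-const (suc n) c = trans (cong (_+ c) (sum-const n c))
      (trans (+-comm _ _) (trans (cong (_+ (fromℕ n * c)) (sym (*-identityˡ c))) (sym (distribʳ _ _ _))))

    sum-bound : ∀ n {f c} → (∀ i → i ℕ.< n → f i ≤ c) → sum n f ≤ fromℕ n * c
    sum-bound n {f} {c} h = ≤-trans (sum-mono n h) (≤-reflexive (sum-const n c))

    infix 4 ∣_∣≤_
    -- A relation in place of an absolute-value function: sums and differences are estimated without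
    -- distinguishing signs.
    ∣_∣≤_ : Carrier → Carrier → Set
    ∣ x ∣≤ ε = (x ≤ ε) × (- x ≤ ε)

    abs-nonNeg : ∀ {x ε} → ∣ x ∣≤ ε → 0# ≤ ε
    abs-nonNeg {x} {ε} (p , q) with ≤-total 0# x
    ... | inj₁ r = ≤-trans r p
    ... | inj₂ r = ≤-trans (subst (_≤ - x) -0≡0 (neg-mono r)) q

    abs-weaken : ∀ {x ε δ} → ∣ x ∣≤ ε → ε ≤ δ → ∣ x ∣≤ δ
    abs-weaken (p , q) r = ≤-trans p r , ≤-trans q r

    abs-of-nonNeg : ∀ {x ε} → 0# ≤ x → x ≤ ε → ∣ x ∣≤ ε
    abs-of-nonNeg {x} 0≤x p = p , ≤-trans (subst (- x ≤_) -0≡0 (neg-mono 0≤x)) (≤-trans 0≤x p)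

    abs-0 : ∀ {ε} → 0# ≤ ε → ∣ 0# ∣≤ ε
    abs-0 p = abs-of-nonNeg ≤-refl p

    abs-+ : ∀ {x y ε δ} → ∣ x ∣≤ ε → ∣ y ∣≤ δ → ∣ x + y ∣≤ ε + δ
    abs-+ {x} {y} (p , q) (r , s) = +-mono p r , subst (_≤ _) (sym (neg-+ x y)) (+-mono q s)

    abs-neg : ∀ {x ε} → ∣ x ∣≤ ε → ∣ - x ∣≤ ε
    abs-neg {x} (p , q) = q , subst (_≤ _) (solve 1 (λ x → x := :- (:- x)) refl x) p
      where open Solver

    abs-- : ∀ {x y ε δ} → ∣ x ∣≤ ε → ∣ y ∣≤ δ → ∣ x - y ∣≤ ε + δ
    abs-- p q = abs-+ p (abs-neg q)

    abs-* : ∀ {x y ε δ} → ∣ x ∣≤ ε → ∣ y ∣≤ δ → ∣ x * y ∣≤ ε * δ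
    abs-* {x} {y} {ε} {δ} p@(p₁ , p₂) q@(q₁ , q₂) with ≤-total 0# x | ≤-total 0# y
    ... | inj₁ a | inj₁ b = abs-of-nonNeg (*-nonNeg a b) (*-mono a b p₁ q₁)
    ... | inj₂ a | inj₂ b = subst (∣_∣≤ ε * δ) (solve 2 (λ x y → (:- x) :* (:- y) := x :* y) refl x y)
          (abs-of-nonNeg (*-nonNeg a' b') (*-mono a' b' p₂ q₂))
      where
      open Solver
      a' = subst (_≤ - x) -0≡0 (neg-mono a)
      b' = subst (_≤ - y) -0≡0 (neg-mono b)
    ... | inj₁ a | inj₂ b = subst (∣_∣≤ ε * δ) (solve 2 (λ x y → :- (x :* (:- y)) := x :* y) refl x y)
          (abs-neg (abs-of-nonNeg (*-nonNeg a b') (*-mono a b' p₁ q₂)))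
      where
      open Solver
      b' = subst (_≤ - y) -0≡0 (neg-mono b)
    ... | inj₂ a | inj₁ b = subst (∣_∣≤ ε * δ) (solve 2 (λ x y → :- ((:- x) :* y) := x :* y) refl x y)
          (abs-neg (abs-of-nonNeg (*-nonNeg a' b) (*-mono a' b p₂ q₁)))
      where
      open Solver
      a' = subst (_≤ - x) -0≡0 (neg-mono a)

    abs-sum : ∀ n {f : ℕ → Carrier} {ε} → (∀ i → i ℕ.< n → ∣ f i ∣≤ ε) → ∣ sum n f ∣≤ fromℕ n * ε
    abs-sum n {f} {ε} h =
        sum-bound n (λ i i<n → proj₁ (h i i<n))
      , subst (_≤ fromℕ n * ε) (sum-neg n f) (sum-bound n (λ i i<n → proj₂ (h i i<n)))

    abs-fromℤ : ∀ {z : ℤ} {n : ℕ} → ℤ.∣ z ∣ ℕ.≤ n → ∣ fromℤ z ∣≤ fromℕ n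
    abs-fromℤ {+ m}      p = abs-of-nonNeg (fromℕ-nonNeg m) (fromℕ-mono p)
    abs-fromℤ { -[1+ m ]} p = abs-neg (abs-of-nonNeg (fromℕ-nonNeg (suc m)) (fromℕ-mono p))

    -- Discreteness of ℤ, the step that turns smallness into vanishing: it is applied to the norm of
    -- an algebraic integer in the Liouville inequality.
    fromℤ-small : ∀ (z : ℤ) {ε} → ∣ fromℤ z ∣≤ ε → ¬ (1# ≤ ε) → z ≡ + 0
    fromℤ-small (+ zero)  p h = refl
    fromℤ-small (+ suc n) (p , _) h = ⊥-elim (h (≤-trans (subst (_≤ fromℕ (suc n)) fromℕ-1 (fromℕ-mono {1} {suc n} (ℕ.s≤s ℕ.z≤n))) p))
    fromℤ-small -[1+ n ]  (_ , q) h = ⊥-elim (h (≤-trans (subst (_≤ fromℕ (suc n)) fromℕ-1 (fromℕ-mono {1} {suc n} (ℕ.s≤s ℕ.z≤n)))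
      (subst (_≤ _) (solve 1 (λ x → :- (:- x) := x) refl (fromℕ (suc n))) q)))
      where open Solver

-- Polynomial functions and the zero estimate for P(x, y) on a grid.

module ZeroEstimate where

  open OrderedField
  open import Data.Empty using (⊥; ⊥-elim)
  open import Data.Integer as ℤ using (ℤ; +_)
  import Data.Integer.Properties as ℤP
  open import Data.List using (List; []; _∷_; length)
  open import Data.List.Relation.Unary.All as All using (All; []; _∷_)
  open import Data.List.Relation.Unary.AllPairs using (AllPairs; []; _∷_)
  open import Data.Nat as ℕ using (ℕ; zero; suc)
  import Data.Nat.Properties as ℕP
  import Data.Nat.DivMod as DM
  open import Data.Product using (Σ; _×_; _,_)
  open import Data.Sum using (_⊎_; inj₁; inj₂)
  open import Relation.Binary.Definitions using (tri<; tri≈; tri>)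
  open import Relation.Binary.PropositionalEquality
  open import Relation.Nullary using (¬_; yes; no)

  module PolynomialFunctions (R : CRing) where
    open CRingTheory R

    -- f is a polynomial function of degree at most d whose coefficient at x ^ d is c
    IsPoly : ℕ → Carrier → (Carrier → Carrier) → Set
    IsPoly zero    c f = ∀ x → f x ≡ c
    IsPoly (suc d) c f = ∀ r → Σ (Carrier → Carrier) λ g → IsPoly d c g × (∀ x → f x ≡ f r + (x - r) * g x)

    poly-resp : ∀ d {c c' f g} → c ≡ c' → (∀ x → f x ≡ g x) → IsPoly d c f → IsPoly d c' g
    poly-resp zero    refl e p x = trans (sym (e x)) (p x)
    poly-resp (suc d) refl e p r with p r
    ... | h , q , eq = h , q , λ x → trans (sym (e x)) (trans (eq x) (cong (_+ (x - r) * h x) (e r)))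

    poly-+ : ∀ d {c c' f g} → IsPoly d c f → IsPoly d c' g → IsPoly d (c + c') (λ x → f x + g x)
    poly-+ zero    p q x = cong₂ _+_ (p x) (q x)
    poly-+ (suc d) {f = f} {g} p q r with p r | q r
    ... | f' , p' , e | g' , q' , e' = (λ x → f' x + g' x) , poly-+ d p' q' , λ x →
      trans (cong₂ _+_ (e x) (e' x))
        (solve 5 (λ a b c d h → (a :+ h :* b) :+ (c :+ h :* d) := (a :+ c) :+ h :* (b :+ d)) refl
          (f r) (f' x) (g r) (g' x) (x - r))
      where open Solver

    poly-* : ∀ d {c f} k → IsPoly d c f → IsPoly d (k * c) (λ x → k * f x)
    poly-* zero    k p x = cong (_*_ k) (p x)
    poly-* (suc d) {f = f} k p r with p r
    ... | f' , p' , e = (λ x → k * f' x) , poly-* d k p' , λ x →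
      trans (cong (_*_ k) (e x))
        (solve 4 (λ k a h b → k :* (a :+ h :* b) := k :* a :+ h :* (k :* b)) refl k (f r) (x - r) (f' x))
      where open Solver

    poly-weaken : ∀ d {c f} → IsPoly d c f → IsPoly (suc d) 0# f
    poly-weaken zero    {f = f} p r = (λ _ → 0#) , (λ _ → refl) , λ x →
      trans (trans (p x) (sym (p r))) (trans (sym (+-identityʳ _)) (cong (_+_ (f r)) (sym (zeroʳ _))))
    poly-weaken (suc d) p r with p r
    ... | f' , p' , e = f' , poly-weaken d p' , e

    poly-weaken-by : ∀ d e {c f} → IsPoly d c f → IsPoly (suc e ℕ.+ d) 0# f
    poly-weaken-by d zero    p = poly-weaken d p
    poly-weaken-by d (suc e) p = poly-weaken (suc e ℕ.+ d) (poly-weaken-by d e p)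

    poly-shift : ∀ d {c f} h → IsPoly d c f → IsPoly d c (λ x → f (x + h))
    poly-shift zero    h p x = p (x + h)
    poly-shift (suc d) {f = f} h p r with p (r + h)
    ... | g , q , e = (λ x → g (x + h)) , poly-shift d h q , λ x →
      trans (e (x + h)) (cong (λ t → f (r + h) + t * g (x + h))
        (solve 3 (λ x h r → x :+ h :- (r :+ h) := x :- r) refl x h r))
      where open Solver

    -- The discrete product rule f g = f(r) g(r) + (x - r)(f' g + f(r) g'). The summand f(r) g' has
    -- too small a degree to matter and is padded with the leading coefficient zero.
    poly-mul : ∀ d e {c c' f g} → IsPoly d c f → IsPoly e c' g → IsPoly (d ℕ.+ e) (c * c') (λ x → f x * g x)
    poly-mul zero e {c} {g = g} p q = poly-resp e refl (λ x → cong (_* g x) (sym (p x))) (poly-* e c q)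
    poly-mul (suc d) zero {c} {c'} {f} {g} p q =
      poly-resp (suc d ℕ.+ 0) (*-comm c' c) (λ x → trans (*-comm c' (f x)) (cong (_*_ (f x)) (sym (q x))))
        (subst (λ k → IsPoly k (c' * c) (λ x → c' * f x)) (sym (ℕP.+-identityʳ (suc d))) (poly-* (suc d) c' p))
    poly-mul (suc d) (suc e) {c} {c'} {f} {g} p q r with p r | q r
    ... | f' , p' , ef | g' , q' , eg =
      (λ x → f' x * g x + f r * g' x)
      , poly-resp (d ℕ.+ suc e) (+-identityʳ _) (λ _ → refl)
          (poly-+ (d ℕ.+ suc e) (poly-mul d (suc e) p' q)
            (subst (λ k → IsPoly k 0# (λ x → f r * g' x)) (sym (ℕP.+-suc d e)) (poly-weaken-by e d (poly-* e (f r) q'))))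
      , λ x → begin
          f x * g x                                         ≡⟨ cong (_* g x) (ef x) ⟩
          (f r + (x - r) * f' x) * g x                      ≡⟨ solve 4 (λ a h b k → (a :+ h :* b) :* k := a :* k :+ h :* (b :* k)) refl (f r) (x - r) (f' x) (g x) ⟩
          f r * g x + (x - r) * (f' x * g x)                ≡⟨ cong (λ t → f r * t + (x - r) * (f' x * g x)) (eg x) ⟩
          f r * (g r + (x - r) * g' x) + (x - r) * (f' x * g x) ≡⟨ solve 5 (λ a b h k m → a :* (b :+ h :* k) :+ h :* m := a :* b :+ h :* (m :+ a :* k)) refl (f r) (g r) (x - r) (g' x) (f' x * g x) ⟩
          f r * g r + (x - r) * (f' x * g x + f r * g' x)   ∎
      where
      open ≡-Reasoning
      open Solver

    poly-id : IsPoly 1 1# (λ x → x)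
    poly-id r = (λ _ → 1#) , (λ _ → refl) , λ x →
      trans (solve 2 (λ x r → x := r :+ (x :- r)) refl x r) (cong (_+_ r) (sym (*-identityʳ _)))
      where open Solver

    poly-^ : ∀ d → IsPoly d 1# (λ x → x ^ d)
    poly-^ zero    x = refl
    poly-^ (suc d) = poly-resp (suc d) (*-identityʳ 1#) (λ _ → refl) (poly-mul 1 d poly-id (poly-^ d))

    -- Splitting off the root `z 0` lowers the degree but keeps the leading coefficient; in a domain
    -- the quotient still vanishes at the other roots.
    poly-roots : (∀ {x y} → x * y ≡ 0# → x ≡ 0# ⊎ y ≡ 0#) →
      ∀ d {c f} → IsPoly d c f → (z : ℕ → Carrier) →
      (∀ i j → i ℕ.≤ d → j ℕ.≤ d → z i ≡ z j → i ≡ j) →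
      (∀ i → i ℕ.≤ d → f (z i) ≡ 0#) → c ≡ 0#
    poly-roots dom zero    p z inj v = trans (sym (p (z 0))) (v 0 ℕ.z≤n)
    poly-roots dom (suc d) {f = f} p z inj v with p (z 0)
    ... | g , q , e = poly-roots dom d q (λ i → z (suc i))
            (λ i j i≤ j≤ eq → ℕP.suc-injective (inj (suc i) (suc j) (ℕ.s≤s i≤) (ℕ.s≤s j≤) eq)) v'
      where
      v' : ∀ i → i ℕ.≤ d → g (z (suc i)) ≡ 0#
      v' i i≤d with dom {z (suc i) - z 0} {g (z (suc i))}
                      (trans (solve 2 (λ a b → a := b :+ a :- b) refl ((z (suc i) - z 0) * g (z (suc i))) (f (z 0)))
                      (trans (cong (_- f (z 0)) (sym (e (z (suc i)))))
                      (trans (cong₂ _-_ (v (suc i) (ℕ.s≤s i≤d)) (v 0 ℕ.z≤n)) (-‿inverseʳ 0#))))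
        where open Solver
      ... | inj₂ h = h
      ... | inj₁ h with inj (suc i) 0 (ℕ.s≤s i≤d) ℕ.z≤n
                          (trans (solve 2 (λ a b → a := (a :- b) :+ b) refl (z (suc i)) (z 0))
                          (trans (cong (_+ z 0) h) (+-identityˡ _)))
        where open Solver
      ... | ()

  -- If several exponents occur, the combination
  --   2ᵇ f(x) f_b(x + h) − 2ᵃ f(x + h) f_b(x)
  -- eliminates the term f(x) yᵃ, keeps the other exponents b and their leading
  -- coefficients nonzero, doubles the degrees and loses one column of points.
  module Elimination
    (R : CRing)
    (dom : ∀ {x y} → CRing._*_ R x y ≡ CRing.0# R → x ≡ CRing.0# R ⊎ y ≡ CRing.0# R)
    (char0 : ∀ z → CRingTheory.fromℤ R z ≡ CRing.0# R → z ≡ + 0)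
    (X : ℕ → ℕ → CRing.Carrier R)
    (h : CRing.Carrier R)
    (X-suc : ∀ i j → X (suc i) j ≡ CRing._+_ R (X i j) h)
    (X-inj : ∀ i j i' j' → X i j ≡ X i' j' → i ≡ i' × j ≡ j')
    (n : ℕ) (n≢0 : ¬ (n ≡ 0))
    where
    open CRingTheory R
    open PolynomialFunctions R

    Y : ℕ → ℕ → Carrier
    Y i j = fromℕ (2 ℕ.^ i ℕ.* n ℕ.^ j)

    fromℕ≢0 : ∀ {k} → ¬ (k ≡ 0) → ¬ (fromℕ k ≡ 0#)
    fromℕ≢0 {k} k≢0 e with char0 (+ k) e
    ... | refl = k≢0 refl

    Y^≢0 : ∀ i j b → ¬ (Y i j ^ b ≡ 0#)
    Y^≢0 i j b e = fromℕ≢0 (λ q → zero-pow b q) (trans (fromℕ-^ _ b) e)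
      where
      zero-pow : ∀ b → ¬ ((2 ℕ.^ i ℕ.* n ℕ.^ j) ℕ.^ b ≡ 0)
      zero-pow b q = ne (ℕP.m^n≡0⇒m≡0 (2 ℕ.^ i ℕ.* n ℕ.^ j) b q)
        where
        ne : ¬ (2 ℕ.^ i ℕ.* n ℕ.^ j ≡ 0)
        ne r with ℕP.m*n≡0⇒m≡0∨n≡0 (2 ℕ.^ i) r
        ... | inj₂ s = n≢0 (ℕP.m^n≡0⇒m≡0 n j s)
        ... | inj₁ s with ℕP.m^n≡0⇒m≡0 2 i s
        ... | ()

    Y-suc : ∀ i j b → Y (suc i) j ^ b ≡ fromℕ (2 ℕ.^ b) * Y i j ^ b
    Y-suc i j b = begin
      Y (suc i) j ^ b                                  ≡⟨ cong (λ t → fromℕ t ^ b) (ℕP.*-assoc 2 (2 ℕ.^ i) (n ℕ.^ j)) ⟩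
      fromℕ (2 ℕ.* (2 ℕ.^ i ℕ.* n ℕ.^ j)) ^ b          ≡⟨ cong (_^ b) (fromℕ-* 2 (2 ℕ.^ i ℕ.* n ℕ.^ j)) ⟩
      (fromℕ 2 * Y i j) ^ b                            ≡⟨ ^-distrib-* (fromℕ 2) (Y i j) b ⟩
      fromℕ 2 ^ b * Y i j ^ b                          ≡⟨ cong (_* Y i j ^ b) (sym (fromℕ-^ 2 b)) ⟩
      fromℕ (2 ℕ.^ b) * Y i j ^ b                      ∎
      where open ≡-Reasoning

    -- The leading coefficient is kept as an integer, so that `elim-lead` is nonzero because ℤ has
    -- no zero divisors and 2ᵃ ≠ 2ᵇ for a ≠ b. The degree is only bounded by `D`, as the terms of
    -- one list may differ in degree.
    record Term (D : ℕ) : Set where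
      field
        expo    : ℕ
        fun     : Carrier → Carrier
        degree  : ℕ
        degree≤ : degree ℕ.≤ D
        lead    : ℤ
        lead≢0  : ¬ (lead ≡ + 0)
        isPoly  : IsPoly degree (fromℤ lead) fun
    open Term

    eval : ∀ {D} → List (Term D) → Carrier → Carrier → Carrier
    eval []       x y = 0#
    eval (t ∷ ts) x y = fun t x * y ^ expo t + eval ts x y

    Distinct : ∀ {D} → List (Term D) → Set
    Distinct = AllPairs (λ s t → ¬ (expo s ≡ expo t))

    two-pow : ℕ → ℤ
    two-pow b = + (2 ℕ.^ b)

    two-pow-inj : ∀ a b → 2 ℕ.^ a ≡ 2 ℕ.^ b → a ≡ b
    two-pow-inj a b e with ℕP.<-cmp a b
    ... | tri< a<b _ _ = ⊥-elim (ℕP.<-irrefl e (ℕP.^-monoʳ-< 2 ℕP.≤-refl a<b))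
    ... | tri≈ _ q _   = q
    ... | tri> _ _ b<a = ⊥-elim (ℕP.<-irrefl (sym e) (ℕP.^-monoʳ-< 2 ℕP.≤-refl b<a))

    elim : ∀ {D} → Term D → Term D → Carrier → Carrier
    elim t s x = fromℤ (two-pow (expo s)) * (fun t x * fun s (x + h))
               - fromℤ (two-pow (expo t)) * (fun t (x + h) * fun s x)

    elim-lead : ∀ {D} → Term D → Term D → ℤ
    elim-lead t s = (two-pow (expo s) ℤ.- two-pow (expo t)) ℤ.* (lead t ℤ.* lead s)

    elim-poly : ∀ {D} (t s : Term D) → IsPoly (degree t ℕ.+ degree s) (fromℤ (elim-lead t s)) (elim t s)
    elim-poly t s = poly-resp e eq (λ x → cong (_+_ _) (sym (lem x)))
       (poly-+ e (poly-* e A (poly-mul (degree t) (degree s) (isPoly t) (poly-shift (degree s) h (isPoly s))))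
                 (poly-* e (- B) (poly-mul (degree t) (degree s) (poly-shift (degree t) h (isPoly t)) (isPoly s))))
      where
      open Solver
      e = degree t ℕ.+ degree s
      A = fromℤ (two-pow (expo s))
      B = fromℤ (two-pow (expo t))
      lt = fromℤ (lead t)
      ls = fromℤ (lead s)
      lem : ∀ x → - (B * (fun t (x + h) * fun s x)) ≡ - B * (fun t (x + h) * fun s x)
      lem x = solve 2 (λ a b → :- (a :* b) := (:- a) :* b) refl B (fun t (x + h) * fun s x)
      eq : A * (lt * ls) + - B * (lt * ls) ≡ fromℤ (elim-lead t s)
      eq = sym (trans (fromℤ-* (two-pow (expo s) ℤ.- two-pow (expo t)) (lead t ℤ.* lead s))
        (trans (cong₂ _*_ (trans (fromℤ-+ (two-pow (expo s)) (ℤ.- two-pow (expo t))) (cong (_+_ A) (fromℤ-neg (two-pow (expo t)))))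
                          (fromℤ-* (lead t) (lead s)))
        (solve 3 (λ a b l → (a :- b) :* l := a :* l :+ (:- b) :* l) refl A B (lt * ls))))

    elim-lead≢0 : ∀ {D} (t s : Term D) → ¬ (expo t ≡ expo s) → ¬ (elim-lead t s ≡ + 0)
    elim-lead≢0 t s ne e with ℤP.i*j≡0⇒i≡0∨j≡0 (two-pow (expo s) ℤ.- two-pow (expo t)) e
    ... | inj₁ q = ne (sym (two-pow-inj (expo s) (expo t) (ℤP.+-injective (ℤP.i-j≡0⇒i≡j (two-pow (expo s)) (two-pow (expo t)) q))))
    ... | inj₂ q with ℤP.i*j≡0⇒i≡0∨j≡0 (lead t) q
    ... | inj₁ r = lead≢0 t r
    ... | inj₂ r = lead≢0 s r

    elim-term : ∀ {D} (t s : Term D) → ¬ (expo t ≡ expo s) → Term (D ℕ.+ D)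
    elim-term t s ne = record
      { expo = expo s ; fun = elim t s ; degree = degree t ℕ.+ degree s
      ; degree≤ = ℕP.+-mono-≤ (degree≤ t) (degree≤ s)
      ; lead = elim-lead t s ; lead≢0 = elim-lead≢0 t s ne ; isPoly = elim-poly t s }

    elim-all : ∀ {D} (t : Term D) (ts : List (Term D)) → All (λ s → ¬ (expo t ≡ expo s)) ts → List (Term (D ℕ.+ D))
    elim-all t []       []       = []
    elim-all t (s ∷ ts) (p ∷ ps) = elim-term t s p ∷ elim-all t ts ps

    elim-all-length : ∀ {D} (t : Term D) ts ps → length (elim-all t ts ps) ≡ length ts
    elim-all-length t []       []       = refl
    elim-all-length t (s ∷ ts) (p ∷ ps) = cong suc (elim-all-length t ts ps)

    elim-all-All : ∀ {D} {e : ℕ} (t : Term D) ts ps → All (λ s → ¬ (e ≡ expo s)) ts → All (λ s → ¬ (e ≡ expo s)) (elim-all t ts ps)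
    elim-all-All t []       []       []       = []
    elim-all-All t (s ∷ ts) (p ∷ ps) (q ∷ qs) = q ∷ elim-all-All t ts ps qs

    elim-all-distinct : ∀ {D} (t : Term D) ts ps → Distinct ts → Distinct (elim-all t ts ps)
    elim-all-distinct t []       []       []       = []
    elim-all-distinct t (s ∷ ts) (p ∷ ps) (q ∷ qs) = elim-all-All t ts ps q ∷ elim-all-distinct t ts ps qs

    -- Moving one column to the right doubles y and so multiplies y ^ b by 2ᵇ. The factor 2ᵇ built
    -- into `elim` is therefore absorbed, and the eliminated expression combines values from two
    -- adjacent columns.
    elim-eval : ∀ {D} (t : Term D) ts ps i j →
      eval (elim-all t ts ps) (X i j) (Y i j)
      ≡ fun t (X i j) * eval ts (X (suc i) j) (Y (suc i) j)
        - fromℤ (two-pow (expo t)) * (fun t (X (suc i) j) * eval ts (X i j) (Y i j))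
    elim-eval t [] [] i j = solve 3 (λ a b c → z := a :* z :- b :* (c :* z)) refl _ _ _
      where
      open Solver
      z : ∀ {k} → Polynomial k
      z = con (+ 0)
    elim-eval t (s ∷ ts) (p ∷ ps) i j rewrite elim-eval t ts ps i j | Y-suc i j (expo s) | X-suc i j =
      solve 9 (λ A B f f' s s' y E E' →
          (A :* (f :* s') :- B :* (f' :* s)) :* y :+ (f :* E' :- B :* (f' :* E))
          := f :* (s' :* (A :* y) :+ E') :- B :* (f' :* (s :* y :+ E))) refl
        (fromℤ (two-pow (expo s))) (fromℤ (two-pow (expo t))) (fun t (X i j)) (fun t (X i j + h))
        (fun s (X i j)) (fun s (X i j + h)) (Y i j ^ expo s)
        (eval ts (X i j) (Y i j)) (eval ts (X i j + h) (Y (suc i) j))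
      where open Solver

    Vanishes : ∀ {D} → ℕ → ℕ → List (Term D) → Set
    Vanishes I J ts = ∀ i j → i ℕ.< I → j ℕ.< J → eval ts (X i j) (Y i j) ≡ 0#

    -- The contributions of `t` to the two columns cancel, since f f' y' = 2ᵃ f f' y with a its
    -- exponent; what is left combines two full sums that vanish by hypothesis.
    elim-vanishes : ∀ {D} (t : Term D) ts ps I J → Vanishes (suc I) J (t ∷ ts) → Vanishes I J (elim-all t ts ps)
    elim-vanishes t ts ps I J v i j i<I j<J = begin
      eval (elim-all t ts ps) (X i j) (Y i j)   ≡⟨ elim-eval t ts ps i j ⟩
      f * E' - B * (f' * E)
        ≡⟨ solve 7 (λ f f' B y E E' y' → f :* E' :- B :* (f' :* E) := f :* (f' :* y' :+ E') :- B :* (f' :* (f :* y :+ E)) :- f :* f' :* (y' :- B :* y)) refl f f' B y E E' y' ⟩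
      f * (f' * y' + E') - B * (f' * (f * y + E)) - f * f' * (y' - B * y)
        ≡⟨ cong₂ (λ a b → f * a - B * (f' * b) - f * f' * (y' - B * y)) (v (suc i) j (ℕ.s≤s i<I) j<J) (v i j (ℕP.m<n⇒m<1+n i<I) j<J) ⟩
      f * 0# - B * (f' * 0#) - f * f' * (y' - B * y) ≡⟨ cong (λ a → f * 0# - B * (f' * 0#) - f * f' * (a - B * y)) (Y-suc i j (expo t)) ⟩
      f * 0# - B * (f' * 0#) - f * f' * (B * y - B * y) ≡⟨ solve 4 (λ f f' B y → f :* con (+ 0) :- B :* (f' :* con (+ 0)) :- f :* f' :* (B :* y :- B :* y) := con (+ 0)) refl f f' B y ⟩
      0# ∎
      where
      open ≡-Reasoning
      open Solver
      f = fun t (X i j)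
      f' = fun t (X (suc i) j)
      B = fromℤ (two-pow (expo t))
      y = Y i j ^ expo t
      y' = Y (suc i) j ^ expo t
      E = eval ts (X i j) (Y i j)
      E' = eval ts (X (suc i) j) (Y (suc i) j)

    -- As y is never zero, `fun t` itself vanishes at the I * J distinct points, which division by
    -- `J` with remainder enumerates; that is more than its degree permits.
    single : ∀ {D} I J (t : Term D) → D ℕ.< I ℕ.* J → Vanishes I J (t ∷ []) → ⊥
    single {D} I zero    t D<IJ v = ℕP.n≮0 (subst (D ℕ.<_) (ℕP.*-zeroʳ I) D<IJ)
    single {D} I J@(suc J₀) t D<IJ v = lead≢0 t (char0 (lead t) (poly-roots dom (degree t) (isPoly t) pt pt-inj pt-root))
      where
      pt : ℕ → Carrier
      pt k = X (k DM./ J) (k DM.% J)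
      pt-inj : ∀ k l → k ℕ.≤ degree t → l ℕ.≤ degree t → pt k ≡ pt l → k ≡ l
      pt-inj k l _ _ e with X-inj _ _ _ _ e
      ... | p , q = trans (DM.m≡m%n+[m/n]*n k J) (trans (cong₂ (λ a b → a ℕ.+ b ℕ.* J) q p) (sym (DM.m≡m%n+[m/n]*n l J)))
      pt-root : ∀ k → k ℕ.≤ degree t → fun t (pt k) ≡ 0#
      pt-root k k≤ with dom (trans (sym (+-identityʳ _)) (v (k DM./ J) (k DM.% J) lt (DM.m%n<n k J)))
        where
        lt : k DM./ J ℕ.< I
        lt = DM.m<n*o⇒m/o<n (ℕP.≤-<-trans (ℕP.≤-trans k≤ (degree≤ t)) D<IJ)
      ... | inj₁ r = r
      ... | inj₂ r = ⊥-elim (Y^≢0 (k DM./ J) (k DM.% J) (expo t) r)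

    -- An elimination removes one term, doubles the degree bound and costs one column: 2 ^ ℓ * D is
    -- invariant, and the ℓ spare columns are exactly used up.
    no-terms : ∀ {D} ℓ I J (t : Term D) ts → length ts ≡ ℓ → Distinct (t ∷ ts) →
      2 ℕ.^ ℓ ℕ.* D ℕ.< I ℕ.* J → Vanishes (ℓ ℕ.+ I) J (t ∷ ts) → ⊥
    no-terms {D} zero I J t [] len dist lt v = single I J t (subst (ℕ._< I ℕ.* J) (ℕP.+-identityʳ D) lt) v
    no-terms {D} (suc ℓ) I J t (s ∷ ts) len ((p ∷ ps) ∷ dist) lt v =
      no-terms ℓ I J (elim-term t s p) (elim-all t ts ps) (trans (elim-all-length t ts ps) (ℕP.suc-injective len))
        (elim-all-distinct t (s ∷ ts) (p ∷ ps) dist)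
        (subst (ℕ._< I ℕ.* J) eq lt)
        (elim-vanishes t (s ∷ ts) (p ∷ ps) (ℓ ℕ.+ I) J v)
      where
      eq : 2 ℕ.^ suc ℓ ℕ.* D ≡ 2 ℕ.^ ℓ ℕ.* (D ℕ.+ D)
      eq = trans (cong (ℕ._* D) (ℕP.*-comm 2 (2 ℕ.^ ℓ))) (trans (ℕP.*-assoc (2 ℕ.^ ℓ) 2 D)
        (cong (λ k → 2 ℕ.^ ℓ ℕ.* (D ℕ.+ k)) (ℕP.+-identityʳ D)))

    coeff-poly : (ℕ → ℤ) → ℕ → Carrier → Carrier
    coeff-poly c A x = sum A (λ a → fromℤ (c a) * x ^ a)

    coeff-poly-bound : ∀ c A → IsPoly A 0# (coeff-poly c A)
    coeff-poly-bound c zero    x = refl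
    coeff-poly-bound c (suc A) = poly-weaken A (poly-resp A refl (λ _ → refl)
      (poly-+ A (coeff-poly-bound c A) (poly-* A (fromℤ (c A)) (poly-^ A))))

    coeff-poly-lead : ∀ c A →
      (∀ a → a ℕ.< A → c a ≡ + 0) ⊎
      Σ ℕ λ d → d ℕ.< A × Σ ℤ λ ℓ → ¬ (ℓ ≡ + 0) × IsPoly d (fromℤ ℓ) (coeff-poly c A)
    coeff-poly-lead c zero = inj₁ (λ a ())
    coeff-poly-lead c (suc A) with c A ℤP.≟ + 0
    ... | no ne = inj₂ (A , ℕP.≤-refl , c A , ne ,
            poly-resp A (trans (+-identityˡ _) (*-identityʳ _)) (λ _ → refl)
              (poly-+ A (coeff-poly-bound c A) (poly-* A (fromℤ (c A)) (poly-^ A))))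
    ... | yes e with coeff-poly-lead c A
    ...   | inj₁ h = inj₁ λ a a<1+A → case a a<1+A
      where
      case : ∀ a → a ℕ.< suc A → c a ≡ + 0
      case a (ℕ.s≤s a≤A) with ℕP.m≤n⇒m<n∨m≡n a≤A
      ... | inj₁ a<A  = h a a<A
      ... | inj₂ refl = e
    ...   | inj₂ (d , d<A , ℓ , ne , p) = inj₂ (d , ℕP.m<n⇒m<1+n d<A , ℓ , ne ,
              poly-resp d refl (λ x → sym (trans (cong (_+_ _) (trans (cong (λ t → fromℤ t * x ^ A) e) (zeroˡ _))) (+-identityʳ _))) p)

    private
      -- Powers of y with vanishing coefficient polynomial are left out, so every remaining term has
      -- a nonzero leading coefficient. The exponents listed so far stay below `b`, which makes a
      -- new term with exponent `b` distinct from them.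
      terms : (c : ℕ → ℕ → ℤ) (A b : ℕ) → Σ (List (Term A)) λ ts →
        Distinct ts × All (λ t → expo t ℕ.< b) ts × length ts ℕ.≤ b ×
        (∀ x y → eval ts x y ≡ sum b (λ k → coeff-poly (λ a → c a k) A x * y ^ k)) ×
        (length ts ≡ 0 → ∀ a k → a ℕ.< A → k ℕ.< b → c a k ≡ + 0)
      terms c A zero = [] , [] , [] , ℕ.z≤n , (λ _ _ → refl) , λ _ _ _ _ ()
      terms c A (suc b) with terms c A b | coeff-poly-lead (λ a → c a b) A
      ... | ts , ds , bs , l , ev , z | inj₁ h =
        ts , ds , All.map ℕP.m<n⇒m<1+n bs , ℕP.m≤n⇒m≤1+n l
        , (λ x y → trans (ev x y) (sym (trans (cong (_+_ _) (trans (cong (_* y ^ b) (van x)) (zeroˡ _))) (+-identityʳ _))))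
        , λ e a k a<A k<1+b → case e a k a<A k<1+b
        where
        van : ∀ x → coeff-poly (λ a → c a b) A x ≡ 0#
        van x = trans (sum-cong A (λ a a<A → trans (cong (λ t → fromℤ t * x ^ a) (h a a<A)) (zeroˡ _))) (sum-0 A)
        case : length ts ≡ 0 → ∀ a k → a ℕ.< A → k ℕ.< suc b → c a k ≡ + 0
        case e a k a<A (ℕ.s≤s k≤b) with ℕP.m≤n⇒m<n∨m≡n k≤b
        ... | inj₁ k<b  = z e a k a<A k<b
        ... | inj₂ refl = h a a<A
      ... | ts , ds , bs , l , ev , z | inj₂ (d , d<A , ℓ , ne , p) =
        record { expo = b ; fun = coeff-poly (λ a → c a b) A ; degree = d ; degree≤ = ℕP.<⇒≤ d<A
               ; lead = ℓ ; lead≢0 = ne ; isPoly = p } ∷ ts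
        , All.map (λ lt e → ℕP.<-irrefl (sym e) lt) bs ∷ ds
        , ℕP.≤-refl ∷ All.map ℕP.m<n⇒m<1+n bs , ℕ.s≤s l
        , (λ x y → trans (+-comm _ _) (cong (_+ _) (ev x y)))
        , λ ()

    -- At most `b` terms occur, hence fewer than `b` eliminations: the `b` additional columns and
    -- the factor 2 ^ b cover the worst case.
    zero-estimate : ∀ (c : ℕ → ℕ → ℤ) A b I J → 2 ℕ.^ b ℕ.* A ℕ.< I ℕ.* J →
      (∀ i j → i ℕ.< b ℕ.+ I → j ℕ.< J → sum b (λ k → coeff-poly (λ a → c a k) A (X i j) * Y i j ^ k) ≡ 0#) →
      ∀ a k → a ℕ.< A → k ℕ.< b → c a k ≡ + 0
    zero-estimate c A b I J lt v with terms c A b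
    ... | [] , _ , _ , _ , _ , z = z refl
    ... | t ∷ ts , ds , _ , l , ev , _ = ⊥-elim (no-terms (length ts) I J t ts refl ds
            (ℕP.≤-<-trans (ℕP.*-monoˡ-≤ A (ℕP.^-monoʳ-≤ 2 (ℕP.<⇒≤ l))) lt)
            (λ i j i< j<J → trans (ev _ _) (v i j (ℕP.<-≤-trans i< (ℕP.+-monoˡ-≤ I (ℕP.<⇒≤ l))) j<J)))

-- The rings ℤ[β] for quadratic and cubic β, with their Liouville inequalities.

module NumberRings where

  open OrderedField
  open import Data.Empty using (⊥-elim)
  open import Data.Integer as ℤ using (ℤ; +_; -[1+_])
  import Data.Integer.Properties as ℤP
  open import Data.Nat as ℕ using (ℕ; zero; suc)
  import Data.Nat.Properties as ℕP
  open import Data.Product using (Σ; _×_; _,_; proj₁; proj₂)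
  open import Data.Sum using (_⊎_; inj₁; inj₂)
  open import Relation.Binary.PropositionalEquality
  open import Relation.Nullary using (¬_; yes; no)

  -- A ring ℤ[β] with βᵏ = m, together with the size of the coordinates (Bd), the
  -- evaluation ev ρ at an approximate value ρ of β, and a Liouville inequality.
  record NumberRing (F : OField) (k m : ℕ) : Set₁ where
    private module F = OFieldTheory F
    field
      ring : CRing
    private module R = CRingTheory ring
    field
      domain : ∀ {x y} → x R.* y ≡ R.0# → x ≡ R.0# ⊎ y ≡ R.0#
      char0  : ∀ z → R.fromℤ z ≡ R.0# → z ≡ + 0
      β      : R.Carrier
      independent : ∀ a b → R.fromℤ a R.+ R.fromℤ b R.* β ≡ R.0# → a ≡ + 0 × b ≡ + 0
      Bd     : ℕ → R.Carrier → Set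
      Bd-0   : Bd 0 R.0#
      Bd-1   : Bd 1 R.1#
      Bd-+   : ∀ {U V x y} → Bd U x → Bd V y → Bd (U ℕ.+ V) (x R.+ y)
      Bd-ℤ   : ∀ {C U c x} → ℤ.∣ c ∣ ℕ.≤ C → Bd U x → Bd (C ℕ.* U) (R.fromℤ c R.* x)
      Bd-step : ∀ {U x} a b → Bd U x → Bd ((a ℕ.+ suc m ℕ.* b) ℕ.* U) (x R.* (R.fromℕ a R.+ R.fromℕ b R.* β))
      Bd-mono : ∀ {U V x} → U ℕ.≤ V → Bd U x → Bd V x
      ev     : F.Carrier → R.Carrier → F.Carrier
      ev-0   : ∀ ρ → ev ρ R.0# ≡ F.0#
      ev-1   : ∀ ρ → ev ρ R.1# ≡ F.1#
      ev-+   : ∀ ρ x y → ev ρ (x R.+ y) ≡ ev ρ x F.+ ev ρ y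
      ev-ℤ   : ∀ ρ c x → ev ρ (R.fromℤ c R.* x) ≡ F.fromℤ c F.* ev ρ x
      -- Because ρᵏ only approximates m, evaluation is multiplicative up to a multiple of ρᵏ - m.
      -- The factor w is the top coordinate of x, the one that multiplication by β carries back to
      -- lower degree through βᵏ = m.
      ev-step : ∀ ρ {U x} a b → Bd U x → Σ F.Carrier λ w → (F.∣ w ∣≤ F.fromℕ U) ×
        ev ρ (x R.* (R.fromℕ a R.+ R.fromℕ b R.* β))
          ≡ ev ρ x F.* (F.fromℕ a F.+ F.fromℕ b F.* ρ) F.- (ρ F.^ k F.- F.fromℕ m) F.* (F.fromℕ b F.* w)
      -- The norm of x is an integer of the form cofactor · ev ρ x + cofactor' · (ρᵏ - m), up to
      -- signs. The number 6 U³ M⁴ bounds both cofactors for k = 2 and for k = 3, so the norm has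
      -- absolute value below 1 and vanishes.
      liouville : ∀ {U M x ρ ε δ} → 1 ℕ.≤ U → 1 ℕ.≤ M → m ℕ.≤ M → F.0# F.≤ ρ → ρ F.≤ F.fromℕ M →
        Bd U x → F.∣ ev ρ x ∣≤ ε → F.∣ ρ F.^ k F.- F.fromℕ m ∣≤ δ →
        ¬ (F.1# F.≤ F.fromℕ 6 F.* (F.fromℕ U F.^ 3 F.* F.fromℕ M F.^ 4) F.* (ε F.+ δ)) → x ≡ R.0#

  open import Data.Integer using () renaming (_+_ to _⊕_; _*_ to _⊛_; -_ to ⊖_; _-_ to _⊝_)

  private
    i*i≡0 : ∀ i → i ⊛ i ≡ + 0 → i ≡ + 0
    i*i≡0 i e with ℤP.i*j≡0⇒i≡0∨j≡0 i e
    ... | inj₁ p = p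
    ... | inj₂ p = p

    abs-+-≤ : ∀ {U V} i j → ℤ.∣ i ∣ ℕ.≤ U → ℤ.∣ j ∣ ℕ.≤ V → ℤ.∣ i ⊕ j ∣ ℕ.≤ U ℕ.+ V
    abs-+-≤ i j p q = ℕP.≤-trans (ℤP.∣i+j∣≤∣i∣+∣j∣ i j) (ℕP.+-mono-≤ p q)

    abs-*-≤ : ∀ {U V} i j → ℤ.∣ i ∣ ℕ.≤ U → ℤ.∣ j ∣ ℕ.≤ V → ℤ.∣ i ⊛ j ∣ ℕ.≤ U ℕ.* V
    abs-*-≤ i j p q = subst (ℕ._≤ _) (sym (ℤP.abs-* i j)) (ℕP.*-mono-≤ p q)

  module Quadratic (m : ℕ) (noRoot : ∀ t s → t ⊛ t ≡ + m ⊛ (s ⊛ s) → s ≡ + 0) where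
    open import Data.Integer.Solver using (module +-*-Solver)

    Q : Set
    Q = ℤ × ℤ

    pair : ∀ {u v u' v' : ℤ} → u ≡ u' → v ≡ v' → (u , v) ≡ (u' , v')
    pair refl refl = refl

    _+Q_ _*Q_ : Q → Q → Q
    (u , v) +Q (u' , v') = u ⊕ u' , v ⊕ v'
    (u , v) *Q (u' , v') = u ⊛ u' ⊕ + m ⊛ (v ⊛ v') , u ⊛ v' ⊕ v ⊛ u'
    -Q_ : Q → Q
    -Q (u , v) = ⊖ u , ⊖ v

    *Q-comm : ∀ x y → x *Q y ≡ y *Q x
    *Q-comm (u , v) (u' , v') = pair
      (solve 5 (λ m u v u' v' → u :* u' :+ m :* (v :* v') := u' :* u :+ m :* (v' :* v)) refl (+ m) u v u' v')
      (solve 4 (λ u v u' v' → u :* v' :+ v :* u' := u' :* v :+ v' :* u) refl u v u' v')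
      where open +-*-Solver

    *Q-identityˡ : ∀ x → (+ 1 , + 0) *Q x ≡ x
    *Q-identityˡ (u , v) = pair
      (solve 3 (λ m u v → con (+ 1) :* u :+ m :* (con (+ 0) :* v) := u) refl (+ m) u v)
      (solve 2 (λ u v → con (+ 1) :* v :+ con (+ 0) :* u := v) refl u v)
      where open +-*-Solver

    *Q-distribˡ : ∀ x y z → x *Q (y +Q z) ≡ (x *Q y) +Q (x *Q z)
    *Q-distribˡ (a , b) (c , d) (e , f) = pair
      (solve 7 (λ m a b c d e f → a :* (c :+ e) :+ m :* (b :* (d :+ f)) := (a :* c :+ m :* (b :* d)) :+ (a :* e :+ m :* (b :* f))) refl (+ m) a b c d e f)
      (solve 6 (λ a b c d e f → a :* (d :+ f) :+ b :* (c :+ e) := (a :* d :+ b :* c) :+ (a :* f :+ b :* e)) refl a b c d e f)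
      where open +-*-Solver

    *Q-assoc : ∀ x y z → (x *Q y) *Q z ≡ x *Q (y *Q z)
    *Q-assoc (a , b) (c , d) (e , f) = pair
      (solve 7 (λ m a b c d e f → (a :* c :+ m :* (b :* d)) :* e :+ m :* ((a :* d :+ b :* c) :* f)
          := a :* (c :* e :+ m :* (d :* f)) :+ m :* (b :* (c :* f :+ d :* e))) refl (+ m) a b c d e f)
      (solve 7 (λ m a b c d e f → (a :* c :+ m :* (b :* d)) :* f :+ (a :* d :+ b :* c) :* e
          := a :* (c :* f :+ d :* e) :+ b :* (c :* e :+ m :* (d :* f))) refl (+ m) a b c d e f)
      where open +-*-Solver

    ring : CRing
    ring = record
      { Carrier = Q ; _+_ = _+Q_ ; _*_ = _*Q_ ; -_ = -Q_ ; 0# = + 0 , + 0 ; 1# = + 1 , + 0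
      ; isCommutativeRing = record
        { isRing = record
          { +-isAbelianGroup = record
            { isGroup = record
              { isMonoid = record
                { isSemigroup = record
                  { isMagma = record { isEquivalence = isEquivalence ; ∙-cong = cong₂ _+Q_ }
                  ; assoc = λ x y z → pair (ℤP.+-assoc (proj₁ x) (proj₁ y) (proj₁ z)) (ℤP.+-assoc (proj₂ x) (proj₂ y) (proj₂ z)) }
                ; identity = (λ x → pair (ℤP.+-identityˡ (proj₁ x)) (ℤP.+-identityˡ (proj₂ x)))
                           , (λ x → pair (ℤP.+-identityʳ (proj₁ x)) (ℤP.+-identityʳ (proj₂ x))) }
              ; inverse = (λ x → pair (ℤP.+-inverseˡ (proj₁ x)) (ℤP.+-inverseˡ (proj₂ x)))
                        , (λ x → pair (ℤP.+-inverseʳ (proj₁ x)) (ℤP.+-inverseʳ (proj₂ x)))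
              ; ⁻¹-cong = cong -Q_ }
            ; comm = λ x y → pair (ℤP.+-comm (proj₁ x) (proj₁ y)) (ℤP.+-comm (proj₂ x) (proj₂ y)) }
          ; *-cong = cong₂ _*Q_
          ; *-assoc = *Q-assoc
          ; *-identity = *Q-identityˡ , (λ x → trans (*Q-comm x _) (*Q-identityˡ x))
          ; distrib = *Q-distribˡ , (λ x y z → trans (*Q-comm (y +Q z) x) (trans (*Q-distribˡ x y z) (cong₂ _+Q_ (*Q-comm x y) (*Q-comm x z)))) }
        ; *-comm = *Q-comm } }

    module R = CRingTheory ring

    fromℕ-pair : ∀ n → R.fromℕ n ≡ (+ n , + 0)
    fromℕ-pair zero    = refl
    fromℕ-pair (suc n) rewrite fromℕ-pair n = refl

    fromℤ-pair : ∀ z → R.fromℤ z ≡ (z , + 0)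
    fromℤ-pair (+ n)    = fromℕ-pair n
    fromℤ-pair -[1+ n ] = cong -Q_ (fromℕ-pair (suc n))

    norm : Q → ℤ
    norm (u , v) = u ⊛ u ⊝ + m ⊛ (v ⊛ v)

    norm≡0 : ∀ x → norm x ≡ + 0 → x ≡ R.0#
    norm≡0 (u , v) e with noRoot u v (ℤP.i-j≡0⇒i≡j (u ⊛ u) _ e)
    ... | refl = pair (i*i≡0 u (trans (solve 2 (λ u m → u :* u := u :* u :- m :* (con (+ 0) :* con (+ 0))) refl u (+ m)) e)) refl
      where open +-*-Solver

    conj-* : ∀ u v u' v' → (u , ⊖ v) *Q ((u , v) *Q (u' , v')) ≡ (norm (u , v) ⊛ u' , norm (u , v) ⊛ v')
    conj-* u v u' v' = pair
      (solve 5 (λ m u v u' v' → u :* (u :* u' :+ m :* (v :* v')) :+ m :* ((:- v) :* (u :* v' :+ v :* u')) := (u :* u :- m :* (v :* v)) :* u') refl (+ m) u v u' v')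
      (solve 5 (λ m u v u' v' → u :* (u :* v' :+ v :* u') :+ (:- v) :* (u :* u' :+ m :* (v :* v')) := (u :* u :- m :* (v :* v)) :* v') refl (+ m) u v u' v')
      where open +-*-Solver

    -- Multiplying x y = 0 by the conjugate of x gives N(x) y = 0 with N(x) an integer, and the norm
    -- vanishes only at zero.
    domain : ∀ {x y} → x *Q y ≡ R.0# → x ≡ R.0# ⊎ y ≡ R.0#
    domain {u , v} {u' , v'} e with norm (u , v) ℤP.≟ + 0
    ... | yes p = inj₁ (norm≡0 _ p)
    ... | no ne = inj₂ (pair (kill u' (cong proj₁ q)) (kill v' (cong proj₂ q)))
      where
      q : (norm (u , v) ⊛ u' , norm (u , v) ⊛ v') ≡ R.0#
      q = trans (sym (conj-* u v u' v')) (trans (cong (_*Q_ (u , ⊖ v)) e) (R.zeroʳ (u , ⊖ v)))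
      kill : ∀ i → norm (u , v) ⊛ i ≡ + 0 → i ≡ + 0
      kill i z with ℤP.i*j≡0⇒i≡0∨j≡0 (norm (u , v)) z
      ... | inj₁ p = ⊥-elim (ne p)
      ... | inj₂ p = p

    linear : ∀ a b → R.fromℤ a R.+ R.fromℤ b R.* (+ 0 , + 1) ≡ (a , b)
    linear a b rewrite fromℤ-pair a | fromℤ-pair b = pair
      (solve 3 (λ m a b → a :+ (b :* con (+ 0) :+ m :* (con (+ 0) :* con (+ 1))) := a) refl (+ m) a b)
      (solve 1 (λ b → con (+ 0) :+ (b :* con (+ 1) :+ con (+ 0) :* con (+ 0)) := b) refl b)
      where open +-*-Solver

    step : ∀ u v a b → (u , v) *Q (R.fromℕ a +Q (R.fromℕ b *Q (+ 0 , + 1))) ≡ (u ⊛ + a ⊕ + m ⊛ (v ⊛ + b) , u ⊛ + b ⊕ v ⊛ + a)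
    step u v a b = cong ((u , v) *Q_) (linear (+ a) (+ b))

    Bd : ℕ → Q → Set
    Bd U (u , v) = ℤ.∣ u ∣ ℕ.≤ U × ℤ.∣ v ∣ ℕ.≤ U

    scale : ∀ c u v → R.fromℤ c *Q (u , v) ≡ (c ⊛ u , c ⊛ v)
    scale c u v rewrite fromℤ-pair c = pair
      (solve 4 (λ m c u v → c :* u :+ m :* (con (+ 0) :* v) := c :* u) refl (+ m) c u v)
      (solve 3 (λ c u v → c :* v :+ con (+ 0) :* u := c :* v) refl c u v)
      where open +-*-Solver

    Bd-step : ∀ {U x} a b → Bd U x → Bd ((a ℕ.+ suc m ℕ.* b) ℕ.* U) (x *Q (R.fromℕ a +Q (R.fromℕ b *Q (+ 0 , + 1))))
    Bd-step {U} {u , v} a b (p , q) = subst (Bd ((a ℕ.+ suc m ℕ.* b) ℕ.* U)) (sym (step u v a b))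
      ( ℕP.≤-trans (abs-+-≤ (u ⊛ + a) (+ m ⊛ (v ⊛ + b)) (abs-*-≤ u (+ a) p ℕP.≤-refl) (abs-*-≤ (+ m) (v ⊛ + b) ℕP.≤-refl (abs-*-≤ v (+ b) q ℕP.≤-refl)))
          (subst (ℕ._≤ (a ℕ.+ suc m ℕ.* b) ℕ.* U) (e₁ U a b m) (ℕP.*-monoˡ-≤ U (ℕP.+-monoʳ-≤ a (ℕP.m≤n+m (m ℕ.* b) b))))
      , ℕP.≤-trans (abs-+-≤ (u ⊛ + b) (v ⊛ + a) (abs-*-≤ u (+ b) p ℕP.≤-refl) (abs-*-≤ v (+ a) q ℕP.≤-refl))
          (subst (ℕ._≤ (a ℕ.+ suc m ℕ.* b) ℕ.* U) (e₂ U a b) (ℕP.*-monoˡ-≤ U (ℕP.+-monoʳ-≤ a (ℕP.m≤m+n b (m ℕ.* b))))) )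
      where
      open import Data.Nat.Tactic.RingSolver using (solve-∀)
      e₁ : ∀ U a b m → (a ℕ.+ m ℕ.* b) ℕ.* U ≡ U ℕ.* a ℕ.+ m ℕ.* (U ℕ.* b)
      e₁ = solve-∀
      e₂ : ∀ U a b → (a ℕ.+ b) ℕ.* U ≡ U ℕ.* b ℕ.+ U ℕ.* a
      e₂ = solve-∀

    module _ (F : OField) where
      private module F = OFieldTheory F
      open F using (∣_∣≤_)

      ev : F.Carrier → Q → F.Carrier
      ev ρ (u , v) = F.fromℤ u F.+ F.fromℤ v F.* ρ

      ev-+ : ∀ ρ x y → ev ρ (x +Q y) ≡ ev ρ x F.+ ev ρ y
      ev-+ ρ (u , v) (u' , v') = trans (cong₂ (λ s t → s F.+ t F.* ρ) (F.fromℤ-+ u u') (F.fromℤ-+ v v')) (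
        solve 5 (λ u v u' v' ρ → (u :+ u') :+ (v :+ v') :* ρ := (u :+ v :* ρ) :+ (u' :+ v' :* ρ)) refl
          (F.fromℤ u) (F.fromℤ v) (F.fromℤ u') (F.fromℤ v') ρ)
        where open F.Solver

      ev-ℤ : ∀ ρ c x → ev ρ (R.fromℤ c *Q x) ≡ F.fromℤ c F.* ev ρ x
      ev-ℤ ρ c (u , v) = trans (cong (ev ρ) (scale c u v)) (trans (cong₂ (λ s t → s F.+ t F.* ρ) (F.fromℤ-* c u) (F.fromℤ-* c v)) (
        solve 4 (λ c u v ρ → c :* u :+ (c :* v) :* ρ := c :* (u :+ v :* ρ)) refl (F.fromℤ c) (F.fromℤ u) (F.fromℤ v) ρ))
        where open F.Solver

      ev-step : ∀ ρ {U x} a b → Bd U x → Σ F.Carrier λ w → (∣ w ∣≤ F.fromℕ U) ×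
        ev ρ (x *Q (R.fromℕ a +Q (R.fromℕ b *Q (+ 0 , + 1))))
          ≡ ev ρ x F.* (F.fromℕ a F.+ F.fromℕ b F.* ρ) F.- (ρ F.^ 2 F.- F.fromℕ m) F.* (F.fromℕ b F.* w)
      ev-step ρ {U} {u , v} a b (p , q) = F.fromℤ v , F.abs-fromℤ {v} q , eq
        where
        open F.Solver
        h : F.fromℤ (u ⊛ + a ⊕ + m ⊛ (v ⊛ + b)) ≡ F.fromℤ u F.* F.fromℕ a F.+ F.fromℕ m F.* (F.fromℤ v F.* F.fromℕ b)
        h = trans (F.fromℤ-+ (u ⊛ + a) _) (cong₂ F._+_ (F.fromℤ-* u (+ a)) (trans (F.fromℤ-* (+ m) _) (cong (F._*_ _) (F.fromℤ-* v (+ b)))))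
        h' : F.fromℤ (u ⊛ + b ⊕ v ⊛ + a) ≡ F.fromℤ u F.* F.fromℕ b F.+ F.fromℤ v F.* F.fromℕ a
        h' = trans (F.fromℤ-+ (u ⊛ + b) _) (cong₂ F._+_ (F.fromℤ-* u (+ b)) (F.fromℤ-* v (+ a)))
        eq : ev ρ ((u , v) *Q (R.fromℕ a +Q (R.fromℕ b *Q (+ 0 , + 1))))
          ≡ ev ρ (u , v) F.* (F.fromℕ a F.+ F.fromℕ b F.* ρ) F.- (ρ F.^ 2 F.- F.fromℕ m) F.* (F.fromℕ b F.* F.fromℤ v)
        eq = trans (cong (ev ρ) (step u v a b)) (trans (cong₂ (λ s t → s F.+ t F.* ρ) h h')
          (trans (
          solve 6 (λ u v a b m ρ → (u :* a :+ m :* (v :* b)) :+ (u :* b :+ v :* a) :* ρ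
             := (u :+ v :* ρ) :* (a :+ b :* ρ) :- (ρ :* ρ :- m) :* (b :* v)) refl
             (F.fromℤ u) (F.fromℤ v) (F.fromℕ a) (F.fromℕ b) (F.fromℕ m) ρ)
          (cong (λ t → ev ρ (u , v) F.* (F.fromℕ a F.+ F.fromℕ b F.* ρ) F.- (ρ F.* t F.- F.fromℕ m) F.* (F.fromℕ b F.* F.fromℤ v)) (sym (F.*-identityʳ ρ)))))

      liouville : ∀ {U M x ρ ε δ} → 1 ℕ.≤ U → 1 ℕ.≤ M → m ℕ.≤ M → F.0# F.≤ ρ → ρ F.≤ F.fromℕ M →
        Bd U x → ∣ ev ρ x ∣≤ ε → ∣ ρ F.^ 2 F.- F.fromℕ m ∣≤ δ →
        ¬ (F.1# F.≤ F.fromℕ 6 F.* (F.fromℕ U F.^ 3 F.* F.fromℕ M F.^ 4) F.* (ε F.+ δ)) → x ≡ R.0#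
      liouville {U} {M} {u , v} {ρ} {ε} {δ} 1≤U 1≤M m≤M 0≤ρ ρ≤M (p , q) hε hδ small =
        norm≡0 (u , v) (F.fromℤ-small (norm (u , v)) (subst (∣_∣≤ _) (sym eq) bound) small)
        where
        open F hiding (_+_; _*_; _-_; -_; _^_)
        open F using (_+_; _*_; _-_; -_; _^_)
        u' = fromℤ u
        v' = fromℤ v
        m' = fromℕ m
        Û = fromℕ U
        M̂ = fromℕ M
        K = Û ^ 3 * M̂ ^ 4
        1≤Û : 1# ≤ Û
        1≤Û = subst (_≤ Û) fromℕ-1 (fromℕ-mono 1≤U)
        1≤M̂ : 1# ≤ M̂
        1≤M̂ = subst (_≤ M̂) fromℕ-1 (fromℕ-mono 1≤M)
        0≤Û = fromℕ-nonNeg U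
        0≤M̂ = fromℕ-nonNeg M
        0≤ε = abs-nonNeg hε
        0≤δ = abs-nonNeg hδ
        eq : fromℤ (norm (u , v)) ≡ (u' + v' * ρ) * (u' - v' * ρ) + (v' * v') * (ρ ^ 2 - m')
        eq = trans (fromℤ-+ (u ⊛ u) _) (trans (cong₂ _+_ (fromℤ-* u u) (trans (fromℤ-neg (+ m ⊛ (v ⊛ v)))
               (cong -_ (trans (fromℤ-* (+ m) _) (cong (_*_ m') (fromℤ-* v v))))))
             (trans (solve 4 (λ u v m ρ → u :* u :+ :- (m :* (v :* v)) := (u :+ v :* ρ) :* (u :- v :* ρ) :+ (v :* v) :* (ρ :* ρ :- m)) refl u' v' m' ρ)
                    (cong (λ t → (u' + v' * ρ) * (u' - v' * ρ) + (v' * v') * (ρ * t - m')) (sym (*-identityʳ ρ)))))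
          where open Solver
        hu : ∣ u' ∣≤ Û
        hu = abs-fromℤ {u} p
        hv : ∣ v' ∣≤ Û
        hv = abs-fromℤ {v} q
        ÛM≤K : Û * M̂ ≤ K
        ÛM≤K = *-mono 0≤Û 0≤M̂
          (subst (_≤ Û ^ 3) (*-identityʳ Û) (*-monoʳ Û 0≤Û (1≤^ 2 1≤Û)))
          (subst (_≤ M̂ ^ 4) (*-identityʳ M̂) (*-monoʳ M̂ 0≤M̂ (1≤^ 3 1≤M̂)))
        Û≤ÛM : Û ≤ Û * M̂
        Û≤ÛM = subst (_≤ Û * M̂) (*-identityʳ Û) (*-monoʳ Û 0≤Û 1≤M̂)
        ÛÛ≤K : Û * Û ≤ K
        ÛÛ≤K = subst (_≤ K) (*-identityʳ (Û * Û)) (*-mono (*-nonNeg 0≤Û 0≤Û) 0≤1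
          (*-monoʳ Û 0≤Û (subst (_≤ Û ^ 2) (*-identityʳ Û) (*-monoʳ Û 0≤Û (1≤^ 1 1≤Û)))) (1≤^ 4 1≤M̂))
        0≤K : 0# ≤ K
        0≤K = ≤-trans (*-nonNeg 0≤Û 0≤Û) ÛÛ≤K
        hρ : ∣ ρ ∣≤ M̂
        hρ = abs-of-nonNeg 0≤ρ ρ≤M
        conj : ∣ u' - v' * ρ ∣≤ (K + K)
        conj = abs-weaken (abs-- hu (abs-* hv hρ)) (+-mono (≤-trans Û≤ÛM ÛM≤K) ÛM≤K)
        bound : ∣ (u' + v' * ρ) * (u' - v' * ρ) + (v' * v') * (ρ ^ 2 - m') ∣≤ (fromℕ 6 * K * (ε + δ))
        bound = abs-weaken (abs-+ (abs-* hε conj) (abs-* (abs-weaken (abs-* hv hv) ÛÛ≤K) hδ))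
          -- The two cofactors need only 2 K and K; the surplus up to 6 K is what the cubic case
          -- requires.
          (x-y≥0⁻¹ (subst (0# ≤_) (solve 3 (λ k e d → con (+ 4) :* (k :* e) :+ con (+ 5) :* (k :* d) := con (+ 6) :* k :* (e :+ d) :- (e :* (k :+ k) :+ k :* d)) refl K ε δ)
            (+-nonNeg (*-nonNeg (fromℕ-nonNeg 4) (*-nonNeg 0≤K 0≤ε)) (*-nonNeg (fromℕ-nonNeg 5) (*-nonNeg 0≤K 0≤δ)))))
          where open Solver

      numberRing : NumberRing F 2 m
      numberRing = record
        { ring = ring ; domain = domain ; char0 = λ z e → cong proj₁ (trans (sym (fromℤ-pair z)) e)
        ; β = + 0 , + 1
        ; independent = λ a b e → cong proj₁ (trans (sym (linear a b)) e) , cong proj₂ (trans (sym (linear a b)) e)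
        ; Bd = Bd ; Bd-0 = ℕ.z≤n , ℕ.z≤n ; Bd-1 = ℕP.≤-refl , ℕ.z≤n
        ; Bd-+ = λ {U} {V} {x} {y} p q → abs-+-≤ (proj₁ x) (proj₁ y) (proj₁ p) (proj₁ q) , abs-+-≤ (proj₂ x) (proj₂ y) (proj₂ p) (proj₂ q)
        ; Bd-ℤ = λ {C} {U} {c} {x} h p → subst (Bd (C ℕ.* U)) (sym (scale c (proj₁ x) (proj₂ x))) (abs-*-≤ c (proj₁ x) h (proj₁ p) , abs-*-≤ c (proj₂ x) h (proj₂ p))
        ; Bd-step = λ {U} {x} a b → Bd-step {U} {x} a b
        ; Bd-mono = λ h p → ℕP.≤-trans (proj₁ p) h , ℕP.≤-trans (proj₂ p) h
        ; ev = ev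
        ; ev-0 = λ ρ → trans (F.+-identityˡ _) (F.zeroˡ ρ)
        ; ev-1 = λ ρ → trans (cong₂ F._+_ F.fromℕ-1 (F.zeroˡ ρ)) (F.+-identityʳ _)
        ; ev-+ = ev-+ ; ev-ℤ = ev-ℤ ; ev-step = λ ρ {U} {x} a b → ev-step ρ {U} {x} a b
        ; liouville = λ {U} {M} {x} → liouville {U} {M} {x} }

  module Cubic (m : ℕ) (noRoot : ∀ t s → t ⊛ (t ⊛ t) ≡ + m ⊛ (s ⊛ (s ⊛ s)) → s ≡ + 0) where
    open import Data.Integer.Solver using (module +-*-Solver)

    data C : Set where
      tri : ℤ → ℤ → ℤ → C

    tri-cong : ∀ {u v w u' v' w'} → u ≡ u' → v ≡ v' → w ≡ w' → tri u v w ≡ tri u' v' w'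
    tri-cong refl refl refl = refl

    tri-inj : ∀ {u v w u' v' w'} → tri u v w ≡ tri u' v' w' → u ≡ u' × v ≡ v' × w ≡ w'
    tri-inj refl = refl , refl , refl

    _+C_ _*C_ : C → C → C
    tri a b c +C tri d e f = tri (a ⊕ d) (b ⊕ e) (c ⊕ f)
    tri a b c *C tri d e f = tri (a ⊛ d ⊕ + m ⊛ (b ⊛ f ⊕ c ⊛ e)) (a ⊛ e ⊕ b ⊛ d ⊕ + m ⊛ (c ⊛ f)) (a ⊛ f ⊕ b ⊛ e ⊕ c ⊛ d)
    -C_ : C → C
    -C tri a b c = tri (⊖ a) (⊖ b) (⊖ c)

    0C 1C : C
    0C = tri (+ 0) (+ 0) (+ 0)
    1C = tri (+ 1) (+ 0) (+ 0)

    *C-comm : ∀ x y → x *C y ≡ y *C x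
    *C-comm (tri a b c) (tri d e f) = tri-cong
      (solve 7 (λ m a b c d e f → a :* d :+ m :* (b :* f :+ c :* e) := d :* a :+ m :* (e :* c :+ f :* b)) refl (+ m) a b c d e f)
      (solve 7 (λ m a b c d e f → a :* e :+ b :* d :+ m :* (c :* f) := d :* b :+ e :* a :+ m :* (f :* c)) refl (+ m) a b c d e f)
      (solve 6 (λ a b c d e f → a :* f :+ b :* e :+ c :* d := d :* c :+ e :* b :+ f :* a) refl a b c d e f)
      where open +-*-Solver

    scale-tri : ∀ k a b c → tri k (+ 0) (+ 0) *C tri a b c ≡ tri (k ⊛ a) (k ⊛ b) (k ⊛ c)
    scale-tri k a b c = tri-cong
      (solve 5 (λ m k a b c → k :* a :+ m :* (con (+ 0) :* c :+ con (+ 0) :* b) := k :* a) refl (+ m) k a b c)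
      (solve 5 (λ m k a b c → k :* b :+ con (+ 0) :* a :+ m :* (con (+ 0) :* c) := k :* b) refl (+ m) k a b c)
      (solve 4 (λ k a b c → k :* c :+ con (+ 0) :* b :+ con (+ 0) :* a := k :* c) refl k a b c)
      where open +-*-Solver

    *C-identityˡ : ∀ x → 1C *C x ≡ x
    *C-identityˡ (tri a b c) = trans (scale-tri (+ 1) a b c) (tri-cong (ℤP.*-identityˡ a) (ℤP.*-identityˡ b) (ℤP.*-identityˡ c))

    *C-distribˡ : ∀ x y z → x *C (y +C z) ≡ (x *C y) +C (x *C z)
    *C-distribˡ (tri a b c) (tri d e f) (tri g h i) = tri-cong
      (solve 10 (λ m a b c d e f g h i → a :* (d :+ g) :+ m :* (b :* (f :+ i) :+ c :* (e :+ h))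
         := (a :* d :+ m :* (b :* f :+ c :* e)) :+ (a :* g :+ m :* (b :* i :+ c :* h))) refl (+ m) a b c d e f g h i)
      (solve 10 (λ m a b c d e f g h i → a :* (e :+ h) :+ b :* (d :+ g) :+ m :* (c :* (f :+ i))
         := (a :* e :+ b :* d :+ m :* (c :* f)) :+ (a :* h :+ b :* g :+ m :* (c :* i))) refl (+ m) a b c d e f g h i)
      (solve 9 (λ a b c d e f g h i → a :* (f :+ i) :+ b :* (e :+ h) :+ c :* (d :+ g)
         := (a :* f :+ b :* e :+ c :* d) :+ (a :* i :+ b :* h :+ c :* g)) refl a b c d e f g h i)
      where open +-*-Solver

    *C-assoc : ∀ x y z → (x *C y) *C z ≡ x *C (y *C z)
    *C-assoc (tri a b c) (tri d e f) (tri g h i) = tri-cong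
      (solve 10 (λ m a b c d e f g h i →
          (a :* d :+ m :* (b :* f :+ c :* e)) :* g :+ m :* ((a :* e :+ b :* d :+ m :* (c :* f)) :* i :+ (a :* f :+ b :* e :+ c :* d) :* h)
          := a :* (d :* g :+ m :* (e :* i :+ f :* h)) :+ m :* (b :* (d :* i :+ e :* h :+ f :* g) :+ c :* (d :* h :+ e :* g :+ m :* (f :* i)))) refl (+ m) a b c d e f g h i)
      (solve 10 (λ m a b c d e f g h i →
          (a :* d :+ m :* (b :* f :+ c :* e)) :* h :+ (a :* e :+ b :* d :+ m :* (c :* f)) :* g :+ m :* ((a :* f :+ b :* e :+ c :* d) :* i)
          := a :* (d :* h :+ e :* g :+ m :* (f :* i)) :+ b :* (d :* g :+ m :* (e :* i :+ f :* h)) :+ m :* (c :* (d :* i :+ e :* h :+ f :* g))) refl (+ m) a b c d e f g h i)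
      (solve 10 (λ m a b c d e f g h i →
          (a :* d :+ m :* (b :* f :+ c :* e)) :* i :+ (a :* e :+ b :* d :+ m :* (c :* f)) :* h :+ (a :* f :+ b :* e :+ c :* d) :* g
          := a :* (d :* i :+ e :* h :+ f :* g) :+ b :* (d :* h :+ e :* g :+ m :* (f :* i)) :+ c :* (d :* g :+ m :* (e :* i :+ f :* h))) refl (+ m) a b c d e f g h i)
      where open +-*-Solver

    +C-assoc : ∀ x y z → (x +C y) +C z ≡ x +C (y +C z)
    +C-assoc (tri a b c) (tri d e f) (tri g h i) = tri-cong (ℤP.+-assoc a d g) (ℤP.+-assoc b e h) (ℤP.+-assoc c f i)
    +C-comm : ∀ x y → x +C y ≡ y +C x
    +C-comm (tri a b c) (tri d e f) = tri-cong (ℤP.+-comm a d) (ℤP.+-comm b e) (ℤP.+-comm c f)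
    +C-identityˡ : ∀ x → 0C +C x ≡ x
    +C-identityˡ (tri a b c) = tri-cong (ℤP.+-identityˡ a) (ℤP.+-identityˡ b) (ℤP.+-identityˡ c)
    +C-inverseˡ : ∀ x → (-C x) +C x ≡ 0C
    +C-inverseˡ (tri a b c) = tri-cong (ℤP.+-inverseˡ a) (ℤP.+-inverseˡ b) (ℤP.+-inverseˡ c)

    ring : CRing
    ring = record
      { Carrier = C ; _+_ = _+C_ ; _*_ = _*C_ ; -_ = -C_ ; 0# = 0C ; 1# = 1C
      ; isCommutativeRing = record
        { isRing = record
          { +-isAbelianGroup = record
            { isGroup = record
              { isMonoid = record
                { isSemigroup = record
                  { isMagma = record { isEquivalence = isEquivalence ; ∙-cong = cong₂ _+C_ }
                  ; assoc = +C-assoc }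
                ; identity = +C-identityˡ , (λ x → trans (+C-comm x 0C) (+C-identityˡ x)) }
              ; inverse = +C-inverseˡ , (λ x → trans (+C-comm x _) (+C-inverseˡ x))
              ; ⁻¹-cong = cong -C_ }
            ; comm = +C-comm }
          ; *-cong = cong₂ _*C_
          ; *-assoc = *C-assoc
          ; *-identity = *C-identityˡ , (λ x → trans (*C-comm x _) (*C-identityˡ x))
          ; distrib = *C-distribˡ , (λ x y z → trans (*C-comm (y +C z) x) (trans (*C-distribˡ x y z) (cong₂ _+C_ (*C-comm x y) (*C-comm x z)))) }
        ; *-comm = *C-comm } }

    module R = CRingTheory ring

    fromℕ-tri : ∀ n → R.fromℕ n ≡ tri (+ n) (+ 0) (+ 0)
    fromℕ-tri zero    = refl
    fromℕ-tri (suc n) = cong (1C +C_) (fromℕ-tri n)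

    fromℤ-tri : ∀ z → R.fromℤ z ≡ tri z (+ 0) (+ 0)
    fromℤ-tri (+ n)    = fromℕ-tri n
    fromℤ-tri -[1+ n ] = cong -C_ (fromℕ-tri (suc n))

    -- The determinant of multiplication by u + v β + w β², that is a³ + b³ + c³ - 3 a b c at a = u,
    -- b = v β, c = w β².
    norm : ℤ → ℤ → ℤ → ℤ
    norm u v w = u ⊛ (u ⊛ u) ⊕ + m ⊛ (v ⊛ (v ⊛ v)) ⊕ + m ⊛ (+ m ⊛ (w ⊛ (w ⊛ w))) ⊝ + 3 ⊛ (+ m ⊛ (u ⊛ (v ⊛ w)))

    -- p + q β + s β² is the product of the two other conjugates of u + v β + w β², multiplied out
    -- so that no cube root of unity is needed.
    module Adjugate (u v w : ℤ) where
      p q s : ℤ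
      p = u ⊛ u ⊝ + m ⊛ (v ⊛ w)
      q = + m ⊛ (w ⊛ w) ⊝ u ⊛ v
      s = v ⊛ v ⊝ u ⊛ w

      adj-* : tri p q s *C tri u v w ≡ tri (norm u v w) (+ 0) (+ 0)
      adj-* = tri-cong
        (solve 4 (λ m u v w → (u :* u :- m :* (v :* w)) :* u :+ m :* ((m :* (w :* w) :- u :* v) :* w :+ (v :* v :- u :* w) :* v)
           := u :* (u :* u) :+ m :* (v :* (v :* v)) :+ m :* (m :* (w :* (w :* w))) :- con (+ 3) :* (m :* (u :* (v :* w)))) refl (+ m) u v w)
        (solve 4 (λ m u v w → (u :* u :- m :* (v :* w)) :* v :+ (m :* (w :* w) :- u :* v) :* u :+ m :* ((v :* v :- u :* w) :* w)
           := con (+ 0)) refl (+ m) u v w)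
        (solve 4 (λ m u v w → (u :* u :- m :* (v :* w)) :* w :+ (m :* (w :* w) :- u :* v) :* v :+ (v :* v :- u :* w) :* u
           := con (+ 0)) refl (+ m) u v w)
        where open +-*-Solver

    cube≡0 : ∀ i → i ⊛ (i ⊛ i) ≡ + 0 → i ≡ + 0
    cube≡0 i e with ℤP.i*j≡0⇒i≡0∨j≡0 i e
    ... | inj₁ p = p
    ... | inj₂ p = i*i≡0 i p

    -- The adjugate (p, q, s) of an element of norm zero satisfies q³ = m s³, and
    -- once it vanishes the element (u, v, w) itself satisfies v³ = m w³.
    norm≡0 : ∀ u v w → norm u v w ≡ + 0 → tri u v w ≡ 0C
    norm≡0 u v w e = tri-cong u≡0 v≡0 w≡0
      where
      open Adjugate u v w
      open +-*-Solver
      N = norm u v w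
      0m = λ (x : ℤ) → trans (cong (_⊛ x) e) (ℤP.*-zeroˡ x)
      q³ : q ⊛ (q ⊛ q) ≡ + m ⊛ (s ⊛ (s ⊛ s))
      q³ = ℤP.i-j≡0⇒i≡j _ _ (trans
        (solve 4 (λ m u v w → let p = u :* u :- m :* (v :* w) ; q = m :* (w :* w) :- u :* v ; s = v :* v :- u :* w
                                  N = u :* (u :* u) :+ m :* (v :* (v :* v)) :+ m :* (m :* (w :* (w :* w))) :- con (+ 3) :* (m :* (u :* (v :* w)))
             in q :* (q :* q) :- m :* (s :* (s :* s)) := N :* (q :* w :- s :* v)) refl (+ m) u v w)
        (0m (q ⊛ w ⊝ s ⊛ v)))
      s≡0 : s ≡ + 0
      s≡0 = noRoot q s q³
      q≡0 : q ≡ + 0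
      q≡0 = cube≡0 q (trans q³ (trans (cong (λ t → + m ⊛ (t ⊛ (t ⊛ t))) s≡0) (ℤP.*-zeroʳ (+ m))))
      p≡0 : p ≡ + 0
      p≡0 = i*i≡0 p (trans
        (solve 4 (λ m u v w → let p = u :* u :- m :* (v :* w) ; q = m :* (w :* w) :- u :* v ; s = v :* v :- u :* w
                                  N = u :* (u :* u) :+ m :* (v :* (v :* v)) :+ m :* (m :* (w :* (w :* w))) :- con (+ 3) :* (m :* (u :* (v :* w)))
             in p :* p := N :* u :+ m :* (q :* s)) refl (+ m) u v w)
        (trans (cong₂ _⊕_ (0m u) (trans (cong (λ t → + m ⊛ (q ⊛ t)) s≡0) (trans (cong (+ m ⊛_) (ℤP.*-zeroʳ q)) (ℤP.*-zeroʳ (+ m))))) refl))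
      w≡0 : w ≡ + 0
      w≡0 = noRoot v w (ℤP.i-j≡0⇒i≡j _ _ (trans
        (solve 4 (λ m u v w → let q = m :* (w :* w) :- u :* v ; s = v :* v :- u :* w
             in v :* (v :* v) :- m :* (w :* (w :* w)) := v :* s :- w :* q) refl (+ m) u v w)
        (cong₂ _⊝_ (trans (cong (v ⊛_) s≡0) (ℤP.*-zeroʳ v)) (trans (cong (w ⊛_) q≡0) (ℤP.*-zeroʳ w)))))
      v≡0 : v ≡ + 0
      v≡0 = i*i≡0 v (trans (solve 3 (λ u v w → v :* v := (v :* v :- u :* w) :+ u :* w) refl u v w)
        (cong₂ _⊕_ s≡0 (trans (cong (u ⊛_) w≡0) (ℤP.*-zeroʳ u))))
      u≡0 : u ≡ + 0
      u≡0 = i*i≡0 u (trans (solve 4 (λ m u v w → u :* u := (u :* u :- m :* (v :* w)) :+ (m :* v) :* w) refl (+ m) u v w)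
        (cong₂ _⊕_ p≡0 (trans (cong ((+ m ⊛ v) ⊛_) w≡0) (ℤP.*-zeroʳ (+ m ⊛ v)))))

    domain : ∀ {x y} → x *C y ≡ 0C → x ≡ 0C ⊎ y ≡ 0C
    domain {tri u v w} {tri u' v' w'} e with norm u v w ℤP.≟ + 0
    ... | yes p = inj₁ (norm≡0 u v w p)
    ... | no ne = inj₂ (tri-cong (kill u' (proj₁ q)) (kill v' (proj₁ (proj₂ q))) (kill w' (proj₂ (proj₂ q))))
      where
      open Adjugate u v w using (adj-*) renaming (p to p₁; q to q₁; s to s₁)
      N = norm u v w
      q : N ⊛ u' ≡ + 0 × N ⊛ v' ≡ + 0 × N ⊛ w' ≡ + 0
      q = tri-inj (trans (sym (scale-tri N u' v' w')) (trans (cong (_*C tri u' v' w') (sym adj-*))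
            (trans (*C-assoc (tri p₁ q₁ s₁) (tri u v w) (tri u' v' w')) (trans (cong (tri p₁ q₁ s₁ *C_) e) (R.zeroʳ (tri p₁ q₁ s₁))))))
      kill : ∀ i → N ⊛ i ≡ + 0 → i ≡ + 0
      kill i z with ℤP.i*j≡0⇒i≡0∨j≡0 N z
      ... | inj₁ p = ⊥-elim (ne p)
      ... | inj₂ p = p

    β : C
    β = tri (+ 0) (+ 1) (+ 0)

    linear : ∀ a b → R.fromℤ a +C (R.fromℤ b *C β) ≡ tri a b (+ 0)
    linear a b = trans (cong₂ (λ s t → s +C (t *C β)) (fromℤ-tri a) (fromℤ-tri b)) (trans (cong (tri a (+ 0) (+ 0) +C_) (scale-tri b (+ 0) (+ 1) (+ 0)))
      (tri-cong (trans (cong (a ⊕_) (ℤP.*-zeroʳ b)) (ℤP.+-identityʳ a)) (trans (ℤP.+-identityˡ _) (ℤP.*-identityʳ b)) (trans (ℤP.+-identityˡ _) (ℤP.*-zeroʳ b))))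

    step : ∀ u v w a b → tri u v w *C (R.fromℕ a +C (R.fromℕ b *C β)) ≡ tri (u ⊛ + a ⊕ + m ⊛ (w ⊛ + b)) (u ⊛ + b ⊕ v ⊛ + a) (v ⊛ + b ⊕ w ⊛ + a)
    step u v w a b = trans (cong (tri u v w *C_) (linear (+ a) (+ b))) (tri-cong
      (solve 6 (λ m u v w a b → u :* a :+ m :* (v :* con (+ 0) :+ w :* b) := u :* a :+ m :* (w :* b)) refl (+ m) u v w (+ a) (+ b))
      (solve 6 (λ m u v w a b → u :* b :+ v :* a :+ m :* (w :* con (+ 0)) := u :* b :+ v :* a) refl (+ m) u v w (+ a) (+ b))
      (solve 5 (λ u v w a b → u :* con (+ 0) :+ v :* b :+ w :* a := v :* b :+ w :* a) refl u v w (+ a) (+ b)))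
      where open +-*-Solver

    Bd : ℕ → C → Set
    Bd U (tri u v w) = ℤ.∣ u ∣ ℕ.≤ U × ℤ.∣ v ∣ ℕ.≤ U × ℤ.∣ w ∣ ℕ.≤ U

    scale : ∀ c u v w → R.fromℤ c *C tri u v w ≡ tri (c ⊛ u) (c ⊛ v) (c ⊛ w)
    scale c u v w = trans (cong (_*C tri u v w) (fromℤ-tri c)) (scale-tri c u v w)

    Bd-+ : ∀ {U V} x y → Bd U x → Bd V y → Bd (U ℕ.+ V) (x +C y)
    Bd-+ (tri a b c) (tri d e f) (p , q , r) (p' , q' , r') = abs-+-≤ a d p p' , abs-+-≤ b e q q' , abs-+-≤ c f r r'

    Bd-ℤ : ∀ {K U} c x → ℤ.∣ c ∣ ℕ.≤ K → Bd U x → Bd (K ℕ.* U) (R.fromℤ c *C x)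
    Bd-ℤ {K} {U} c (tri u v w) h (p , q , r) =
      subst (Bd (K ℕ.* U)) (sym (scale c u v w)) (abs-*-≤ c u h p , abs-*-≤ c v h q , abs-*-≤ c w h r)

    Bd-mono : ∀ {U V} x → U ℕ.≤ V → Bd U x → Bd V x
    Bd-mono (tri u v w) h (p , q , r) = ℕP.≤-trans p h , ℕP.≤-trans q h , ℕP.≤-trans r h

    Bd-step : ∀ {U} x a b → Bd U x → Bd ((a ℕ.+ suc m ℕ.* b) ℕ.* U) (x *C (R.fromℕ a +C (R.fromℕ b *C β)))
    Bd-step {U} (tri u v w) a b (p , q , r) = subst (Bd ((a ℕ.+ suc m ℕ.* b) ℕ.* U)) (sym (step u v w a b))
      ( ℕP.≤-trans (abs-+-≤ (u ⊛ + a) (+ m ⊛ (w ⊛ + b)) (abs-*-≤ u (+ a) p ℕP.≤-refl) (abs-*-≤ (+ m) (w ⊛ + b) ℕP.≤-refl (abs-*-≤ w (+ b) r ℕP.≤-refl)))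
          (subst (ℕ._≤ (a ℕ.+ suc m ℕ.* b) ℕ.* U) (e₁ U a b m) (ℕP.*-monoˡ-≤ U (ℕP.+-monoʳ-≤ a (ℕP.m≤n+m (m ℕ.* b) b))))
      , ab u v p q , ab v w q r )
      where
      open import Data.Nat.Tactic.RingSolver using (solve-∀)
      e₁ : ∀ U a b m → (a ℕ.+ m ℕ.* b) ℕ.* U ≡ U ℕ.* a ℕ.+ m ℕ.* (U ℕ.* b)
      e₁ = solve-∀
      e₂ : ∀ U a b → (a ℕ.+ b) ℕ.* U ≡ U ℕ.* b ℕ.+ U ℕ.* a
      e₂ = solve-∀
      ab : ∀ i j → ℤ.∣ i ∣ ℕ.≤ U → ℤ.∣ j ∣ ℕ.≤ U → ℤ.∣ i ⊛ + b ⊕ j ⊛ + a ∣ ℕ.≤ (a ℕ.+ suc m ℕ.* b) ℕ.* U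
      ab i j p q = ℕP.≤-trans (abs-+-≤ (i ⊛ + b) (j ⊛ + a) (abs-*-≤ i (+ b) p ℕP.≤-refl) (abs-*-≤ j (+ a) q ℕP.≤-refl))
        (subst (ℕ._≤ (a ℕ.+ suc m ℕ.* b) ℕ.* U) (e₂ U a b) (ℕP.*-monoˡ-≤ U (ℕP.+-monoʳ-≤ a (ℕP.m≤m+n b (m ℕ.* b)))))

    module _ (F : OField) where
      private module F = OFieldTheory F
      open F using (∣_∣≤_)

      ev : F.Carrier → C → F.Carrier
      ev ρ (tri u v w) = F.fromℤ u F.+ F.fromℤ v F.* ρ F.+ F.fromℤ w F.* (ρ F.* ρ)

      private
        ev-cong : ∀ ρ u v w {x y z} → F.fromℤ u ≡ x → F.fromℤ v ≡ y → F.fromℤ w ≡ z → ev ρ (tri u v w) ≡ x F.+ y F.* ρ F.+ z F.* (ρ F.* ρ)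
        ev-cong ρ u v w refl refl refl = refl

      ev-+ : ∀ ρ x y → ev ρ (x +C y) ≡ ev ρ x F.+ ev ρ y
      ev-+ ρ (tri u v w) (tri u' v' w') = trans
        (ev-cong ρ (u ⊕ u') (v ⊕ v') (w ⊕ w') (F.fromℤ-+ u u') (F.fromℤ-+ v v') (F.fromℤ-+ w w'))
        (solve 8 (λ u v w u' v' w' ρ σ → (u :+ u') :+ (v :+ v') :* ρ :+ (w :+ w') :* σ := (u :+ v :* ρ :+ w :* σ) :+ (u' :+ v' :* ρ :+ w' :* σ)) refl
          (F.fromℤ u) (F.fromℤ v) (F.fromℤ w) (F.fromℤ u') (F.fromℤ v') (F.fromℤ w') ρ (ρ F.* ρ))
        where open F.Solver

      ev-ℤ : ∀ ρ c x → ev ρ (R.fromℤ c *C x) ≡ F.fromℤ c F.* ev ρ x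
      ev-ℤ ρ c (tri u v w) = trans (cong (ev ρ) (scale c u v w)) (trans
        (ev-cong ρ (c ⊛ u) (c ⊛ v) (c ⊛ w) (F.fromℤ-* c u) (F.fromℤ-* c v) (F.fromℤ-* c w))
        (solve 6 (λ c u v w ρ σ → c :* u :+ (c :* v) :* ρ :+ (c :* w) :* σ := c :* (u :+ v :* ρ :+ w :* σ)) refl
          (F.fromℤ c) (F.fromℤ u) (F.fromℤ v) (F.fromℤ w) ρ (ρ F.* ρ)))
        where open F.Solver

      ev-step : ∀ ρ {U} x a b → Bd U x → Σ F.Carrier λ w → (∣ w ∣≤ F.fromℕ U) ×
        ev ρ (x *C (R.fromℕ a +C (R.fromℕ b *C β)))
          ≡ ev ρ x F.* (F.fromℕ a F.+ F.fromℕ b F.* ρ) F.- (ρ F.^ 3 F.- F.fromℕ m) F.* (F.fromℕ b F.* w)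
      ev-step ρ {U} (tri u v w) a b (p , q , r) = F.fromℤ w , F.abs-fromℤ {w} r , trans (cong (ev ρ) (step u v w a b)) (trans
        (ev-cong ρ (u ⊛ + a ⊕ + m ⊛ (w ⊛ + b)) (u ⊛ + b ⊕ v ⊛ + a) (v ⊛ + b ⊕ w ⊛ + a)
          (trans (F.fromℤ-+ (u ⊛ + a) (+ m ⊛ (w ⊛ + b))) (cong₂ F._+_ (F.fromℤ-* u (+ a)) (trans (F.fromℤ-* (+ m) (w ⊛ + b)) (cong (F._*_ _) (F.fromℤ-* w (+ b))))))
          (trans (F.fromℤ-+ (u ⊛ + b) (v ⊛ + a)) (cong₂ F._+_ (F.fromℤ-* u (+ b)) (F.fromℤ-* v (+ a))))
          (trans (F.fromℤ-+ (v ⊛ + b) (w ⊛ + a)) (cong₂ F._+_ (F.fromℤ-* v (+ b)) (F.fromℤ-* w (+ a)))))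
        (trans
        (solve 7 (λ u v w a b m ρ → (u :* a :+ m :* (w :* b)) :+ (u :* b :+ v :* a) :* ρ :+ (v :* b :+ w :* a) :* (ρ :* ρ)
             := (u :+ v :* ρ :+ w :* (ρ :* ρ)) :* (a :+ b :* ρ) :- (ρ :* (ρ :* ρ) :- m) :* (b :* w)) refl
             (F.fromℤ u) (F.fromℤ v) (F.fromℤ w) (F.fromℕ a) (F.fromℕ b) (F.fromℕ m) ρ)
        (cong (λ t → ev ρ (tri u v w) F.* (F.fromℕ a F.+ F.fromℕ b F.* ρ) F.- (ρ F.* (ρ F.* t) F.- F.fromℕ m) F.* (F.fromℕ b F.* F.fromℤ w)) (sym (F.*-identityʳ ρ)))))
        where open F.Solver

      liouville : ∀ {U M ρ ε δ} x → 1 ℕ.≤ U → 1 ℕ.≤ M → m ℕ.≤ M → F.0# F.≤ ρ → ρ F.≤ F.fromℕ M →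
        Bd U x → ∣ ev ρ x ∣≤ ε → ∣ ρ F.^ 3 F.- F.fromℕ m ∣≤ δ →
        ¬ (F.1# F.≤ F.fromℕ 6 F.* (F.fromℕ U F.^ 3 F.* F.fromℕ M F.^ 4) F.* (ε F.+ δ)) → x ≡ 0C
      liouville {U} {M} {ρ} {ε} {δ} (tri u v w) 1≤U 1≤M m≤M 0≤ρ ρ≤M (p , q , r) hε hδ small =
        norm≡0 u v w (F.fromℤ-small (norm u v w) (subst (∣_∣≤ _) (sym eq) bound) small)
        where
        open F hiding (_+_; _*_; _-_; -_; _^_)
        open F using (_+_; _*_; _-_; -_; _^_)
        u' = fromℤ u
        v' = fromℤ v
        w' = fromℤ w
        m' = fromℕ m
        y = v' * ρ
        z = w' * (ρ * ρ)
        Û = fromℕ U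
        M̂ = fromℕ M
        K = Û ^ 3 * M̂ ^ 4
        1≤Û : 1# ≤ Û
        1≤Û = subst (_≤ Û) fromℕ-1 (fromℕ-mono 1≤U)
        1≤M̂ : 1# ≤ M̂
        1≤M̂ = subst (_≤ M̂) fromℕ-1 (fromℕ-mono 1≤M)
        0≤Û = fromℕ-nonNeg U
        0≤M̂ = fromℕ-nonNeg M
        -- The second factor in a³ + b³ + c³ - 3 a b c = (a + b + c)(a² + b² + c² - a b - b c - c a)
        -- at a = u', b = y, c = z; `rest` is the cofactor of ρ³ - m that accounts for replacing m
        -- by ρ³.
        qf = u' * u' + y * y + z * z + - (u' * y) + - (y * z) + - (z * u')
        ρ³ = ρ * (ρ * ρ)
        rest = v' * (v' * v') + w' * (w' * w') * (m' + ρ³) - fromℕ 3 * (u' * (v' * w'))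
        eq : fromℤ (norm u v w) ≡ (u' + y + z) * qf + - (ρ³ - m') * rest
        eq = trans (fromℤ-+ (u ⊛ (u ⊛ u) ⊕ + m ⊛ (v ⊛ (v ⊛ v)) ⊕ + m ⊛ (+ m ⊛ (w ⊛ (w ⊛ w)))) (⊖ (+ 3 ⊛ (+ m ⊛ (u ⊛ (v ⊛ w))))))
            (trans (cong₂ _+_ (trans (fromℤ-+ (u ⊛ (u ⊛ u) ⊕ + m ⊛ (v ⊛ (v ⊛ v))) (+ m ⊛ (+ m ⊛ (w ⊛ (w ⊛ w)))))
                                     (cong₂ _+_ (trans (fromℤ-+ (u ⊛ (u ⊛ u)) (+ m ⊛ (v ⊛ (v ⊛ v)))) (cong₂ _+_ (cube u) (mul (+ m) (v ⊛ (v ⊛ v)) (cube v)))) (mul (+ m) (+ m ⊛ (w ⊛ (w ⊛ w))) (mul (+ m) (w ⊛ (w ⊛ w)) (cube w)))))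
                              (trans (fromℤ-neg (+ 3 ⊛ (+ m ⊛ (u ⊛ (v ⊛ w))))) (cong -_ (mul (+ 3) (+ m ⊛ (u ⊛ (v ⊛ w))) (mul (+ m) (u ⊛ (v ⊛ w)) (mul u (v ⊛ w) (fromℤ-* v w)))))))
            (solve 5 (λ u v w m ρ → let y = v :* ρ ; z = w :* (ρ :* ρ) in
               u :* (u :* u) :+ m :* (v :* (v :* v)) :+ m :* (m :* (w :* (w :* w))) :+ :- (con (+ 3) :* (m :* (u :* (v :* w))))
               := (u :+ y :+ z) :* (u :* u :+ y :* y :+ z :* z :+ :- (u :* y) :+ :- (y :* z) :+ :- (z :* u))
                 :+ (:- (ρ :* (ρ :* ρ) :- m)) :* (v :* (v :* v) :+ (w :* (w :* w)) :* (m :+ ρ :* (ρ :* ρ)) :- con (+ 3) :* (u :* (v :* w)))) refl u' v' w' m' ρ))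
          where
          open Solver
          mul : ∀ i j {x} → fromℤ j ≡ x → fromℤ (i ⊛ j) ≡ fromℤ i * x
          mul i j refl = fromℤ-* i j
          cube : ∀ i → fromℤ (i ⊛ (i ⊛ i)) ≡ fromℤ i * (fromℤ i * fromℤ i)
          cube i = mul i (i ⊛ i) (fromℤ-* i i)
        hρ : ∣ ρ ∣≤ M̂
        hρ = abs-of-nonNeg 0≤ρ ρ≤M
        B = Û * (M̂ * M̂)
        1≤MM : 1# ≤ M̂ * M̂
        1≤MM = subst (_≤ M̂ * M̂) (*-identityʳ 1#) (*-mono 0≤1 0≤1 1≤M̂ 1≤M̂)
        hu : ∣ u' ∣≤ B
        hu = abs-weaken (abs-fromℤ {u} p) (subst (_≤ B) (*-identityʳ Û) (*-monoʳ Û 0≤Û 1≤MM))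
        hy : ∣ y ∣≤ B
        hy = abs-weaken (abs-* (abs-fromℤ {v} q) hρ) (*-monoʳ Û 0≤Û (subst (_≤ M̂ * M̂) (*-identityʳ M̂) (*-monoʳ M̂ 0≤M̂ 1≤M̂)))
        hz : ∣ z ∣≤ B
        hz = abs-* (abs-fromℤ {w} r) (abs-* hρ hρ)
        0≤K : 0# ≤ K
        0≤K = *-nonNeg (^-nonNeg 3 0≤Û) (^-nonNeg 4 0≤M̂)
        BB≤K : B * B ≤ K
        BB≤K = ≤-trans (≤-reflexive (solve 3 (λ u m o → (u :* (m :* m)) :* (u :* (m :* m)) := (u :* u) :* (m :* (m :* (m :* m)))) refl Û M̂ 1#))
          (*-mono (*-nonNeg 0≤Û 0≤Û) (*-nonNeg 0≤M̂ (*-nonNeg 0≤M̂ (*-nonNeg 0≤M̂ 0≤M̂)))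
            (*-monoʳ Û 0≤Û (subst (_≤ Û ^ 2) (*-identityʳ Û) (*-monoʳ Û 0≤Û (1≤^ 1 1≤Û))))
            (≤-reflexive (cong (λ t → M̂ * (M̂ * (M̂ * t))) (sym (*-identityʳ M̂)))))
          where open Solver
        hqf : ∣ qf ∣≤ (fromℕ 6 * K)
        hqf = abs-weaken (abs-+ (abs-+ (abs-+ (abs-+ (abs-+ (abs-* hu hu) (abs-* hy hy)) (abs-* hz hz)) (abs-neg (abs-* hu hy))) (abs-neg (abs-* hy hz))) (abs-neg (abs-* hz hu)))
          (≤-trans (≤-reflexive (solve 1 (λ b → b :+ b :+ b :+ b :+ b :+ b := con (+ 6) :* b) refl (B * B))) (*-monoʳ (fromℕ 6) (fromℕ-nonNeg 6) BB≤K))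
          where open Solver
        Û³ = Û * (Û * Û)
        0≤Û³ : 0# ≤ Û³
        0≤Û³ = *-nonNeg 0≤Û (*-nonNeg 0≤Û 0≤Û)
        Û³*≤K : ∀ {t} → t ≤ M̂ ^ 4 → 0# ≤ t → Û³ * t ≤ K
        Û³*≤K h 0≤t = *-mono 0≤Û³ 0≤t (≤-reflexive (cong (λ t → Û * (Û * t)) (sym (*-identityʳ Û)))) h
        M³ = M̂ * (M̂ * M̂)
        M³≤M⁴ : M³ ≤ M̂ ^ 4
        M³≤M⁴ = *-monoʳ M̂ 0≤M̂ (*-monoʳ M̂ 0≤M̂ (subst (_≤ M̂ ^ 2) (*-identityʳ M̂) (*-monoʳ M̂ 0≤M̂ (1≤^ 1 1≤M̂))))
        M≤M⁴ : M̂ ≤ M̂ ^ 4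
        M≤M⁴ = subst (_≤ M̂ ^ 4) (*-identityʳ M̂) (*-monoʳ M̂ 0≤M̂ (1≤^ 3 1≤M̂))
        hm : ∣ m' ∣≤ M̂
        hm = abs-of-nonNeg (fromℕ-nonNeg m) (fromℕ-mono m≤M)
        hv : ∣ v' ∣≤ Û
        hv = abs-fromℤ {v} q
        hw : ∣ w' ∣≤ Û
        hw = abs-fromℤ {w} r
        hrest : ∣ rest ∣≤ (fromℕ 6 * K)
        hrest = abs-weaken (abs-- (abs-+ (abs-* hv (abs-* hv hv)) (abs-* (abs-* hw (abs-* hw hw)) (abs-+ hm (abs-* hρ (abs-* hρ hρ)))))
                                  (abs-* (abs-of-nonNeg (fromℕ-nonNeg 3) ≤-refl) (abs-* (abs-fromℤ {u} p) (abs-* hv hw))))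
          (≤-trans (≤-reflexive (solve 3 (λ a m n → a :+ a :* (m :+ n) :+ con (+ 3) :* a := con (+ 4) :* (a :* con (+ 1)) :+ a :* m :+ a :* n) refl Û³ M̂ M³))
          (≤-trans (+-mono (+-mono (*-monoʳ (fromℕ 4) (fromℕ-nonNeg 4) (Û³*≤K (subst (_≤ M̂ ^ 4) (sym fromℕ-1) (1≤^ 4 1≤M̂)) (fromℕ-nonNeg 1)))
                                   (Û³*≤K M≤M⁴ 0≤M̂)) (Û³*≤K M³≤M⁴ (*-nonNeg 0≤M̂ (*-nonNeg 0≤M̂ 0≤M̂))))
            (≤-reflexive (solve 1 (λ k → con (+ 4) :* k :+ k :+ k := con (+ 6) :* k) refl K))))
          where open Solver
        hδ' : ∣ ρ³ - m' ∣≤ δ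
        hδ' = subst (λ t → ∣ ρ * (ρ * t) - m' ∣≤ δ) (*-identityʳ ρ) hδ
        bound : ∣ (u' + y + z) * qf + - (ρ³ - m') * rest ∣≤ (fromℕ 6 * K * (ε + δ))
        bound = abs-weaken (abs-+ (abs-* hε hqf) (abs-* (abs-neg hδ') hrest))
          (≤-reflexive (solve 3 (λ k e d → e :* k :+ d :* k := k :* (e :+ d)) refl (fromℕ 6 * K) ε δ))
          where open Solver

      numberRing : NumberRing F 3 m
      numberRing = record
        { ring = ring ; domain = domain ; char0 = λ z e → proj₁ (tri-inj (trans (sym (fromℤ-tri z)) e))
        ; β = β
        ; independent = λ a b e → proj₁ (tri-inj (trans (sym (linear a b)) e)) , proj₁ (proj₂ (tri-inj (trans (sym (linear a b)) e)))
        ; Bd = Bd ; Bd-0 = ℕ.z≤n , ℕ.z≤n , ℕ.z≤n ; Bd-1 = ℕP.≤-refl , ℕ.z≤n , ℕ.z≤n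
        ; Bd-+ = λ {U} {V} {x} {y} → Bd-+ {U} {V} x y
        ; Bd-ℤ = λ {K} {U} {c} {x} → Bd-ℤ {K} {U} c x
        ; Bd-step = λ {U} {x} → Bd-step {U} x
        ; Bd-mono = λ {U} {V} {x} → Bd-mono {U} {V} x
        ; ev = ev
        ; ev-0 = λ ρ → trans (cong₂ F._+_ (trans (F.+-identityˡ _) (F.zeroˡ ρ)) (F.zeroˡ _)) (F.+-identityʳ _)
        ; ev-1 = λ ρ → trans (cong₂ F._+_ (trans (cong₂ F._+_ F.fromℕ-1 (F.zeroˡ ρ)) (F.+-identityʳ _)) (F.zeroˡ _)) (F.+-identityʳ _)
        ; ev-+ = ev-+ ; ev-ℤ = ev-ℤ ; ev-step = λ ρ {U} {x} → ev-step ρ {U} x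
        ; liouville = λ {U} {M} {x} → liouville {U} {M} x }

-- Newton series of xᵃ(1 + ζk)ᵖ in the variable p, with bounds on their terms.

module NewtonSeries where

  open OrderedField
  open import Data.Empty using (⊥-elim)
  open import Data.Integer using (+_)
  open import Data.Nat as ℕ using (ℕ; zero; suc; _!)
  import Data.Nat.Properties as ℕP
  open import Data.Nat.Tactic.RingSolver using (solve-∀)
  open import Data.Product using (_,_)
  open import Relation.Binary.PropositionalEquality
  open import Relation.Nullary using (yes; no)
  open import Data.Sum using (inj₁; inj₂)

  ℕ^-distrib-* : ∀ a b n → (a ℕ.* b) ℕ.^ n ≡ a ℕ.^ n ℕ.* b ℕ.^ n
  ℕ^-distrib-* a b zero    = refl
  ℕ^-distrib-* a b (suc n) = trans (cong (a ℕ.* b ℕ.*_) (ℕ^-distrib-* a b n)) (lem a b (a ℕ.^ n) (b ℕ.^ n))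
    where
    lem : ∀ a b c d → a ℕ.* b ℕ.* (c ℕ.* d) ≡ a ℕ.* c ℕ.* (b ℕ.* d)
    lem = solve-∀

  binom : ℕ → ℕ → ℕ
  binom p       zero    = 1
  binom zero    (suc s) = 0
  binom (suc p) (suc s) = binom p s ℕ.+ binom p (suc s)

  binom-> : ∀ p s → p ℕ.< s → binom p s ≡ 0
  binom-> zero    (suc s) _          = refl
  binom-> (suc p) (suc s) (ℕ.s≤s lt) = cong₂ ℕ._+_ (binom-> p s lt) (binom-> p (suc s) (ℕP.m<n⇒m<1+n lt))

  -- Rewrites a factor p as an index shift of binomial coefficients; this is what lets a Newton
  -- series be multiplied by p.
  binom-* : ∀ p s → p ℕ.* binom p s ≡ s ℕ.* binom p s ℕ.+ suc s ℕ.* binom p (suc s)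
  binom-* zero    zero    = refl
  binom-* zero    (suc s) = sym (cong₂ ℕ._+_ (ℕP.*-zeroʳ s) (ℕP.*-zeroʳ s))
  binom-* (suc p) zero    = trans (cong suc (trans (binom-* p 0) (ℕP.+-identityʳ (binom p 1)))) (sym (ℕP.+-identityʳ (suc (binom p 1))))
  binom-* (suc p) (suc s) = begin
    suc p ℕ.* (a ℕ.+ b)                                            ≡⟨ l₁ p a b ⟩
    (p ℕ.* a ℕ.+ a) ℕ.+ (p ℕ.* b ℕ.+ b)                            ≡⟨ cong₂ (λ u v → (u ℕ.+ a) ℕ.+ (v ℕ.+ b)) (binom-* p s) (binom-* p (suc s)) ⟩
    (s ℕ.* a ℕ.+ suc s ℕ.* b ℕ.+ a) ℕ.+ (suc s ℕ.* b ℕ.+ suc (suc s) ℕ.* c ℕ.+ b) ≡⟨ l₂ s a b c ⟩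
    suc s ℕ.* (a ℕ.+ b) ℕ.+ suc (suc s) ℕ.* (b ℕ.+ c)              ∎
    where
    open ≡-Reasoning
    a = binom p s
    b = binom p (suc s)
    c = binom p (suc (suc s))
    l₁ : ∀ p a b → suc p ℕ.* (a ℕ.+ b) ≡ (p ℕ.* a ℕ.+ a) ℕ.+ (p ℕ.* b ℕ.+ b)
    l₁ = solve-∀
    l₂ : ∀ s a b c → (s ℕ.* a ℕ.+ suc s ℕ.* b ℕ.+ a) ℕ.+ (suc s ℕ.* b ℕ.+ suc (suc s) ℕ.* c ℕ.+ b) ≡ suc s ℕ.* (a ℕ.+ b) ℕ.+ suc (suc s) ℕ.* (b ℕ.+ c)
    l₂ = solve-∀

  !-binom-≤ : ∀ p s → s ! ℕ.* binom p s ℕ.≤ p ℕ.^ s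
  !-binom-≤ p zero    = ℕP.≤-refl
  !-binom-≤ p (suc s) = begin
    suc s ! ℕ.* binom p (suc s)                ≡⟨ l₁ (suc s) (s !) (binom p (suc s)) ⟩
    s ! ℕ.* (suc s ℕ.* binom p (suc s))        ≤⟨ ℕP.*-monoʳ-≤ (s !) (ℕP.m≤n+m _ (s ℕ.* binom p s)) ⟩
    s ! ℕ.* (s ℕ.* binom p s ℕ.+ suc s ℕ.* binom p (suc s)) ≡⟨ cong (s ! ℕ.*_) (sym (binom-* p s)) ⟩
    s ! ℕ.* (p ℕ.* binom p s)                  ≡⟨ l₂ (s !) p (binom p s) ⟩
    p ℕ.* (s ! ℕ.* binom p s)                  ≤⟨ ℕP.*-monoʳ-≤ p (!-binom-≤ p s) ⟩
    p ℕ.* p ℕ.^ s                              ∎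
    where
    open ℕP.≤-Reasoning
    l₁ : ∀ a b c → a ℕ.* b ℕ.* c ≡ b ℕ.* (a ℕ.* c)
    l₁ = solve-∀
    l₂ : ∀ a b c → a ℕ.* (b ℕ.* c) ≡ b ℕ.* (a ℕ.* c)
    l₂ = solve-∀

  module Expansion (F : OField) where
    open OFieldTheory F

    *-cancel : ∀ {c x y} → 1# ≤ c → c * x ≤ c * y → x ≤ y
    *-cancel {c} {x} {y} 1≤c p with inverse c (λ c≤0 → 1≰0 (≤-trans 1≤c c≤0))
    ... | c⁻¹ , e = subst₂ _≤_ (cancel x) (cancel y) (*-monoʳ c⁻¹ 0≤c⁻¹ p)
      where
      cancel : ∀ z → c⁻¹ * (c * z) ≡ z
      cancel z = trans (sym (*-assoc c⁻¹ c z)) (trans (cong (_* z) (trans (*-comm c⁻¹ c) e)) (*-identityˡ z))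
      0≤c⁻¹ : 0# ≤ c⁻¹
      0≤c⁻¹ with ≤-total 0# c⁻¹
      ... | inj₁ q = q
      ... | inj₂ q = ⊥-elim (1≰0 (subst₂ _≤_ e (zeroʳ c) (*-monoʳ c (≤-trans 0≤1 1≤c) q)))

    1≤fromℕ : ∀ {n} → 1 ℕ.≤ n → 1# ≤ fromℕ n
    1≤fromℕ {n} p = subst (_≤ fromℕ n) fromℕ-1 (fromℕ-mono p)

    binomial-theorem : ∀ κ p S → p ℕ.< S → (1# + κ) ^ p ≡ sum S (λ s → fromℕ (binom p s) * κ ^ s)
    binomial-theorem κ zero (suc S) _ = sym (trans (sum-suc S _)
      (trans (cong₂ _+_ (trans (*-identityʳ _) fromℕ-1) (trans (sum-cong S (λ s _ → zeroˡ _)) (sum-0 S))) (+-identityʳ _)))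
    binomial-theorem κ (suc p) (suc S) (ℕ.s≤s p<S) = begin
      (1# + κ) * (1# + κ) ^ p                       ≡⟨ distribʳ _ _ _ ⟩
      1# * (1# + κ) ^ p + κ * (1# + κ) ^ p          ≡⟨ cong₂ _+_ (trans (*-identityˡ _) (binomial-theorem κ p (suc S) (ℕP.m<n⇒m<1+n p<S))) (cong (_*_ κ) (binomial-theorem κ p S p<S)) ⟩
      sum (suc S) f + κ * sum S f                   ≡⟨ cong₂ _+_ (sum-suc S f) (sym (sum-* S κ f)) ⟩
      (f 0 + sum S (λ s → f (suc s))) + sum S (λ s → κ * f s) ≡⟨ +-assoc _ _ _ ⟩
      f 0 + (sum S (λ s → f (suc s)) + sum S (λ s → κ * f s)) ≡⟨ cong (_+_ (f 0)) (sym (sum-+ S _ _)) ⟩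
      f 0 + sum S (λ s → f (suc s) + κ * f s)       ≡⟨ cong (_+_ (f 0)) (sum-cong S (λ s _ → step s)) ⟩
      f 0 + sum S (λ s → g (suc s))                 ≡⟨ sym (sum-suc S g) ⟩
      sum (suc S) g                                 ∎
      where
      open ≡-Reasoning
      f g : ℕ → Carrier
      f s = fromℕ (binom p s) * κ ^ s
      g s = fromℕ (binom (suc p) s) * κ ^ s
      step : ∀ s → f (suc s) + κ * f s ≡ g (suc s)
      step s = trans (solve 4 (λ a b k x → a :* (k :* x) :+ k :* (b :* x) := (b :+ a) :* (k :* x)) refl (fromℕ (binom p (suc s))) (fromℕ (binom p s)) κ (κ ^ s))
                     (cong (_* (κ * κ ^ s)) (sym (fromℕ-+ (binom p s) (binom p (suc s)))))
        where open Solver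

    module _ (ζ k : Carrier) where

      -- (pζ)ᵃ (1 + ζk)ᵖ is a Newton series in p; coeff a s is its coefficient at ζˢ (p choose s)
      coeff : ℕ → ℕ → Carrier
      coeff zero    s       = k ^ s
      coeff (suc a) zero    = 0#
      coeff (suc a) (suc s) = fromℕ (suc s) * (coeff a s + ζ * coeff a (suc s))

      newton-term : ℕ → ℕ → ℕ → Carrier
      newton-term a p s = fromℕ (binom p s) * ζ ^ s * coeff a s

      -- Each factor p ζ is absorbed by `binom-*`. The limit S is arbitrary beyond p, where all
      -- terms vanish, so that the same first T terms can be split off at every grid point.
      newton : ∀ a p S → p ℕ.< S → (fromℕ p * ζ) ^ a * (1# + ζ * k) ^ p ≡ sum S (newton-term a p)
      newton zero p S p<S = trans (*-identityˡ _) (trans (binomial-theorem (ζ * k) p S p<S)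
        (sum-cong S (λ s _ → trans (cong (_*_ (fromℕ (binom p s))) (^-distrib-* ζ k s)) (sym (*-assoc _ _ _)))))
      newton (suc a) p (suc S) p<S = begin
        (fromℕ p * ζ) ^ suc a * (1# + ζ * k) ^ p          ≡⟨ *-assoc _ _ _ ⟩
        (fromℕ p * ζ) * ((fromℕ p * ζ) ^ a * (1# + ζ * k) ^ p) ≡⟨ cong (_*_ (fromℕ p * ζ)) (newton a p (suc S) p<S) ⟩
        (fromℕ p * ζ) * sum (suc S) (newton-term a p)     ≡⟨ sym (sum-* (suc S) _ _) ⟩
        sum (suc S) (λ s → (fromℕ p * ζ) * newton-term a p s) ≡⟨ sum-cong (suc S) (λ s _ → expand s) ⟩
        sum (suc S) (λ s → g s + h s)                     ≡⟨ sum-+ (suc S) g h ⟩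
        sum (suc S) g + sum (suc S) h                     ≡⟨ cong₂ _+_ (trans (sum-suc S g) (trans (cong (_+ sum S (λ s → g (suc s))) g0) (+-identityˡ _)))
                                                                       (trans (cong (_+_ (sum S h)) hS) (+-identityʳ _)) ⟩
        sum S (λ s → g (suc s)) + sum S h                 ≡⟨ sym (sum-+ S _ _) ⟩
        sum S (λ s → g (suc s) + h s)                     ≡⟨ sum-cong S (λ s _ → combine s) ⟩
        sum S (λ s → newton-term (suc a) p (suc s))       ≡⟨ sym (trans (cong (_+ sum S (λ s → newton-term (suc a) p (suc s))) (zeroʳ _)) (+-identityˡ _)) ⟩
        newton-term (suc a) p 0 + sum S (λ s → newton-term (suc a) p (suc s)) ≡⟨ sym (sum-suc S _) ⟩
        sum (suc S) (newton-term (suc a) p)               ∎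
        where
        open ≡-Reasoning
        open Solver
        g h : ℕ → Carrier
        g s = fromℕ s * fromℕ (binom p s) * (ζ * ζ ^ s) * coeff a s
        h s = fromℕ (suc s) * fromℕ (binom p (suc s)) * (ζ * ζ ^ s) * coeff a s
        expand : ∀ s → (fromℕ p * ζ) * newton-term a p s ≡ g s + h s
        expand s = trans (solve 5 (λ p z b zs c → (p :* z) :* (b :* zs :* c) := (p :* b) :* (z :* zs :* c)) refl (fromℕ p) ζ (fromℕ (binom p s)) (ζ ^ s) (coeff a s))
          (trans (cong (_* (ζ * ζ ^ s * coeff a s)) (trans (sym (fromℕ-* p (binom p s))) (trans (cong fromℕ (binom-* p s))
                   (trans (fromℕ-+ (s ℕ.* binom p s) (suc s ℕ.* binom p (suc s))) (cong₂ _+_ (fromℕ-* s (binom p s)) (fromℕ-* (suc s) (binom p (suc s))))))))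
            (solve 4 (λ x y z c → (x :+ y) :* (z :* c) := x :* z :* c :+ y :* z :* c) refl
               (fromℕ s * fromℕ (binom p s)) (fromℕ (suc s) * fromℕ (binom p (suc s))) (ζ * ζ ^ s) (coeff a s)))
        g0 : g 0 ≡ 0#
        g0 = solve 3 (λ b z c → con (+ 0) :* b :* z :* c := con (+ 0)) refl (fromℕ (binom p 0)) (ζ * ζ ^ 0) (coeff a 0)
        hS : h S ≡ 0#
        hS = trans (cong (λ b → fromℕ (suc S) * fromℕ b * (ζ * ζ ^ S) * coeff a S) (binom-> p (suc S) p<S))
          (solve 3 (λ b z c → b :* con (+ 0) :* z :* c := con (+ 0)) refl (fromℕ (suc S)) (ζ * ζ ^ S) (coeff a S))
        combine : ∀ s → g (suc s) + h s ≡ newton-term (suc a) p (suc s)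
        combine s = solve 6 (λ n b z zs c c' → n :* b :* (z :* (z :* zs)) :* c' :+ n :* b :* (z :* zs) :* c := b :* (z :* zs) :* (n :* (c :+ z :* c'))) refl
          (fromℕ (suc s)) (fromℕ (binom p (suc s))) ζ (ζ ^ s) (coeff a s) (coeff a (suc s))

      module _ (0≤ζ : 0# ≤ ζ) (0≤k : 0# ≤ k) where

        coeff-nonNeg : ∀ a s → 0# ≤ coeff a s
        coeff-nonNeg zero    s       = ^-nonNeg s 0≤k
        coeff-nonNeg (suc a) zero    = ≤-refl
        coeff-nonNeg (suc a) (suc s) = *-nonNeg (fromℕ-nonNeg (suc s)) (+-nonNeg (coeff-nonNeg a s) (*-nonNeg 0≤ζ (coeff-nonNeg a (suc s))))

        newton-term-nonNeg : ∀ a p s → 0# ≤ newton-term a p s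
        newton-term-nonNeg a p s = *-nonNeg (*-nonNeg (fromℕ-nonNeg (binom p s)) (^-nonNeg s 0≤ζ)) (coeff-nonNeg a s)

        module _ (K : ℕ) (1≤K : 1 ℕ.≤ K) (k≤K : k ≤ fromℕ K) where

          private
            k^≤ : ∀ s → k ^ s ≤ fromℕ (K ℕ.^ s)
            k^≤ s = subst (k ^ s ≤_) (sym (fromℕ-^ K s)) (^-mono s 0≤k k≤K)

          -- For the finitely many coefficients that the pigeonhole principle sees. Their growth is
          -- harmless there, as it only enters the number of boxes.
          coeff-≤ : ζ ≤ 1# → ∀ a s → coeff a s ≤ fromℕ (K ℕ.^ s ℕ.* (2 ℕ.* s) ℕ.^ a)
          coeff-≤ ζ≤1 zero    s       = subst (λ t → k ^ s ≤ fromℕ t) (sym (ℕP.*-identityʳ (K ℕ.^ s))) (k^≤ s)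
          coeff-≤ ζ≤1 (suc a) zero    = fromℕ-nonNeg (1 ℕ.* 0 ℕ.^ suc a)
          coeff-≤ ζ≤1 (suc a) (suc s) = ≤-trans
            (*-monoʳ (fromℕ (suc s)) (fromℕ-nonNeg (suc s))
              (+-mono (≤-trans (coeff-≤ ζ≤1 a s) (fromℕ-mono (ℕP.*-mono-≤ (ℕP.m≤n*m (K ℕ.^ s) K {{ℕ.>-nonZero 1≤K}}) (ℕP.^-monoˡ-≤ a (ℕP.*-monoʳ-≤ 2 (ℕP.n≤1+n s))))))
                      (≤-trans (subst (ζ * coeff a (suc s) ≤_) (*-identityˡ _) (*-monoˡ (coeff a (suc s)) (coeff-nonNeg a (suc s)) ζ≤1)) (coeff-≤ ζ≤1 a (suc s)))))
            (≤-reflexive (trans (cong (_*_ (fromℕ (suc s))) (sym (fromℕ-+ X X)))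
              (trans (sym (fromℕ-* (suc s) (X ℕ.+ X))) (cong fromℕ (lem (suc s) (K ℕ.^ suc s) ((2 ℕ.* suc s) ℕ.^ a))))))
            where
            X = K ℕ.^ suc s ℕ.* (2 ℕ.* suc s) ℕ.^ a
            lem : ∀ s x y → s ℕ.* (x ℕ.* y ℕ.+ x ℕ.* y) ≡ x ℕ.* ((2 ℕ.* s) ℕ.* y)
            lem = solve-∀

          module _ (R : ℕ) (1≤R : 1 ℕ.≤ R) where

            -- The coefficient may grow like (a + r)! / r!. The binomial coefficient supplies 1 / (a
            -- + r)!, so what survives in a Newton term is 1 / r!; this is the decay that makes the
            -- tail negligible.
            coeff-!-≤ : ∀ a r → fromℕ (a ℕ.+ r) * ζ ≤ fromℕ R →
              coeff a (a ℕ.+ r) * fromℕ (r !) ≤ fromℕ ((a ℕ.+ r) ! ℕ.* ((2 ℕ.* R) ℕ.^ a ℕ.* K ℕ.^ (a ℕ.+ r)))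
            coeff-!-≤ zero r h = ≤-trans (*-monoˡ (fromℕ (r !)) (fromℕ-nonNeg (r !)) (k^≤ r))
              (≤-reflexive (trans (sym (fromℕ-* (K ℕ.^ r) (r !))) (cong fromℕ (lem (K ℕ.^ r) (r !)))))
              where
              lem : ∀ x y → x ℕ.* y ≡ y ℕ.* (1 ℕ.* x)
              lem = solve-∀
            coeff-!-≤ (suc a) r h =
              fromℕ N * (c + ζ * c') * fromℕ (r !)                    ≡⟨ solve 5 (λ n c z c' f → n :* (c :+ z :* c') :* f := n :* (c :* f) :+ (n :* z) :* (c' :* f)) refl (fromℕ N) c ζ c' (fromℕ (r !)) ⟩'
              fromℕ N * (c * fromℕ (r !)) + (fromℕ N * ζ) * (c' * fromℕ (r !))
                ≤⟨ +-mono (*-monoʳ (fromℕ N) (fromℕ-nonNeg N) (coeff-!-≤ a r (≤-trans (*-monoˡ ζ 0≤ζ (fromℕ-mono (ℕP.n≤1+n (a ℕ.+ r)))) h)))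
                          (*-mono (*-nonNeg (fromℕ-nonNeg N) 0≤ζ) (*-nonNeg (coeff-nonNeg a N) (fromℕ-nonNeg (r !))) h
                             (≤-trans (*-monoʳ c' (coeff-nonNeg a N) (fromℕ-mono (ℕP.m≤n*m (r !) (suc r)))) ih')) ⟩
              fromℕ N * fromℕ (X ℕ.* (Y ℕ.* Z)) + fromℕ R * fromℕ ((N ℕ.* X) ℕ.* (Y ℕ.* (K ℕ.* Z)))
                ≡⟨ trans (cong₂ _+_ (sym (fromℕ-* N (X ℕ.* (Y ℕ.* Z)))) (sym (fromℕ-* R ((N ℕ.* X) ℕ.* (Y ℕ.* (K ℕ.* Z)))))) (sym (fromℕ-+ (N ℕ.* (X ℕ.* (Y ℕ.* Z))) _)) ⟩'
              fromℕ (N ℕ.* (X ℕ.* (Y ℕ.* Z)) ℕ.+ R ℕ.* ((N ℕ.* X) ℕ.* (Y ℕ.* (K ℕ.* Z))))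
                ≤⟨ fromℕ-mono fin ⟩
              fromℕ ((N ℕ.* X) ℕ.* ((2 ℕ.* R ℕ.* Y) ℕ.* (K ℕ.* Z))) □
              where
              open Solver
              N = suc (a ℕ.+ r)
              c = coeff a (a ℕ.+ r)
              c' = coeff a N
              X = (a ℕ.+ r) !
              Y = (2 ℕ.* R) ℕ.^ a
              Z = K ℕ.^ (a ℕ.+ r)
              ih' : c' * fromℕ (suc r !) ≤ fromℕ ((N ℕ.* X) ℕ.* (Y ℕ.* (K ℕ.* Z)))
              ih' = subst (λ n → coeff a n * fromℕ (suc r !) ≤ fromℕ (n ! ℕ.* (Y ℕ.* K ℕ.^ n))) (ℕP.+-suc a r)
                (coeff-!-≤ a (suc r) (subst (λ n → fromℕ n * ζ ≤ fromℕ R) (sym (ℕP.+-suc a r)) h))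
              l₁ : ∀ N X Y Z R K → N ℕ.* (X ℕ.* (Y ℕ.* Z)) ℕ.* (R ℕ.* K) ℕ.+ R ℕ.* ((N ℕ.* X) ℕ.* (Y ℕ.* (K ℕ.* Z))) ≡ (N ℕ.* X) ℕ.* ((2 ℕ.* R ℕ.* Y) ℕ.* (K ℕ.* Z))
              l₁ = solve-∀
              fin : N ℕ.* (X ℕ.* (Y ℕ.* Z)) ℕ.+ R ℕ.* ((N ℕ.* X) ℕ.* (Y ℕ.* (K ℕ.* Z))) ℕ.≤ (N ℕ.* X) ℕ.* ((2 ℕ.* R ℕ.* Y) ℕ.* (K ℕ.* Z))
              fin = subst (N ℕ.* (X ℕ.* (Y ℕ.* Z)) ℕ.+ R ℕ.* ((N ℕ.* X) ℕ.* (Y ℕ.* (K ℕ.* Z))) ℕ.≤_) (l₁ N X Y Z R K)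
                (ℕP.+-monoˡ-≤ (R ℕ.* ((N ℕ.* X) ℕ.* (Y ℕ.* (K ℕ.* Z)))) (ℕP.m≤m*n (N ℕ.* (X ℕ.* (Y ℕ.* Z))) (R ℕ.* K) {{ℕ.>-nonZero (ℕP.*-mono-≤ 1≤R 1≤K)}}))

            newton-term-!-≤ : ∀ a p r → fromℕ p * ζ ≤ fromℕ R → fromℕ (a ℕ.+ r) * ζ ≤ fromℕ R →
              fromℕ (r !) * newton-term a p (a ℕ.+ r) ≤ fromℕ ((R ℕ.* K) ℕ.^ (a ℕ.+ r) ℕ.* (2 ℕ.* R) ℕ.^ a)
            newton-term-!-≤ a p r hp hs = *-cancel (1≤fromℕ (ℕP.1≤n! s))
              ( fromℕ (s !) * (fromℕ (r !) * (fromℕ (binom p s) * ζ ^ s * coeff a s))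
                  ≡⟨ solve 5 (λ f g b z c → f :* (g :* (b :* z :* c)) := (f :* b :* z) :* (c :* g)) refl (fromℕ (s !)) (fromℕ (r !)) (fromℕ (binom p s)) (ζ ^ s) (coeff a s) ⟩'
                (fromℕ (s !) * fromℕ (binom p s) * ζ ^ s) * (coeff a s * fromℕ (r !))
                  ≤⟨ *-mono (*-nonNeg (*-nonNeg (fromℕ-nonNeg (s !)) (fromℕ-nonNeg (binom p s))) (^-nonNeg s 0≤ζ)) (*-nonNeg (coeff-nonNeg a s) (fromℕ-nonNeg (r !))) first (coeff-!-≤ a r hs) ⟩
                fromℕ (R ℕ.^ s) * fromℕ (s ! ℕ.* ((2 ℕ.* R) ℕ.^ a ℕ.* K ℕ.^ s))
                  ≡⟨ trans (sym (fromℕ-* (R ℕ.^ s) _)) (trans (cong fromℕ (trans (lem (R ℕ.^ s) (s !) ((2 ℕ.* R) ℕ.^ a) (K ℕ.^ s))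
                      (cong (λ t → s ! ℕ.* (t ℕ.* (2 ℕ.* R) ℕ.^ a)) (sym (ℕ^-distrib-* R K s))))) (fromℕ-* (s !) _)) ⟩'
                fromℕ (s !) * fromℕ ((R ℕ.* K) ℕ.^ s ℕ.* (2 ℕ.* R) ℕ.^ a) □ )
              where
              open Solver
              s = a ℕ.+ r
              lem : ∀ x f y z → x ℕ.* (f ℕ.* (y ℕ.* z)) ≡ f ℕ.* ((x ℕ.* z) ℕ.* y)
              lem = solve-∀
              first : fromℕ (s !) * fromℕ (binom p s) * ζ ^ s ≤ fromℕ (R ℕ.^ s)
              first = ≤-trans (*-monoˡ (ζ ^ s) (^-nonNeg s 0≤ζ) (≤-trans (≤-reflexive (sym (fromℕ-* (s !) (binom p s)))) (fromℕ-mono (!-binom-≤ p s))))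
                (≤-trans (≤-reflexive (trans (cong (_* ζ ^ s) (fromℕ-^ p s)) (sym (^-distrib-* (fromℕ p) ζ s))))
                  (subst ((fromℕ p * ζ) ^ s ≤_) (sym (fromℕ-^ R s)) (^-mono s (*-nonNeg (fromℕ-nonNeg p) 0≤ζ) hp)))

            -- Beyond s = p the term vanishes, so no bound on s ζ has to be assumed.
            newton-term-≤ : ∀ V a p s → a ℕ.≤ s → fromℕ p * ζ ≤ fromℕ R →
              V ℕ.* ((R ℕ.* K) ℕ.^ s ℕ.* (2 ℕ.* R) ℕ.^ a) ℕ.≤ (s ℕ.∸ a) ! → fromℕ V * newton-term a p s ≤ 1#
            newton-term-≤ V a p s a≤s hp hV with p ℕP.<? s
            ... | yes p<s = ≤-trans (≤-reflexive (trans (cong (λ b → fromℕ V * (fromℕ b * ζ ^ s * coeff a s)) (binom-> p s p<s))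
                  (solve 3 (λ v z c → v :* (con (+ 0) :* z :* c) := con (+ 0)) refl (fromℕ V) (ζ ^ s) (coeff a s)))) 0≤1
              where open Solver
            ... | no p≮s = *-cancel (1≤fromℕ (ℕP.1≤n! r))
                ( fromℕ (r !) * (fromℕ V * newton-term a p s)   ≡⟨ solve 3 (λ f v t → f :* (v :* t) := v :* (f :* t)) refl (fromℕ (r !)) (fromℕ V) (newton-term a p s) ⟩'
                  fromℕ V * (fromℕ (r !) * newton-term a p s)   ≤⟨ *-monoʳ (fromℕ V) (fromℕ-nonNeg V) bound ⟩
                  fromℕ V * fromℕ ((R ℕ.* K) ℕ.^ s ℕ.* (2 ℕ.* R) ℕ.^ a) ≡⟨ sym (fromℕ-* V _) ⟩'
                  fromℕ (V ℕ.* ((R ℕ.* K) ℕ.^ s ℕ.* (2 ℕ.* R) ℕ.^ a)) ≤⟨ fromℕ-mono hV ⟩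
                  fromℕ (r !)                                   ≡⟨ sym (*-identityʳ _) ⟩'
                  fromℕ (r !) * 1# □ )
              where
              open Solver
              r = s ℕ.∸ a
              bound : fromℕ (r !) * newton-term a p s ≤ fromℕ ((R ℕ.* K) ℕ.^ s ℕ.* (2 ℕ.* R) ℕ.^ a)
              bound = subst (λ n → fromℕ (r !) * newton-term a p n ≤ fromℕ ((R ℕ.* K) ℕ.^ n ℕ.* (2 ℕ.* R) ℕ.^ a)) (ℕP.m+[n∸m]≡n a≤s)
                (newton-term-!-≤ a p r hp (≤-trans (*-monoˡ ζ 0≤ζ (fromℕ-mono (subst (ℕ._≤ p) (sym (ℕP.m+[n∸m]≡n a≤s)) (ℕP.≮⇒≥ p≮s)))) hp))

    geometric-sum : ∀ r (t : ℕ → Carrier) → (∀ i → i ℕ.< r → fromℕ (2 ℕ.^ suc i) * t i ≤ 1#) → sum r t ≤ 1#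
    geometric-sum r t h = *-cancel (1≤fromℕ (ℕP.m^n>0 2 r)) (≤-trans (≤-trans le (≤-trans (≤-reflexive (+-comm _ _)) (go r h))) (≤-reflexive (sym (*-identityʳ _))))
      where
      le : fromℕ (2 ℕ.^ r) * sum r t ≤ fromℕ (2 ℕ.^ r) * sum r t + 1#
      le = subst (_≤ fromℕ (2 ℕ.^ r) * sum r t + 1#) (+-identityʳ _) (+-monoʳ _ 0≤1)
      -- The induction carries the sharper bound 1 - 2⁻ʳ for the partial sum, multiplied by 2ʳ.
      go : ∀ r → (∀ i → i ℕ.< r → fromℕ (2 ℕ.^ suc i) * t i ≤ 1#) → 1# + fromℕ (2 ℕ.^ r) * sum r t ≤ fromℕ (2 ℕ.^ r)
      go zero    h = ≤-reflexive (trans (cong (_+_ 1#) (zeroʳ _)) (trans (+-identityʳ _) (sym fromℕ-1)))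
      go (suc r) h =
        1# + fromℕ (2 ℕ.^ suc r) * (sum r t + t r)                          ≡⟨ cong (_+_ 1#) (distribˡ _ _ _) ⟩'
        1# + (fromℕ (2 ℕ.^ suc r) * sum r t + fromℕ (2 ℕ.^ suc r) * t r)    ≤⟨ +-monoʳ 1# (+-monoʳ _ (h r ℕP.≤-refl)) ⟩
        1# + (fromℕ (2 ℕ.^ suc r) * sum r t + 1#)                           ≡⟨ cong (λ u → 1# + (u * sum r t + 1#)) (fromℕ-* 2 (2 ℕ.^ r)) ⟩'
        1# + (fromℕ 2 * fromℕ (2 ℕ.^ r) * sum r t + 1#)                     ≡⟨ solve 3 (λ o a s → o :+ (con (+ 2) :* a :* s :+ o) := (o :+ a :* s) :+ (o :+ a :* s)) refl 1# (fromℕ (2 ℕ.^ r)) (sum r t) ⟩'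
        (1# + fromℕ (2 ℕ.^ r) * sum r t) + (1# + fromℕ (2 ℕ.^ r) * sum r t) ≤⟨ +-mono ih ih ⟩
        fromℕ (2 ℕ.^ r) + fromℕ (2 ℕ.^ r)                                   ≡⟨ trans (sym (fromℕ-+ (2 ℕ.^ r) (2 ℕ.^ r))) (cong (λ u → fromℕ (2 ℕ.^ r ℕ.+ u)) (sym (ℕP.+-identityʳ (2 ℕ.^ r)))) ⟩'
        fromℕ (2 ℕ.^ suc r) □
        where
        open Solver
        ih = go r (λ i i<r → h i (ℕP.m<n⇒m<1+n i<r))

-- Pigeonhole principle for coefficient tables, and integer exponents of the base 1 + 1/Q.

module Pigeonhole where

  open import Data.Empty using (⊥-elim)
  open import Data.Fin using (Fin; toℕ; fromℕ<)
  import Data.Fin.Properties as FinP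
  open import Data.Nat
  open import Data.Nat.Properties
  open import Data.Nat.DivMod
  open import Data.Nat.Tactic.RingSolver using (solve-∀)
  open import Data.Product using (Σ; _×_; _,_)
  open import Relation.Binary.PropositionalEquality
  open import Relation.Nullary using (¬_; Dec; yes; no)

  digit : (H : ℕ) .{{_ : NonZero H}} → ℕ → ℕ → ℕ
  digit H zero    x = x % H
  digit H (suc k) x = digit H k (x / H)

  digit-< : ∀ H .{{_ : NonZero H}} k x → digit H k x < H
  digit-< H zero    x = m%n<n x H
  digit-< H (suc k) x = digit-< H k (x / H)

  digit-injective : ∀ H .{{_ : NonZero H}} b x y → x < H ^ b → y < H ^ b →
    (∀ k → k < b → digit H k x ≡ digit H k y) → x ≡ y
  digit-injective H zero    x y x< y< h = trans (n<1⇒n≡0 x<) (sym (n<1⇒n≡0 y<))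
  digit-injective H (suc b) x y x< y< h = trans (m≡m%n+[m/n]*n x H)
    (trans (cong₂ (λ r q → r + q * H) (h 0 z<s)
       (digit-injective H b (x / H) (y / H) (quot x x<) (quot y y<) (λ k k<b → h (suc k) (s<s k<b))))
     (sym (m≡m%n+[m/n]*n y H)))
    where
    quot : ∀ z → z < H ^ suc b → z / H < H ^ b
    quot z z< = m<n*o⇒m/o<n (subst (z <_) (*-comm H (H ^ b)) z<)

  encode : ℕ → ℕ → (ℕ → ℕ) → ℕ
  encode N zero    f = 0
  encode N (suc T) f = f 0 + encode N T (λ t → f (suc t)) * N

  encode-< : ∀ N T f → (∀ t → t < T → f t < N) → encode N T f < N ^ T
  encode-< N zero    f h = z<s
  encode-< N (suc T) f h = begin-strict
    f 0 + e * N    <⟨ +-monoˡ-< (e * N) (h 0 z<s) ⟩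
    N + e * N      ≤⟨ *-monoˡ-≤ N (encode-< N T (λ t → f (suc t)) (λ t t<T → h (suc t) (s<s t<T))) ⟩
    N ^ T * N      ≡⟨ *-comm (N ^ T) N ⟩
    N * N ^ T      ∎
    where
    open ≤-Reasoning
    e = encode N T (λ t → f (suc t))

  encode-injective : ∀ N .{{_ : NonZero N}} T f g → (∀ t → t < T → f t < N) → (∀ t → t < T → g t < N) →
    encode N T f ≡ encode N T g → ∀ t → t < T → f t ≡ g t
  encode-injective N (suc T) f g hf hg e = λ { zero _ → head ; (suc t) (s≤s t<T) → tail t t<T }
    where
    ef = encode N T (λ t → f (suc t))
    eg = encode N T (λ t → g (suc t))
    head : f 0 ≡ g 0
    head = begin
      f 0                ≡⟨ m<n⇒m%n≡m (hf 0 z<s) ⟨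
      f 0 % N            ≡⟨ [m+kn]%n≡m%n (f 0) ef N ⟨
      (f 0 + ef * N) % N ≡⟨ cong (_% N) e ⟩
      (g 0 + eg * N) % N ≡⟨ [m+kn]%n≡m%n (g 0) eg N ⟩
      g 0 % N            ≡⟨ m<n⇒m%n≡m (hg 0 z<s) ⟩
      g 0                ∎
      where open ≡-Reasoning
    tail : ∀ t → t < T → f (suc t) ≡ g (suc t)
    tail = encode-injective N T (λ t → f (suc t)) (λ t → g (suc t)) (λ t t<T → hf (suc t) (s<s t<T)) (λ t t<T → hg (suc t) (s<s t<T))
      (*-cancelʳ-≡ ef eg N (+-cancelˡ-≡ (f 0) _ _ (trans e (cong (_+ eg * N) (sym head)))))

  -- A table with entries below `H` is read off a single number: a digit in base H ^ b gives the
  -- coefficients for one a, and its digits in base `H` give the entries.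
  coefficients : (H b : ℕ) .{{_ : NonZero H}} → ℕ → ℕ → ℕ → ℕ
  coefficients H b x a k = digit H k (digit (H ^ b) {{m^n≢0 H b}} a x)

  -- Tables are coded by numbers below (H ^ b) ^ A and vectors of box numbers by numbers below N ^
  -- T, which reduces the claim to the principle for `Fin`; decoding recovers a difference in some
  -- entry and equality of all boxes.
  pigeonhole : ∀ H .{{_ : NonZero H}} b A T N .{{_ : NonZero N}} → N ^ T < (H ^ b) ^ A →
    (g : (ℕ → ℕ → ℕ) → ℕ → ℕ) → (∀ c → (∀ a k → c a k < H) → ∀ t → t < T → g c t < N) →
    Σ (ℕ → ℕ → ℕ) λ c → Σ (ℕ → ℕ → ℕ) λ c' →
      (∀ a k → c a k < H) × (∀ a k → c' a k < H) ×
      ¬ (∀ a k → a < A → k < b → c a k ≡ c' a k) ×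
      (∀ t → t < T → g c t ≡ g c' t)
  pigeonhole H b A T N lt g hg with FinP.pigeonhole lt code
    where
    code : Fin ((H ^ b) ^ A) → Fin (N ^ T)
    code i = fromℕ< (encode-< N T (g c) (hg c (λ a k → digit-< H k _)))
      where c = coefficients H b (toℕ i)
  ... | i , j , i<j , e = c , c' , c< , c'< , distinct ,
        encode-injective N T (g c) (g c') (hg c c<) (hg c' c'<)
          (trans (sym (FinP.toℕ-fromℕ< _)) (trans (cong toℕ e) (FinP.toℕ-fromℕ< _)))
    where
    instance
      _ = m^n≢0 H b
    c = coefficients H b (toℕ i)
    c' = coefficients H b (toℕ j)
    c< : ∀ a k → c a k < H
    c< a k = digit-< H k _
    c'< : ∀ a k → c' a k < H
    c'< a k = digit-< H k _
    distinct : ¬ (∀ a k → a < A → k < b → c a k ≡ c' a k)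
    distinct h = <⇒≢ i<j (digit-injective (H ^ b) A (toℕ i) (toℕ j) (FinP.toℕ<n i) (FinP.toℕ<n j)
      (λ a a<A → digit-injective H b _ _ (digit-< (H ^ b) a (toℕ i)) (digit-< (H ^ b) a (toℕ j)) (λ k k<b → h a k a<A k<b)))

  -- A discrete intermediate value theorem. It replaces logarithms and integer parts: `exponent` and
  -- `floor` are both obtained from it.
  crossing : (P : ℕ → Set) → (∀ p → Dec (P p)) → P 0 → ∀ N → ¬ P N → Σ ℕ λ p → p < N × P p × ¬ P (suc p)
  crossing P P? P0 zero    ¬PN = ⊥-elim (¬PN P0)
  crossing P P? P0 (suc N) ¬PN with P? N
  ... | yes PN = N , ≤-refl , PN , ¬PN
  ... | no ¬P with crossing P P? P0 N ¬P
  ...   | p , p<N , r = p , m<n⇒m<1+n p<N , r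

  -- 1 + p/Q ≤ (1 + 1/Q)ᵖ, cleared of denominators.
  bernoulli : ∀ Q p → (Q + p) * Q ^ p ≤ Q * suc Q ^ p
  bernoulli Q zero    = ≤-reflexive (cong (_* 1) (+-identityʳ Q))
  bernoulli Q (suc p) = begin
    (Q + suc p) * (Q * Q ^ p)     ≡⟨ l₁ Q p (Q ^ p) ⟩
    (Q * (Q + p) + Q) * Q ^ p     ≤⟨ *-monoˡ-≤ (Q ^ p) (+-monoʳ-≤ (Q * (Q + p)) (m≤m+n Q p)) ⟩
    (Q * (Q + p) + (Q + p)) * Q ^ p ≡⟨ l₂ Q (Q + p) (Q ^ p) ⟩
    suc Q * ((Q + p) * Q ^ p)     ≤⟨ *-monoʳ-≤ (suc Q) (bernoulli Q p) ⟩
    suc Q * (Q * suc Q ^ p)       ≡⟨ l₃ (suc Q) Q (suc Q ^ p) ⟩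
    Q * (suc Q * suc Q ^ p)       ∎
    where
    open ≤-Reasoning
    l₁ : ∀ Q p x → (Q + suc p) * (Q * x) ≡ (Q * (Q + p) + Q) * x
    l₁ = solve-∀
    l₂ : ∀ Q y x → (Q * y + y) * x ≡ suc Q * (y * x)
    l₂ = solve-∀
    l₃ : ∀ a b c → a * (b * c) ≡ b * (a * c)
    l₃ = solve-∀

  -- Bernoulli's inequality for the base 1 - 1/(Q + 1), cleared of denominators; r stands for Q + 1
  -- - m.
  reverse-bernoulli : ∀ Q m r → m + r ≡ suc Q → suc Q ^ m * r ≤ suc Q * Q ^ m
  reverse-bernoulli Q zero    r refl = ≤-reflexive (trans (+-identityʳ r) (sym (*-identityʳ r)))
  reverse-bernoulli Q (suc m) r e = begin
    suc Q * suc Q ^ m * r         ≡⟨ l₁ (suc Q) (suc Q ^ m) r ⟩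
    suc Q ^ m * (suc Q * r)       ≤⟨ *-monoʳ-≤ (suc Q ^ m) step ⟩
    suc Q ^ m * (Q * suc r)       ≡⟨ l₂ (suc Q ^ m) Q (suc r) ⟩
    Q * (suc Q ^ m * suc r)       ≤⟨ *-monoʳ-≤ Q (reverse-bernoulli Q m (suc r) (trans (+-suc m r) e)) ⟩
    Q * (suc Q * Q ^ m)           ≡⟨ l₂' Q (suc Q) (Q ^ m) ⟩
    suc Q * (Q * Q ^ m)           ∎
    where
    open ≤-Reasoning
    step : suc Q * r ≤ Q * suc r
    step = begin
      r + Q * r   ≤⟨ +-monoˡ-≤ (Q * r) (subst (r ≤_) (suc-injective e) (m≤n+m r m)) ⟩
      Q + Q * r   ≡⟨ *-suc Q r ⟨
      Q * suc r   ∎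
    l₁ : ∀ a b c → a * b * c ≡ b * (a * c)
    l₁ = solve-∀
    l₂ : ∀ a b c → a * (b * c) ≡ b * (a * c)
    l₂ = solve-∀
    l₂' : ∀ a b c → a * (b * c) ≡ b * (a * c)
    l₂' = solve-∀

  -- p ≈ Q ln g: the base 1 + 1/Q has g between its p-th and its (p+1)-st power
  record Exponent (Q g : ℕ) : Set where
    field
      p     : ℕ
      lower : suc Q ^ p ≤ g * Q ^ p
      upper : g * Q ^ suc p < suc Q ^ suc p
      p<    : p < g * Q

  exponent : ∀ Q g → 1 ≤ Q → 1 ≤ g → Exponent Q g
  exponent Q g 1≤Q 1≤g with crossing (λ p → suc Q ^ p ≤ g * Q ^ p) (λ p → suc Q ^ p ≤? g * Q ^ p)
                             (≤-trans 1≤g (≤-reflexive (sym (*-identityʳ g)))) (g * Q) big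
    where
    instance
      _ = >-nonZero 1≤Q
    -- At p = g Q Bernoulli gives (1 + 1/Q)ᵖ ≥ 1 + g, so the crossing occurs earlier.
    big : ¬ (suc Q ^ (g * Q) ≤ g * Q ^ (g * Q))
    big h = <-irrefl refl (begin-strict
      Q * (g * Q ^ (g * Q))       <⟨ *-monoʳ-< Q (*-monoˡ-< (Q ^ (g * Q)) {{m^n≢0 Q (g * Q)}} (n<1+n g)) ⟩
      Q * (suc g * Q ^ (g * Q))   ≡⟨ l Q g (Q ^ (g * Q)) ⟩
      (Q + g * Q) * Q ^ (g * Q)   ≤⟨ bernoulli Q (g * Q) ⟩
      Q * suc Q ^ (g * Q)         ≤⟨ *-monoʳ-≤ Q h ⟩
      Q * (g * Q ^ (g * Q))       ∎)
      where
      open ≤-Reasoning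
      l : ∀ Q g x → Q * (suc g * x) ≡ (Q + g * Q) * x
      l = solve-∀
  ... | p , p<N , lo , hi = record { p = p ; lower = lo ; upper = ≰⇒> hi ; p< = p<N }

  -- A discrete form of ln 2 ≥ 1/2: for 2 p < Q the reverse inequality would give (1 + 1/Q)^(p + 1)
  -- ≤ 2. As p is a denominator later on, this lower bound keeps all quotients by it under control.
  exponent-two : ∀ Q (e : Exponent Q 2) → Q ≤ 2 * Exponent.p e
  exponent-two Q e with Q ≤? 2 * p
    where open Exponent e
  ... | yes h = h
  ... | no ¬h = ⊥-elim (<-irrefl refl (<-≤-trans upper (*-cancelˡ-≤ (suc Q) (begin
      suc Q * suc Q ^ suc p           ≤⟨ *-monoˡ-≤ (suc Q ^ suc p) r-big ⟩
      2 * r * suc Q ^ suc p           ≡⟨ l₁ r (suc Q ^ suc p) ⟩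
      2 * (suc Q ^ suc p * r)         ≤⟨ *-monoʳ-≤ 2 (reverse-bernoulli Q (suc p) r r-eq) ⟩
      2 * (suc Q * Q ^ suc p)         ≡⟨ l₂ (suc Q) (Q ^ suc p) ⟩
      suc Q * (2 * Q ^ suc p)         ∎))))
    where
    open Exponent e
    open ≤-Reasoning
    2p<Q : 2 * p < Q
    2p<Q = ≰⇒> ¬h
    r = suc Q ∸ suc p
    p≤Q : p ≤ Q
    p≤Q = ≤-trans (m≤m+n p (p + 0)) (<⇒≤ 2p<Q)
    r-eq : suc p + r ≡ suc Q
    r-eq = m+[n∸m]≡n (s≤s p≤Q)
    r-big : suc Q ≤ 2 * r
    r-big = +-cancelˡ-≤ (suc Q) _ _ (begin
      suc Q + suc Q               ≡⟨ cong₂ _+_ r-eq r-eq ⟨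
      (suc p + r) + (suc p + r)   ≡⟨ l₃ p r ⟩
      suc (suc (2 * p)) + 2 * r   ≤⟨ +-monoˡ-≤ (2 * r) (s≤s 2p<Q) ⟩
      suc Q + 2 * r               ∎)
      where
      l₃ : ∀ p r → (suc p + r) + (suc p + r) ≡ suc (suc (2 * p)) + 2 * r
      l₃ = solve-∀
    l₁ : ∀ r x → 2 * r * x ≡ 2 * (x * r)
    l₁ = solve-∀
    l₂ : ∀ r x → 2 * (r * x) ≡ r * (2 * x)
    l₂ = solve-∀

-- Double sums, integer parts, and the rational grid approximating the points (x, y).

module Grid where

  open OrderedField
  open NewtonSeries
  open Pigeonhole
  open import Data.Empty using (⊥-elim)
  open import Data.Integer using (+_)
  open import Data.Nat as ℕ using (ℕ; zero; suc)
  import Data.Nat.Properties as ℕP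
  open import Data.Nat.Tactic.RingSolver using (solve-∀)
  open import Data.Product using (Σ; _×_; _,_; proj₁; proj₂)
  open import Relation.Binary.PropositionalEquality
  open import Relation.Nullary using (¬_; yes; no)

  module DoubleSum (F : OField) (b D : ℕ) where
    open OFieldTheory F

    dsum : (ℕ → ℕ → Carrier) → Carrier
    dsum f = sum b (λ k → sum D (λ a → f a k))

    dsum-cong : ∀ {f g} → (∀ a k → a ℕ.< D → k ℕ.< b → f a k ≡ g a k) → dsum f ≡ dsum g
    dsum-cong h = sum-cong b (λ k k<b → sum-cong D (λ a a<D → h a k a<D k<b))

    dsum-+ : ∀ f g → dsum (λ a k → f a k + g a k) ≡ dsum f + dsum g
    dsum-+ f g = trans (sum-cong b (λ k _ → sum-+ D _ _)) (sum-+ b _ _)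

    dsum-neg : ∀ f → dsum (λ a k → - f a k) ≡ - dsum f
    dsum-neg f = trans (sum-cong b (λ k _ → sum-neg D _)) (sum-neg b _)

    dsum-* : ∀ c f → dsum (λ a k → c * f a k) ≡ c * dsum f
    dsum-* c f = trans (sum-cong b (λ k _ → sum-* D c _)) (sum-* b c _)

    dsum-sum : ∀ T (f : ℕ → ℕ → ℕ → Carrier) → dsum (λ a k → sum T (f a k)) ≡ sum T (λ s → dsum (λ a k → f a k s))
    dsum-sum T f = trans (sum-cong b (λ k _ → sum-swap D T (λ a s → f a k s))) (sum-swap b T _)

    dsum-nonNeg : ∀ {f} → (∀ a k → a ℕ.< D → k ℕ.< b → 0# ≤ f a k) → 0# ≤ dsum f
    dsum-nonNeg h = sum-nonNeg b (λ k k<b → sum-nonNeg D (λ a a<D → h a k a<D k<b))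

    dsum-bound : ∀ {f c} → (∀ a k → a ℕ.< D → k ℕ.< b → f a k ≤ c) → dsum f ≤ fromℕ (b ℕ.* D) * c
    dsum-bound {c = c} h = ≤-trans (sum-bound b (λ k k<b → sum-bound D (λ a a<D → h a k a<D k<b)))
      (≤-reflexive (trans (sym (*-assoc _ _ _)) (cong (_* c) (sym (fromℕ-* b D)))))

    dsum-abs : ∀ {f c} → (∀ a k → a ℕ.< D → k ℕ.< b → ∣ f a k ∣≤ c) → ∣ dsum f ∣≤ (fromℕ (b ℕ.* D) * c)
    dsum-abs {f} {c} h = dsum-bound (λ a k p q → proj₁ (h a k p q))
      , subst (_≤ fromℕ (b ℕ.* D) * c) (dsum-neg f) (dsum-bound (λ a k p q → proj₂ (h a k p q)))

  module Floor (F : OField) where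
    open OFieldTheory F

    floor : ℕ → ∀ x → 0# ≤ x → ℕ
    floor N x 0≤x with fromℕ N ≤? x
    -- A default: the lemmas on `floor` assume that x is below N.
    ... | yes _ = 0
    ... | no ¬p = proj₁ (crossing (λ p → fromℕ p ≤ x) (λ p → fromℕ p ≤? x) 0≤x N ¬p)

    floor-< : ∀ N x 0≤x → ¬ (fromℕ N ≤ x) → floor N x 0≤x ℕ.< N
    floor-< N x 0≤x ¬q with fromℕ N ≤? x
    ... | yes q = ⊥-elim (¬q q)
    ... | no ¬p = proj₁ (proj₂ (crossing (λ p → fromℕ p ≤ x) (λ p → fromℕ p ≤? x) 0≤x N ¬p))

    floor-spec : ∀ N x 0≤x → ¬ (fromℕ N ≤ x) → fromℕ (floor N x 0≤x) ≤ x × x ≤ fromℕ (floor N x 0≤x) + 1#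
    floor-spec N x 0≤x ¬q with fromℕ N ≤? x
    ... | yes q = ⊥-elim (¬q q)
    ... | no ¬p with crossing (λ p → fromℕ p ≤ x) (λ p → fromℕ p ≤? x) 0≤x N ¬p
    ...   | p , _ , lo , hi = lo , ≤-trans (≰⇒≥ hi) (≤-reflexive (+-comm _ _))

    floor-close : ∀ N x y 0≤x 0≤y → ¬ (fromℕ N ≤ x) → ¬ (fromℕ N ≤ y) → floor N x 0≤x ≡ floor N y 0≤y → ∣ x - y ∣≤ 1#
    floor-close N x y 0≤x 0≤y ¬p ¬q e with floor N x 0≤x | floor N y 0≤y | floor-spec N x 0≤x ¬p | floor-spec N y 0≤y ¬q
    floor-close N x y 0≤x 0≤y ¬p ¬q refl | f | _ | lx , ux | ly , uy =
        ≤-trans (+-mono ux (neg-mono ly)) (≤-reflexive (solve 2 (λ f o → f :+ o :- f := o) refl (fromℕ f) 1#))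
      , ≤-trans (≤-reflexive (solve 2 (λ x y → :- (x :- y) := y :- x) refl x y))
          (≤-trans (+-mono uy (neg-mono lx)) (≤-reflexive (solve 2 (λ f o → f :+ o :- f := o) refl (fromℕ f) 1#)))
      where open Solver

  grid-≤ : ∀ i j n Q R {p q} → p ℕ.≤ 2 ℕ.* Q → q ℕ.≤ n ℕ.* Q → 2 ℕ.* i ℕ.+ n ℕ.* j ℕ.≤ R → i ℕ.* p ℕ.+ j ℕ.* q ℕ.≤ R ℕ.* Q
  grid-≤ i j n Q R {p} {q} hp hq h = begin
    i ℕ.* p ℕ.+ j ℕ.* q                     ≤⟨ ℕP.+-mono-≤ (ℕP.*-monoʳ-≤ i hp) (ℕP.*-monoʳ-≤ j hq) ⟩
    i ℕ.* (2 ℕ.* Q) ℕ.+ j ℕ.* (n ℕ.* Q)     ≡⟨ l i j n Q ⟩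
    (2 ℕ.* i ℕ.+ n ℕ.* j) ℕ.* Q             ≤⟨ ℕP.*-monoˡ-≤ Q h ⟩
    R ℕ.* Q                                 ∎
    where
    open ℕP.≤-Reasoning
    l : ∀ i j n Q → i ℕ.* (2 ℕ.* Q) ℕ.+ j ℕ.* (n ℕ.* Q) ≡ (2 ℕ.* i ℕ.+ n ℕ.* j) ℕ.* Q
    l = solve-∀

  -- The grid of mesh ζ = 1/Q on the axis of log y: the point (i , j) sits at p i j,
  -- where (1 + ζ) ^ p i j approximates y = 2ⁱ nʲ.
  module GridPoints (F : OField) (Q n B : ℕ) (1≤Q : 1 ℕ.≤ Q) (1≤n : 1 ℕ.≤ n) (1≤B : 1 ℕ.≤ B)
              (e₂ : Exponent Q 2) (eₙ : Exponent Q n) where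
    open OFieldTheory F
    open Expansion F
    open Exponent e₂ using () renaming (p to p₂; lower to lower₂; upper to upper₂; p< to p₂<) public
    open Exponent eₙ using () renaming (p to pₙ; lower to lowerₙ; upper to upperₙ; p< to pₙ<) public

    recip : ∀ a → 1 ℕ.≤ a → Σ Carrier λ x → fromℕ a * x ≡ 1# × 0# ≤ x
    recip a 1≤a with inverse (fromℕ a) (λ a≤0 → 1≰0 (≤-trans (1≤fromℕ 1≤a) a≤0))
    ... | x , e = x , e , *-cancel (1≤fromℕ 1≤a) (≤-trans (≤-reflexive (zeroʳ _)) (≤-trans 0≤1 (≤-reflexive (sym e))))

    1≤p₂ : 1 ℕ.≤ p₂
    1≤p₂ with p₂ | exponent-two Q e₂
    ... | zero  | h = ⊥-elim (ℕP.<-irrefl refl (ℕP.<-≤-trans 1≤Q h))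
    ... | suc _ | _ = ℕ.s≤s ℕ.z≤n

    ζ : Carrier
    ζ = proj₁ (recip Q 1≤Q)
    Qζ≡1 : fromℕ Q * ζ ≡ 1#
    Qζ≡1 = proj₁ (proj₂ (recip Q 1≤Q))
    0≤ζ : 0# ≤ ζ
    0≤ζ = proj₂ (proj₂ (recip Q 1≤Q))
    ζ≤1 : ζ ≤ 1#
    ζ≤1 = subst₂ _≤_ (*-identityˡ ζ) Qζ≡1 (*-monoˡ ζ 0≤ζ (1≤fromℕ 1≤Q))

    1/p₂ : Carrier
    1/p₂ = proj₁ (recip p₂ 1≤p₂)
    p₂/p₂≡1 : fromℕ p₂ * 1/p₂ ≡ 1#
    p₂/p₂≡1 = proj₁ (proj₂ (recip p₂ 1≤p₂))
    0≤1/p₂ : 0# ≤ 1/p₂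
    0≤1/p₂ = proj₂ (proj₂ (recip p₂ 1≤p₂))

    -- Since p₂ ≈ Q ln 2 and pₙ ≈ Q ln n, this approximates B log₂ n, the presumed value of β.
    -- Likewise w ≈ B / ln 2 converts the coordinate p ζ ≈ ln y into x = B log₂ y.
    ρ : Carrier
    ρ = fromℕ (B ℕ.* pₙ) * 1/p₂
    w : Carrier
    w = fromℕ (B ℕ.* Q) * 1/p₂

    0≤ρ : 0# ≤ ρ
    0≤ρ = *-nonNeg (fromℕ-nonNeg (B ℕ.* pₙ)) 0≤1/p₂
    0≤w : 0# ≤ w
    0≤w = *-nonNeg (fromℕ-nonNeg (B ℕ.* Q)) 0≤1/p₂

    w≤2B : w ≤ fromℕ (2 ℕ.* B)
    w≤2B = ≤-trans (*-monoˡ 1/p₂ 0≤1/p₂ (fromℕ-mono (ℕP.*-monoʳ-≤ B (exponent-two Q e₂))))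
      (≤-reflexive (trans (cong (_* 1/p₂) (trans (cong fromℕ (l B p₂)) (fromℕ-* (2 ℕ.* B) p₂)))
        (trans (*-assoc _ _ _) (trans (cong (_*_ _) p₂/p₂≡1) (*-identityʳ _)))))
      where
      l : ∀ B p → B ℕ.* (2 ℕ.* p) ≡ (2 ℕ.* B) ℕ.* p
      l = solve-∀

    p : ℕ → ℕ → ℕ
    p i j = i ℕ.* p₂ ℕ.+ j ℕ.* pₙ

    ξ : ℕ → ℕ → Carrier
    ξ i j = fromℕ (B ℕ.* i) + fromℕ j * ρ

    -- Exact because ρ and w share the denominator p₂. Thus x is a linear function of the grid
    -- coordinate, the Newton series applies to it as it stands, and approximating y by a power of 1
    -- + ζ is a separate error.
    w-p : ∀ i j → w * (fromℕ (p i j) * ζ) ≡ ξ i j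
    w-p i j = begin
      fromℕ (B ℕ.* Q) * 1/p₂ * (fromℕ (p i j) * ζ)
        ≡⟨ cong₂ (λ s t → s * 1/p₂ * (t * ζ)) (fromℕ-* B Q) (trans (fromℕ-+ (i ℕ.* p₂) (j ℕ.* pₙ)) (cong₂ _+_ (fromℕ-* i p₂) (fromℕ-* j pₙ))) ⟩
      (fromℕ B * fromℕ Q) * 1/p₂ * ((fromℕ i * fromℕ p₂ + fromℕ j * fromℕ pₙ) * ζ)
        ≡⟨ solve 8 (λ b q r i p j s z → (b :* q) :* r :* ((i :* p :+ j :* s) :* z) := (q :* z) :* ((p :* r) :* (b :* i) :+ j :* ((b :* s) :* r))) refl
             (fromℕ B) (fromℕ Q) 1/p₂ (fromℕ i) (fromℕ p₂) (fromℕ j) (fromℕ pₙ) ζ ⟩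
      (fromℕ Q * ζ) * ((fromℕ p₂ * 1/p₂) * (fromℕ B * fromℕ i) + fromℕ j * ((fromℕ B * fromℕ pₙ) * 1/p₂))
        ≡⟨ cong₂ (λ s t → s * (t * (fromℕ B * fromℕ i) + fromℕ j * ((fromℕ B * fromℕ pₙ) * 1/p₂))) Qζ≡1 p₂/p₂≡1 ⟩
      1# * (1# * (fromℕ B * fromℕ i) + fromℕ j * ((fromℕ B * fromℕ pₙ) * 1/p₂))
        ≡⟨ trans (*-identityˡ _) (cong₂ _+_ (trans (*-identityˡ _) (sym (fromℕ-* B i))) (cong (λ t → fromℕ j * (t * 1/p₂)) (sym (fromℕ-* B pₙ)))) ⟩
      ξ i j ∎
      where
      open ≡-Reasoning
      open Solver

    pζ≤ : ∀ R i j → 2 ℕ.* i ℕ.+ n ℕ.* j ℕ.≤ R → fromℕ (p i j) * ζ ≤ fromℕ R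
    pζ≤ R i j h = ≤-trans (*-monoˡ ζ 0≤ζ (fromℕ-mono le))
      (≤-reflexive (trans (cong (_* ζ) (fromℕ-* R Q)) (trans (*-assoc _ _ _) (trans (cong (_*_ _) Qζ≡1) (*-identityʳ _)))))
      where
      le : p i j ℕ.≤ R ℕ.* Q
      le = grid-≤ i j n Q R (ℕP.<⇒≤ p₂<) (ℕP.<⇒≤ pₙ<) h

    θ : Carrier
    θ = 1# + ζ

    0≤θ : 0# ≤ θ
    0≤θ = +-nonNeg 0≤1 0≤ζ

    -- The difference quotient (θᵇ - 1) / ζ, written as a geometric sum so that no division occurs
    -- and nonnegativity is evident.
    slope : ℕ → Carrier
    slope zero    = 0#
    slope (suc b) = slope b * θ + 1#

    θ^ : ∀ b → θ ^ b ≡ 1# + ζ * slope b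
    θ^ zero    = sym (trans (cong (_+_ 1#) (zeroʳ ζ)) (+-identityʳ _))
    θ^ (suc b) = trans (cong (_*_ θ) (θ^ b))
      (trans (solve 3 (λ o z s → (o :+ z) :* (o :+ z :* s) := (o :* o) :+ z :* (s :* (o :+ z) :+ o) :+ (o :* z :* s :- z :* s :* o)) refl 1# ζ (slope b))
      (trans (cong₂ _+_ (cong (_+ (ζ * (slope b * (1# + ζ) + 1#))) (*-identityˡ 1#)) (solve 3 (λ o z s → o :* z :* s :- z :* s :* o := con (+ 0)) refl 1# ζ (slope b))) (+-identityʳ _)))
      where open Solver

    slope-nonNeg : ∀ b → 0# ≤ slope b
    slope-nonNeg zero    = ≤-refl
    slope-nonNeg (suc b) = +-nonNeg (*-nonNeg (slope-nonNeg b) 0≤θ) 0≤1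

    slope≤ : ∀ b → slope b ≤ fromℕ (2 ℕ.^ b)
    slope≤ b = ≤-trans (subst (_≤ slope b + 1#) (+-identityʳ _) (+-monoʳ _ 0≤1)) (go b)
      where
      go : ∀ b → slope b + 1# ≤ fromℕ (2 ℕ.^ b)
      go zero    = ≤-reflexive (trans (+-identityˡ _) (sym fromℕ-1))
      go (suc b) =
        slope b * θ + 1# + 1#                     ≤⟨ +-monoˡ 1# (+-monoˡ 1# (*-monoʳ (slope b) (slope-nonNeg b) (+-monoʳ 1# ζ≤1))) ⟩
        slope b * (1# + 1#) + 1# + 1#             ≡⟨ trans (cong (λ t → t + 1# + 1#) (trans (distribˡ _ _ _) (cong₂ _+_ (*-identityʳ _) (*-identityʳ _))))
                                                       (solve 2 (λ s o → (s :+ s) :+ o :+ o := (s :+ o) :+ (s :+ o)) refl (slope b) 1#) ⟩'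
        (slope b + 1#) + (slope b + 1#)           ≤⟨ +-mono (go b) (go b) ⟩
        fromℕ (2 ℕ.^ b) + fromℕ (2 ℕ.^ b)         ≡⟨ trans (sym (fromℕ-+ (2 ℕ.^ b) (2 ℕ.^ b))) (cong (λ u → fromℕ (2 ℕ.^ b ℕ.+ u)) (sym (ℕP.+-identityʳ (2 ℕ.^ b)))) ⟩'
        fromℕ (2 ℕ.^ suc b) □
        where open Solver

    private
      sucQζ : fromℕ (suc Q) * ζ ≡ θ
      sucQζ = trans (distribʳ _ _ _) (trans (cong₂ _+_ (*-identityˡ ζ) Qζ≡1) (+-comm _ _))

      scaled : ∀ q → fromℕ (suc Q ℕ.^ q) * ζ ^ q ≡ θ ^ q
      scaled q = trans (cong (_* ζ ^ q) (fromℕ-^ (suc Q) q)) (trans (sym (^-distrib-* _ ζ q)) (cong (_^ q) sucQζ))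

      scaled' : ∀ g q → fromℕ (g ℕ.* Q ℕ.^ q) * ζ ^ q ≡ fromℕ g
      scaled' g q = trans (cong (_* ζ ^ q) (trans (fromℕ-* g (Q ℕ.^ q)) (cong (_*_ (fromℕ g)) (fromℕ-^ Q q))))
        (trans (*-assoc _ _ _) (trans (cong (_*_ (fromℕ g)) (trans (sym (^-distrib-* _ ζ q)) (trans (cong (_^ q) Qζ≡1) (1^ q)))) (*-identityʳ _)))

    θ^-lower : ∀ {g} (e : Exponent Q g) → θ ^ Exponent.p e ≤ fromℕ g
    θ^-lower {g} e = subst₂ _≤_ (scaled q) (scaled' g q) (*-monoˡ (ζ ^ q) (^-nonNeg q 0≤ζ) (fromℕ-mono (Exponent.lower e)))
      where q = Exponent.p e

    θ^-upper : ∀ {g} (e : Exponent Q g) → fromℕ g ≤ θ ^ suc (Exponent.p e)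
    θ^-upper {g} e = subst₂ _≤_ (scaled' g q) (scaled q) (*-monoˡ (ζ ^ q) (^-nonNeg q 0≤ζ) (fromℕ-mono (ℕP.<⇒≤ (Exponent.upper e))))
      where q = suc (Exponent.p e)

    y : ℕ → ℕ → ℕ
    y i j = 2 ℕ.^ i ℕ.* n ℕ.^ j

    private
      y≡ : ∀ i j → fromℕ (y i j) ≡ fromℕ 2 ^ i * fromℕ n ^ j
      y≡ i j = trans (fromℕ-* (2 ℕ.^ i) (n ℕ.^ j)) (cong₂ _*_ (fromℕ-^ 2 i) (fromℕ-^ n j))

    y-lower : ∀ i j → θ ^ p i j ≤ fromℕ (y i j)
    y-lower i j = subst₂ _≤_ eq (sym (y≡ i j)) (*-mono (^-nonNeg i (^-nonNeg p₂ 0≤θ)) (^-nonNeg j (^-nonNeg pₙ 0≤θ))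
        (^-mono i (^-nonNeg p₂ 0≤θ) (θ^-lower e₂)) (^-mono j (^-nonNeg pₙ 0≤θ) (θ^-lower eₙ)))
      where
      eq : (θ ^ p₂) ^ i * (θ ^ pₙ) ^ j ≡ θ ^ p i j
      eq = trans (cong₂ _*_ (trans (^-^ θ p₂ i) (cong (θ ^_) (ℕP.*-comm p₂ i))) (trans (^-^ θ pₙ j) (cong (θ ^_) (ℕP.*-comm pₙ j)))) (sym (^-+ θ (i ℕ.* p₂) (j ℕ.* pₙ)))

    y-upper : ∀ i j → fromℕ (y i j) ≤ θ ^ p i j * θ ^ (i ℕ.+ j)
    y-upper i j = subst₂ _≤_ (sym (y≡ i j)) eq (*-mono (^-nonNeg i (fromℕ-nonNeg 2)) (^-nonNeg j (fromℕ-nonNeg n))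
        (^-mono i (fromℕ-nonNeg 2) (θ^-upper e₂)) (^-mono j (fromℕ-nonNeg n) (θ^-upper eₙ)))
      where
      l : ∀ i j a b → suc a ℕ.* i ℕ.+ suc b ℕ.* j ≡ (i ℕ.* a ℕ.+ j ℕ.* b) ℕ.+ (i ℕ.+ j)
      l = solve-∀
      eq : (θ ^ suc p₂) ^ i * (θ ^ suc pₙ) ^ j ≡ θ ^ p i j * θ ^ (i ℕ.+ j)
      eq = trans (cong₂ _*_ (^-^ θ (suc p₂) i) (^-^ θ (suc pₙ) j)) (trans (sym (^-+ θ (suc p₂ ℕ.* i) (suc pₙ ℕ.* j)))
        (trans (cong (θ ^_) (l i j p₂ pₙ)) (^-+ θ (p i j) (i ℕ.+ j))))

    -- θᵇ to the power p i j, in the form handled by the Newton series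
    expo : ℕ → ℕ → ℕ → Carrier
    expo b i j = (1# + ζ * slope b) ^ p i j

    expo≡ : ∀ b i j → expo b i j ≡ (θ ^ p i j) ^ b
    expo≡ b i j = trans (cong (_^ p i j) (sym (θ^ b))) (trans (^-^ θ b (p i j)) (trans (cong (θ ^_) (ℕP.*-comm b (p i j))) (sym (^-^ θ (p i j) b))))

    -- The true y exceeds θ ^ p i j by a factor of at most θ ^ (i + j), one step of the base for
    -- each factor 2 or n. After taking the b-th power the relative error is θ ^ t - 1 = ζ slope t
    -- with t = (i + j) b, and slope t ≤ 2 ^ t.
    y^-error : ∀ Y E b i j → y i j ℕ.^ b ℕ.≤ Y → 2 ℕ.^ ((i ℕ.+ j) ℕ.* b) ℕ.≤ E →
      ∣ fromℕ (y i j ℕ.^ b) - expo b i j ∣≤ (fromℕ (Y ℕ.* E) * ζ)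
    y^-error Y E b i j hY hE = abs-of-nonNeg (x-y≥0 lo) up
      where
      open Solver
      lo : expo b i j ≤ fromℕ (y i j ℕ.^ b)
      lo = subst₂ _≤_ (sym (expo≡ b i j)) (sym (fromℕ-^ (y i j) b)) (^-mono b (^-nonNeg (p i j) 0≤θ) (y-lower i j))
      t = (i ℕ.+ j) ℕ.* b
      hi : fromℕ (y i j ℕ.^ b) ≤ expo b i j * (1# + ζ * slope t)
      hi = subst₂ _≤_ (sym (fromℕ-^ (y i j) b)) (trans (^-distrib-* _ _ b) (cong₂ _*_ (sym (expo≡ b i j)) (trans (^-^ θ (i ℕ.+ j) b) (θ^ t))))
        (^-mono b (fromℕ-nonNeg (y i j)) (y-upper i j))
      0≤expo : 0# ≤ expo b i j
      0≤expo = subst (0# ≤_) (sym (expo≡ b i j)) (^-nonNeg b (^-nonNeg (p i j) 0≤θ))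
      up : fromℕ (y i j ℕ.^ b) - expo b i j ≤ fromℕ (Y ℕ.* E) * ζ
      up =
        fromℕ (y i j ℕ.^ b) - expo b i j                         ≤⟨ +-monoˡ _ hi ⟩
        expo b i j * (1# + ζ * slope t) - expo b i j             ≡⟨ trans (cong (_- expo b i j) (trans (distribˡ _ _ _) (cong (_+ expo b i j * (ζ * slope t)) (*-identityʳ _))))
                                                                      (solve 3 (λ e z s → e :+ e :* (z :* s) :- e := (e :* s) :* z) refl (expo b i j) ζ (slope t)) ⟩'
        (expo b i j * slope t) * ζ                               ≤⟨ *-monoˡ ζ 0≤ζ (*-mono 0≤expo (slope-nonNeg t) (≤-trans lo (fromℕ-mono hY)) (≤-trans (slope≤ t) (fromℕ-mono hE))) ⟩
        (fromℕ Y * fromℕ E) * ζ                                  ≡⟨ cong (_* ζ) (sym (fromℕ-* Y E)) ⟩'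
        fromℕ (Y ℕ.* E) * ζ □

-- Two coefficient tables whose values nearly agree on the whole grid.

module SmallValues where

  open OrderedField
  open NewtonSeries
  open Pigeonhole
  open Grid
  open import Data.Integer using (+_)
  open import Data.Nat as ℕ using (ℕ; suc; _!)
  import Data.Nat.Properties as ℕP
  open import Data.Product using (Σ; _×_; _,_; proj₁; proj₂)
  open import Relation.Binary.PropositionalEquality
  open import Relation.Nullary using (¬_)

  module Boxes
    (F : OField) (Q n B : ℕ) (1≤Q : 1 ℕ.≤ Q) (1≤n : 1 ℕ.≤ n) (1≤B : 1 ℕ.≤ B)
    (e₂ : Exponent Q 2) (eₙ : Exponent Q n)
    (b D H T R Λ Gam N : ℕ) (1≤b : 1 ℕ.≤ b) (1≤D : 1 ℕ.≤ D) (1≤H : 1 ℕ.≤ H) (1≤T : 1 ℕ.≤ T) (1≤R : 1 ℕ.≤ R) (D≤T : D ℕ.≤ T)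
    (hGam : ∀ a s → a ℕ.< D → s ℕ.< T → (2 ℕ.* B) ℕ.^ a ℕ.* ((2 ℕ.^ b) ℕ.^ s ℕ.* (2 ℕ.* s) ℕ.^ a) ℕ.≤ Gam)
    (hN : (b ℕ.* D) ℕ.* (H ℕ.* Gam) ℕ.* (Λ ℕ.* (T ℕ.* R ℕ.^ T)) ℕ.< N)
    (hTail : ∀ a s → a ℕ.< D → T ℕ.≤ s →
       (Λ ℕ.* ((b ℕ.* D) ℕ.* (H ℕ.* (2 ℕ.* B) ℕ.^ D)) ℕ.* 2 ℕ.^ suc s) ℕ.* ((R ℕ.* 2 ℕ.^ b) ℕ.^ s ℕ.* (2 ℕ.* R) ℕ.^ a) ℕ.≤ (s ℕ.∸ a) !)
    (hPigeon : N ℕ.^ T ℕ.< (H ℕ.^ b) ℕ.^ D)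
    where
    open OFieldTheory F
    open Expansion F
    open GridPoints F Q n B 1≤Q 1≤n 1≤B e₂ eₙ
    open DoubleSum F b D
    open Floor F

    K : ℕ
    K = 2 ℕ.^ b

    1≤K : 1 ℕ.≤ K
    1≤K = ℕP.m^n>0 2 b

    slope≤K : ∀ k → k ℕ.< b → slope k ≤ fromℕ K
    slope≤K k k<b = ≤-trans (slope≤ k) (fromℕ-mono (ℕP.^-monoʳ-≤ 2 (ℕP.<⇒≤ k<b)))

    cf : ℕ → ℕ → ℕ → Carrier
    cf k a s = coeff ζ (slope k) a s

    nt : ℕ → ℕ → ℕ → ℕ → Carrier
    nt k a q s = newton-term ζ (slope k) a q s

    w^≤ : ∀ a → w ^ a ≤ fromℕ ((2 ℕ.* B) ℕ.^ a)
    w^≤ a = subst (w ^ a ≤_) (sym (fromℕ-^ (2 ℕ.* B) a)) (^-mono a 0≤w w≤2B)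

    -- The part of the s-th Newton term that is common to all grid points; only the factor binom (p
    -- i j) s · ζˢ varies. Finitely many forms therefore control all values at once.
    form : (ℕ → ℕ → ℕ) → ℕ → Carrier
    form c s = dsum (λ a k → fromℕ (c a k) * (w ^ a * cf k a s))

    form-nonNeg : ∀ c s → 0# ≤ form c s
    form-nonNeg c s = dsum-nonNeg (λ a k _ _ → *-nonNeg (fromℕ-nonNeg (c a k)) (*-nonNeg (^-nonNeg a 0≤w) (coeff-nonNeg ζ (slope k) 0≤ζ (slope-nonNeg k) a s)))

    form-≤ : ∀ c s → (∀ a k → c a k ℕ.< H) → s ℕ.< T → form c s ≤ fromℕ ((b ℕ.* D) ℕ.* (H ℕ.* Gam))
    form-≤ c s hc s<T = ≤-trans (dsum-bound {c = fromℕ (H ℕ.* Gam)} term)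
      (≤-reflexive (sym (fromℕ-* (b ℕ.* D) (H ℕ.* Gam))))
      where
      term : ∀ a k → a ℕ.< D → k ℕ.< b → fromℕ (c a k) * (w ^ a * cf k a s) ≤ fromℕ (H ℕ.* Gam)
      term a k a<D k<b = subst (fromℕ (c a k) * (w ^ a * cf k a s) ≤_) (sym (fromℕ-* H Gam))
        (*-mono (fromℕ-nonNeg (c a k)) (*-nonNeg (^-nonNeg a 0≤w) c≥0) (fromℕ-mono (ℕP.<⇒≤ (hc a k)))
          (≤-trans (*-mono (^-nonNeg a 0≤w) c≥0 (w^≤ a) (coeff-≤ ζ (slope k) 0≤ζ (slope-nonNeg k) K 1≤K (slope≤K k k<b) ζ≤1 a s))
            (≤-trans (≤-reflexive (sym (fromℕ-* ((2 ℕ.* B) ℕ.^ a) _))) (fromℕ-mono (hGam a s a<D s<T)))))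
        where
        c≥0 = coeff-nonNeg ζ (slope k) 0≤ζ (slope-nonNeg k) a s

    -- Forms in the same box differ by at most 1 / V. The head has T terms with factors up to R ^ T,
    -- so the values of two such heads differ by at most T R ^ T / V = 1 / Λ.
    TRT V : ℕ
    TRT = T ℕ.* R ℕ.^ T
    V = Λ ℕ.* TRT

    scaled-form : (ℕ → ℕ → ℕ) → ℕ → Carrier
    scaled-form c s = form c s * fromℕ V

    scaled-nonNeg : ∀ c s → 0# ≤ scaled-form c s
    scaled-nonNeg c s = *-nonNeg (form-nonNeg c s) (fromℕ-nonNeg V)

    scaled-< : ∀ c s → (∀ a k → c a k ℕ.< H) → s ℕ.< T → ¬ (fromℕ N ≤ scaled-form c s)
    scaled-< c s hc s<T h = ℕP.<-irrefl refl (ℕP.<-≤-trans hN (fromℕ-cancel (≤-trans h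
      (≤-trans (*-monoˡ (fromℕ V) (fromℕ-nonNeg V) (form-≤ c s hc s<T)) (≤-reflexive (sym (fromℕ-* ((b ℕ.* D) ℕ.* (H ℕ.* Gam)) V)))))))

    box : (ℕ → ℕ → ℕ) → ℕ → ℕ
    box c s = floor N (scaled-form c s) (scaled-nonNeg c s)

    value : (ℕ → ℕ → ℕ) → ℕ → ℕ → Carrier
    value c i j = dsum (λ a k → fromℕ (c a k) * (ξ i j ^ a * expo k i j))

    head : (ℕ → ℕ → ℕ) → ℕ → ℕ → Carrier
    head c i j = sum T (λ s → fromℕ (binom (p i j) s) * ζ ^ s * form c s)

    tail : (ℕ → ℕ → ℕ) → ℕ → ℕ → Carrier
    tail c i j = dsum (λ a k → fromℕ (c a k) * (w ^ a * sum (suc (p i j)) (λ r → nt k a (p i j) (T ℕ.+ r))))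

    value≡ : ∀ c i j → value c i j ≡ head c i j + tail c i j
    value≡ c i j = begin
      value c i j                                                ≡⟨ dsum-cong (λ a k _ _ → term a k) ⟩
      dsum (λ a k → sum T (f a k) + fromℕ (c a k) * (w ^ a * sum (suc q) (λ r → nt k a q (T ℕ.+ r)))) ≡⟨ dsum-+ _ _ ⟩
      dsum (λ a k → sum T (f a k)) + tail c i j                  ≡⟨ cong (_+ tail c i j) (trans (dsum-sum T f) (sum-cong T (λ s _ → dsum-* _ _))) ⟩
      head c i j + tail c i j ∎
      where
      open ≡-Reasoning
      open Solver
      q = p i j
      f : ℕ → ℕ → ℕ → Carrier
      f a k s = fromℕ (binom q s) * ζ ^ s * (fromℕ (c a k) * (w ^ a * cf k a s))
      term : ∀ a k → fromℕ (c a k) * (ξ i j ^ a * expo k i j) ≡ sum T (f a k) + fromℕ (c a k) * (w ^ a * sum (suc q) (λ r → nt k a q (T ℕ.+ r)))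
      term a k = begin
        fromℕ (c a k) * (ξ i j ^ a * expo k i j)
          ≡⟨ cong (λ t → fromℕ (c a k) * (t * expo k i j)) (trans (cong (_^ a) (sym (w-p i j))) (^-distrib-* w _ a)) ⟩
        fromℕ (c a k) * (w ^ a * (fromℕ q * ζ) ^ a * expo k i j)
          ≡⟨ cong (_*_ (fromℕ (c a k))) (trans (*-assoc _ _ _) (cong (_*_ (w ^ a)) (newton ζ (slope k) a q (T ℕ.+ suc q) (ℕP.m≤n+m (suc q) T)))) ⟩
        fromℕ (c a k) * (w ^ a * sum (T ℕ.+ suc q) (nt k a q))
          ≡⟨ cong (λ t → fromℕ (c a k) * (w ^ a * t)) (sum-split T (suc q) _) ⟩
        fromℕ (c a k) * (w ^ a * (sum T (nt k a q) + sum (suc q) (λ r → nt k a q (T ℕ.+ r))))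
          ≡⟨ solve 4 (λ c w s t → c :* (w :* (s :+ t)) := (c :* w) :* s :+ c :* (w :* t)) refl (fromℕ (c a k)) (w ^ a) (sum T (nt k a q)) (sum (suc q) (λ r → nt k a q (T ℕ.+ r))) ⟩
        (fromℕ (c a k) * w ^ a) * sum T (nt k a q) + fromℕ (c a k) * (w ^ a * sum (suc q) (λ r → nt k a q (T ℕ.+ r)))
          ≡⟨ cong (_+ fromℕ (c a k) * (w ^ a * sum (suc q) (λ r → nt k a q (T ℕ.+ r)))) (trans (sym (sum-* T _ _)) (sum-cong T (λ s _ → solve 4 (λ c w z e → (c :* w) :* (z :* e) := z :* (c :* (w :* e))) refl (fromℕ (c a k)) (w ^ a) (fromℕ (binom q s) * ζ ^ s) (cf k a s)))) ⟩
        sum T (f a k) + fromℕ (c a k) * (w ^ a * sum (suc q) (λ r → nt k a q (T ℕ.+ r))) ∎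

    module _ (λ' : Carrier) (Λλ≡1 : fromℕ Λ * λ' ≡ 1#) (0≤λ : 0# ≤ λ') (1≤Λ : 1 ℕ.≤ Λ) where

      ≤λ : ∀ {x} Z → 1 ℕ.≤ Z → fromℕ (Λ ℕ.* Z) * x ≤ fromℕ Z → x ≤ λ'
      ≤λ {x} Z 1≤Z h = *-cancel (1≤fromℕ 1≤Λ) (*-cancel (1≤fromℕ 1≤Z)
        (≤-trans (≤-reflexive (trans (sym (*-assoc _ _ _)) (cong (_* x) (trans (*-comm _ _) (sym (fromℕ-* Λ Z))))))
          (≤-trans h (≤-reflexive (sym (trans (cong (_*_ (fromℕ Z)) Λλ≡1) (*-identityʳ _)))))))

      -- The factor 2 ^ suc s in `hTail` dominates the tail by a geometric series. The bound is thus
      -- independent of the number of terms p i j + 1, which grows with Q.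
      tail-≤ : ∀ c i j → (∀ a k → c a k ℕ.< H) → 2 ℕ.* i ℕ.+ n ℕ.* j ℕ.≤ R → ∣ tail c i j ∣≤ λ'
      tail-≤ c i j hc hR = abs-of-nonNeg (dsum-nonNeg (λ a k _ k<b → *-nonNeg (fromℕ-nonNeg (c a k)) (*-nonNeg (^-nonNeg a 0≤w) (sum≥0 a k))))
        (≤λ Z 1≤Z (≤-trans (≤-reflexive (sym (dsum-* (fromℕ (Λ ℕ.* Z)) _))) (≤-trans (dsum-bound {c = fromℕ (H ℕ.* (2 ℕ.* B) ℕ.^ D)} term)
          (≤-reflexive (sym (fromℕ-* (b ℕ.* D) _))))))
        where
        open Solver
        q = p i j
        Z = (b ℕ.* D) ℕ.* (H ℕ.* (2 ℕ.* B) ℕ.^ D)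
        1≤2B : 1 ℕ.≤ 2 ℕ.* B
        1≤2B = ℕP.≤-trans 1≤B (ℕP.m≤m+n B (B ℕ.+ 0))
        1≤Z : 1 ℕ.≤ Z
        1≤Z = ℕP.*-mono-≤ (ℕP.*-mono-≤ 1≤b 1≤D) (ℕP.*-mono-≤ 1≤H (ℕP.m^n>0 (2 ℕ.* B) {{ℕ.>-nonZero 1≤2B}} D))
        sum≥0 : ∀ a k → 0# ≤ sum (suc q) (λ r → nt k a q (T ℕ.+ r))
        sum≥0 a k = sum-nonNeg (suc q) (λ r _ → newton-term-nonNeg ζ (slope k) 0≤ζ (slope-nonNeg k) a q (T ℕ.+ r))
        term : ∀ a k → a ℕ.< D → k ℕ.< b →
          fromℕ (Λ ℕ.* Z) * (fromℕ (c a k) * (w ^ a * sum (suc q) (λ r → nt k a q (T ℕ.+ r)))) ≤ fromℕ (H ℕ.* (2 ℕ.* B) ℕ.^ D)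
        term a k a<D k<b =
          fromℕ (Λ ℕ.* Z) * (fromℕ (c a k) * (w ^ a * S))   ≡⟨ solve 4 (λ v c w s → v :* (c :* (w :* s)) := (c :* w) :* (v :* s)) refl (fromℕ (Λ ℕ.* Z)) (fromℕ (c a k)) (w ^ a) S ⟩'
          (fromℕ (c a k) * w ^ a) * (fromℕ (Λ ℕ.* Z) * S)   ≤⟨ *-mono (*-nonNeg (fromℕ-nonNeg (c a k)) (^-nonNeg a 0≤w)) (*-nonNeg (fromℕ-nonNeg (Λ ℕ.* Z)) (sum≥0 a k))
                                                                   (*-mono (fromℕ-nonNeg (c a k)) (^-nonNeg a 0≤w) (fromℕ-mono (ℕP.<⇒≤ (hc a k)))
                                                                      (≤-trans (w^≤ a) (fromℕ-mono (ℕP.^-monoʳ-≤ (2 ℕ.* B) {{ℕ.>-nonZero 1≤2B}} (ℕP.<⇒≤ a<D)))))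
                                                                   S-small ⟩
          (fromℕ H * fromℕ ((2 ℕ.* B) ℕ.^ D)) * 1#          ≡⟨ trans (*-identityʳ _) (sym (fromℕ-* H _)) ⟩'
          fromℕ (H ℕ.* (2 ℕ.* B) ℕ.^ D) □
          where
          S = sum (suc q) (λ r → nt k a q (T ℕ.+ r))
          S-small : fromℕ (Λ ℕ.* Z) * S ≤ 1#
          S-small = ≤-trans (≤-reflexive (sym (sum-* (suc q) _ _))) (geometric-sum (suc q) _ each)
            where
            each : ∀ r → r ℕ.< suc q → fromℕ (2 ℕ.^ suc r) * (fromℕ (Λ ℕ.* Z) * nt k a q (T ℕ.+ r)) ≤ 1#
            each r _ = ≤-trans (≤-reflexive (trans (sym (*-assoc _ _ _)) (cong (_* nt k a q (T ℕ.+ r)) (sym (fromℕ-* (2 ℕ.^ suc r) _)))))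
              (≤-trans (*-monoˡ _ (newton-term-nonNeg ζ (slope k) 0≤ζ (slope-nonNeg k) a q (T ℕ.+ r))
                  (fromℕ-mono (ℕP.≤-trans (ℕP.≤-reflexive (ℕP.*-comm (2 ℕ.^ suc r) (Λ ℕ.* Z))) (ℕP.*-monoʳ-≤ (Λ ℕ.* Z) (ℕP.^-monoʳ-≤ 2 (ℕ.s≤s (ℕP.m≤n+m r T)))))))
                (newton-term-≤ ζ (slope k) 0≤ζ (slope-nonNeg k) K 1≤K (slope≤K k k<b) R 1≤R (Λ ℕ.* Z ℕ.* 2 ℕ.^ suc (T ℕ.+ r)) a q (T ℕ.+ r)
                  (ℕP.≤-trans (ℕP.<⇒≤ a<D) (ℕP.≤-trans D≤T (ℕP.m≤m+n T r))) (pζ≤ R i j hR) (hTail a (T ℕ.+ r) a<D (ℕP.m≤m+n T r))))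

      head-close : ∀ c c' i j → (∀ s → s ℕ.< T → ∣ scaled-form c s - scaled-form c' s ∣≤ 1#) → 2 ℕ.* i ℕ.+ n ℕ.* j ℕ.≤ R →
        ∣ head c i j - head c' i j ∣≤ λ'
      head-close c c' i j h hR =
          ≤λ TRT 1≤TRT (≤-trans (≤-reflexive eq) (proj₁ bound))
        , ≤λ TRT 1≤TRT (≤-trans (≤-reflexive (trans (solve 2 (λ v x → v :* (:- x) := :- (v :* x)) refl (fromℕ V) (head c i j - head c' i j)) (cong -_ eq))) (proj₂ bound))
        where
        open Solver
        q = p i j
        1≤TRT : 1 ℕ.≤ TRT
        1≤TRT = ℕP.*-mono-≤ 1≤T (ℕP.m^n>0 R {{ℕ.>-nonZero 1≤R}} T)
        u : ℕ → Carrier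
        u s = fromℕ (binom q s) * ζ ^ s
        eq : fromℕ V * (head c i j - head c' i j) ≡ sum T (λ s → u s * (scaled-form c s - scaled-form c' s))
        eq = trans (cong (_*_ (fromℕ V)) (trans (cong (_+_ (head c i j)) (sym (sum-neg T _))) (sym (sum-+ T _ _))))
          (trans (sym (sum-* T _ _)) (sum-cong T (λ s _ →
            solve 4 (λ v u f g → v :* (u :* f :- u :* g) := u :* (f :* v :- g :* v)) refl (fromℕ V) (u s) (form c s) (form c' s))))
        u-≤ : ∀ s → s ℕ.< T → ∣ u s ∣≤ fromℕ (R ℕ.^ T)
        u-≤ s s<T = abs-of-nonNeg (*-nonNeg (fromℕ-nonNeg (binom q s)) (^-nonNeg s 0≤ζ))
          (≤-trans (*-monoˡ (ζ ^ s) (^-nonNeg s 0≤ζ) (fromℕ-mono (ℕP.≤-trans (ℕP.m≤n*m (binom q s) (s !) {{ℕ.>-nonZero (ℕP.1≤n! s)}}) (!-binom-≤ q s))))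
          (≤-trans (≤-reflexive (trans (cong (_* ζ ^ s) (fromℕ-^ q s)) (sym (^-distrib-* (fromℕ q) ζ s))))
          (≤-trans (^-mono s (*-nonNeg (fromℕ-nonNeg q) 0≤ζ) (pζ≤ R i j hR))
          (≤-trans (≤-reflexive (sym (fromℕ-^ R s))) (fromℕ-mono (ℕP.^-monoʳ-≤ R {{ℕ.>-nonZero 1≤R}} (ℕP.<⇒≤ s<T)))))))
        bound : ∣ sum T (λ s → u s * (scaled-form c s - scaled-form c' s)) ∣≤ fromℕ TRT
        bound = subst (∣ sum T (λ s → u s * (scaled-form c s - scaled-form c' s)) ∣≤_) (trans (cong (_*_ (fromℕ T)) (*-identityʳ _)) (sym (fromℕ-* T (R ℕ.^ T))))
          (abs-sum T (λ s s<T → abs-* (u-≤ s s<T) (h s s<T)))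

      -- One λ' accounts for the heads, whose forms share their boxes, and one for each of the two
      -- tails.
      small-values : Σ (ℕ → ℕ → ℕ) λ c → Σ (ℕ → ℕ → ℕ) λ c' →
        (∀ a k → c a k ℕ.< H) × (∀ a k → c' a k ℕ.< H) ×
        ¬ (∀ a k → a ℕ.< D → k ℕ.< b → c a k ≡ c' a k) ×
        (∀ i j → 2 ℕ.* i ℕ.+ n ℕ.* j ℕ.≤ R → ∣ value c i j - value c' i j ∣≤ (λ' + (λ' + λ')))
      small-values = conclude (pigeonhole H {{ℕ.>-nonZero 1≤H}} b D T N {{ℕ.>-nonZero (ℕP.≤-<-trans ℕ.z≤n hN)}} hPigeon box
                          (λ c hc s s<T → floor-< N (scaled-form c s) (scaled-nonNeg c s) (scaled-< c s hc s<T)))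
        where
        open Solver
        conclude : (Σ (ℕ → ℕ → ℕ) λ c → Σ (ℕ → ℕ → ℕ) λ c' →
                     (∀ a k → c a k ℕ.< H) × (∀ a k → c' a k ℕ.< H) ×
                     ¬ (∀ a k → a ℕ.< D → k ℕ.< b → c a k ≡ c' a k) × (∀ s → s ℕ.< T → box c s ≡ box c' s)) → _
        conclude (c , c' , hc , hc' , ne , same) = c , c' , hc , hc' , ne , λ i j hR →
          subst (∣_∣≤ (λ' + (λ' + λ')))
            (sym (trans (cong₂ _-_ (value≡ c i j) (value≡ c' i j))
              (solve 4 (λ h t h' t' → (h :+ t) :- (h' :+ t') := (h :- h') :+ (t :- t')) refl (head c i j) (tail c i j) (head c' i j) (tail c' i j))))
            (abs-+ (head-close c c' i j
                      (λ s s<T → floor-close N (scaled-form c s) (scaled-form c' s) (scaled-nonNeg c s) (scaled-nonNeg c' s) (scaled-< c s hc s<T) (scaled-< c' s hc' s<T) (same s s<T)) hR)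
                   (abs-- (tail-≤ c i j hc hR) (tail-≤ c' i j hc' hR)))

-- The contradiction from an approximation of log n that is too good.

module Transcendence where

  open OrderedField
  open NewtonSeries
  open Pigeonhole
  open Grid
  open SmallValues
  open ZeroEstimate
  open NumberRings
  open import Data.Empty using (⊥)
  open import Data.Integer as ℤ using (ℤ; +_)
  import Data.Integer.Properties as ℤP
  open import Data.Nat as ℕ using (ℕ; zero; suc; _!)
  import Data.Nat.Properties as ℕP
  open import Data.Nat.Tactic.RingSolver using (solve-∀)
  open import Data.Product using (Σ; _×_; _,_; proj₁; proj₂)
  open import Relation.Binary.PropositionalEquality hiding (J)
  open import Relation.Nullary using (¬_)

  -- `b` and `D` bound the degrees in y and x, `H` the coefficients, `T` the length of the Newton
  -- head, `R` the range of p ζ; `I` and `J` give the grid, `X` and `Y` bound x and the powers of y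
  -- on it, `E` the error factor of y, `Gam` the Newton coefficients, and `N` counts boxes. Nothing
  -- here depends on Q, so the mesh can be chosen afterwards.
  record Parameters (n B m : ℕ) : Set where
    field
      b D H T R I J M X Y E Gam N : ℕ
    U : ℕ
    U = (b ℕ.* D) ℕ.* (H ℕ.* (X ℕ.^ D ℕ.* Y))
    Λ : ℕ
    -- 60 = 2 · 6 · 5: the factor 6 of `liouville`, five errors of size 1 / Λ, and a factor 2 to
    -- stay strictly below 1.
    Λ = 60 ℕ.* (U ℕ.^ 3 ℕ.* M ℕ.^ 4)
    field
      1≤b : 1 ℕ.≤ b
      1≤D : 1 ℕ.≤ D
      1≤H : 1 ℕ.≤ H
      1≤R : 1 ℕ.≤ R
      1≤X : 1 ℕ.≤ X
      1≤Y : 1 ℕ.≤ Y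
      D≤T : D ℕ.≤ T
      m<M : m ℕ.< M
      hX : ∀ i j → i ℕ.< b ℕ.+ I → j ℕ.< J → B ℕ.* i ℕ.+ M ℕ.* j ℕ.≤ X
      hY : ∀ i j k → i ℕ.< b ℕ.+ I → j ℕ.< J → k ℕ.< b → (2 ℕ.^ i ℕ.* n ℕ.^ j) ℕ.^ k ℕ.≤ Y
      hE : ∀ i j k → i ℕ.< b ℕ.+ I → j ℕ.< J → k ℕ.< b → 2 ℕ.^ ((i ℕ.+ j) ℕ.* k) ℕ.≤ E
      hR : ∀ i j → i ℕ.< b ℕ.+ I → j ℕ.< J → 2 ℕ.* i ℕ.+ n ℕ.* j ℕ.≤ R
      hGam : ∀ a s → a ℕ.< D → s ℕ.< T → (2 ℕ.* B) ℕ.^ a ℕ.* ((2 ℕ.^ b) ℕ.^ s ℕ.* (2 ℕ.* s) ℕ.^ a) ℕ.≤ Gam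
      hN : (b ℕ.* D) ℕ.* (H ℕ.* Gam) ℕ.* (Λ ℕ.* (T ℕ.* R ℕ.^ T)) ℕ.< N
      hTail : ∀ a s → a ℕ.< D → T ℕ.≤ s →
        (Λ ℕ.* ((b ℕ.* D) ℕ.* (H ℕ.* (2 ℕ.* B) ℕ.^ D)) ℕ.* 2 ℕ.^ suc s) ℕ.* ((R ℕ.* 2 ℕ.^ b) ℕ.^ s ℕ.* (2 ℕ.* R) ℕ.^ a) ℕ.≤ (s ℕ.∸ a) !
      hPigeon : N ℕ.^ T ℕ.< (H ℕ.^ b) ℕ.^ D
      hZero : 2 ℕ.^ b ℕ.* D ℕ.< I ℕ.* J

    -- the mesh 1/Q needed when |ρᵏ − m| ≤ C/Q
    mesh : ℕ → ℕ
    mesh C = Λ ℕ.* (C ℕ.+ (b ℕ.* D) ℕ.* (H ℕ.* (Y ℕ.* (X ℕ.^ D ℕ.* (D ℕ.* C ℕ.+ E)))))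

  module Contradiction
    (F : OField) (k m n B Q : ℕ) (NR : NumberRing F k m)
    (1≤n : 1 ℕ.≤ n) (1≤B : 1 ℕ.≤ B) (1≤Q : 1 ℕ.≤ Q)
    (e₂ : Exponent Q 2) (eₙ : Exponent Q n) (P : Parameters n B m)
    where
    open OFieldTheory F
    open Expansion F
    open NumberRing NR
    private module R = CRingTheory ring
    open GridPoints F Q n B 1≤Q 1≤n 1≤B e₂ eₙ
    open Parameters P hiding (R)
    open DoubleSum F b D

    1≤T : 1 ℕ.≤ T
    1≤T = ℕP.≤-trans 1≤D D≤T

    open Boxes F Q n B 1≤Q 1≤n 1≤B e₂ eₙ b D H T (Parameters.R P) Λ Gam N 1≤b 1≤D 1≤H 1≤T 1≤R D≤T hGam hN hTail hPigeon
      using (value; small-values; ≤λ)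

    point : ℕ → ℕ → R.Carrier
    point i j = R.fromℕ (B ℕ.* i) R.+ R.fromℕ j R.* β

    point-suc : ∀ i j → point (suc i) j ≡ point i j R.+ R.fromℕ B
    point-suc i j = trans (cong (R._+ (R.fromℕ j R.* β)) (trans (cong R.fromℕ (ℕP.*-suc B i)) (R.fromℕ-+ B (B ℕ.* i))))
      (solve 3 (λ b x y → (b :+ x) :+ y := (x :+ y) :+ b) refl (R.fromℕ B) (R.fromℕ (B ℕ.* i)) (R.fromℕ j R.* β))
      where open R.Solver

    point-injective : ∀ i j i' j' → point i j ≡ point i' j' → i ≡ i' × j ≡ j'
    point-injective i j i' j' e with independent (+ (B ℕ.* i) ℤ.- + (B ℕ.* i')) (+ j ℤ.- + j') zero-diff
      where
      open R.Solver
      zero-diff : R.fromℤ (+ (B ℕ.* i) ℤ.- + (B ℕ.* i')) R.+ R.fromℤ (+ j ℤ.- + j') R.* β ≡ R.0#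
      zero-diff = trans (cong₂ (λ s t → s R.+ t R.* β)
          (trans (R.fromℤ-+ (+ (B ℕ.* i)) (ℤ.- + (B ℕ.* i'))) (cong (R._+_ (R.fromℕ (B ℕ.* i))) (R.fromℤ-neg (+ (B ℕ.* i')))))
          (trans (R.fromℤ-+ (+ j) (ℤ.- + j')) (cong (R._+_ (R.fromℕ j)) (R.fromℤ-neg (+ j')))))
        (trans (solve 5 (λ a a' b b' x → (a :+ :- a') :+ (b :+ :- b') :* x := (a :+ b :* x) :- (a' :+ b' :* x)) refl
                 (R.fromℕ (B ℕ.* i)) (R.fromℕ (B ℕ.* i')) (R.fromℕ j) (R.fromℕ j') β)
          (trans (cong (R._- point i' j') e) (R.-‿inverseʳ _)))
    ... | p , q = ℕP.*-cancelˡ-≡ i i' B {{ℕ.>-nonZero 1≤B}} (ℤP.+-injective (ℤP.i-j≡0⇒i≡j (+ (B ℕ.* i)) (+ (B ℕ.* i')) p))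
                , ℤP.+-injective (ℤP.i-j≡0⇒i≡j (+ j) (+ j') q)

    module ZE = Elimination ring domain char0 point (R.fromℕ B) point-suc point-injective n (ℕP.n>0⇒n≢0 1≤n)

    InRange : ℕ → ℕ → Set
    InRange i j = i ℕ.< b ℕ.+ I × j ℕ.< J

    point-Bd : ∀ {i j} → InRange i j → ∀ a → Bd (X ℕ.^ a) (point i j R.^ a)
    point-Bd r zero = Bd-1
    point-Bd {i} {j} r (suc a) = subst (Bd _) (R.*-comm _ _) (Bd-mono (ℕP.*-monoˡ-≤ (X ℕ.^ a)
      (ℕP.≤-trans (ℕP.+-monoʳ-≤ (B ℕ.* i) (ℕP.*-monoˡ-≤ j m<M)) (hX i j (proj₁ r) (proj₂ r)))) (Bd-step (B ℕ.* i) j (point-Bd r a)))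

    Bd-sum : ∀ {U} N f → (∀ i → i ℕ.< N → Bd U (f i)) → Bd (N ℕ.* U) (R.sum N f)
    Bd-sum zero    f h = Bd-0
    Bd-sum {U} (suc N) f h = subst (λ V → Bd V (R.sum N f R.+ f N)) (ℕP.+-comm (N ℕ.* U) U)
      (Bd-+ (Bd-sum N f (λ i i<N → h i (ℕP.m<n⇒m<1+n i<N))) (h N ℕP.≤-refl))

    ev-sum : ∀ N f → ev ρ (R.sum N f) ≡ sum N (λ i → ev ρ (f i))
    ev-sum zero    f = ev-0 ρ
    ev-sum (suc N) f = trans (ev-+ ρ _ _) (cong (_+ ev ρ (f N)) (ev-sum N f))

    Y^-fromℤ : ∀ i j l x → x R.* ZE.Y i j R.^ l ≡ R.fromℤ (+ (y i j ℕ.^ l)) R.* x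
    Y^-fromℤ i j l x = trans (R.*-comm _ _) (cong (R._* x) (sym (R.fromℕ-^ (y i j) l)))

    module _ (C : ℕ) (ρ≤M : ρ ≤ fromℕ M) (close : ∣ ρ ^ k - fromℕ m ∣≤ (fromℕ C * ζ)) (mesh≤Q : mesh C ℕ.≤ Q) where

      δ : Carrier
      δ = fromℕ C * ζ

      0≤δ : 0# ≤ δ
      0≤δ = *-nonNeg (fromℕ-nonNeg C) 0≤ζ

      ξ≤X : ∀ {i j} → InRange i j → ∣ ξ i j ∣≤ fromℕ X
      ξ≤X {i} {j} r = abs-of-nonNeg (+-nonNeg (fromℕ-nonNeg (B ℕ.* i)) (*-nonNeg (fromℕ-nonNeg j) 0≤ρ))
        (≤-trans (+-monoʳ _ (≤-trans (*-monoʳ (fromℕ j) (fromℕ-nonNeg j) ρ≤M) (≤-reflexive (trans (*-comm _ _) (sym (fromℕ-* M j))))))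
        (≤-trans (≤-reflexive (sym (fromℕ-+ (B ℕ.* i) (M ℕ.* j)))) (fromℕ-mono (hX i j (proj₁ r) (proj₂ r)))))

      j≤X : ∀ {i j} → InRange i j → ∣ fromℕ j ∣≤ fromℕ X
      j≤X {i} {j} r = abs-of-nonNeg (fromℕ-nonNeg j) (fromℕ-mono (ℕP.≤-trans (ℕP.m≤n*m j M {{ℕ.>-nonZero (ℕP.≤-<-trans ℕ.z≤n m<M)}})
        (ℕP.≤-trans (ℕP.m≤n+m (M ℕ.* j) (B ℕ.* i)) (hX i j (proj₁ r) (proj₂ r)))))

      ξ^≤ : ∀ {i j} → InRange i j → ∀ a → ∣ ξ i j ^ a ∣≤ fromℕ (X ℕ.^ a)
      ξ^≤ r zero    = abs-of-nonNeg 0≤1 (≤-reflexive (sym fromℕ-1))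
      ξ^≤ {i} {j} r (suc a) = subst (∣ ξ i j * ξ i j ^ a ∣≤_) (sym (fromℕ-* X (X ℕ.^ a))) (abs-* (ξ≤X r) (ξ^≤ r a))

      -- Each of the a multiplications by `point i j` adds one multiple of ρᵏ - m through `ev-step`,
      -- and the remaining factors magnify it by powers of X.
      power-error : ∀ {i j} → InRange i j → ∀ a → ∣ ev ρ (point i j R.^ a) - ξ i j ^ a ∣≤ (fromℕ (a ℕ.* X ℕ.^ a) * δ)
      power-error r zero = subst (∣_∣≤ (fromℕ 0 * δ)) (sym (trans (cong (_- 1#) (ev-1 ρ)) (-‿inverseʳ 1#))) (abs-0 (*-nonNeg (fromℕ-nonNeg 0) 0≤δ))
      power-error {i} {j} r (suc a) = step (ev-step ρ (B ℕ.* i) j (point-Bd r a))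
        where
        open Solver
        v = ev ρ (point i j R.^ a)
        step : (Σ Carrier λ w → (∣ w ∣≤ fromℕ (X ℕ.^ a)) × ev ρ (point i j R.^ a R.* point i j) ≡ v * ξ i j - (ρ ^ k - fromℕ m) * (fromℕ j * w)) →
               ∣ ev ρ (point i j R.^ suc a) - ξ i j ^ suc a ∣≤ (fromℕ (suc a ℕ.* X ℕ.^ suc a) * δ)
        step (w , hw , e) = subst₂ ∣_∣≤_
          (sym (trans (cong (_- ξ i j ^ suc a) (trans (cong (ev ρ) (R.*-comm _ _)) e))
            (solve 4 (λ v x z u → v :* x :- u :- x :* z := (v :- z) :* x :- u) refl v (ξ i j) (ξ i j ^ a) ((ρ ^ k - fromℕ m) * (fromℕ j * w)))))
          (trans (solve 4 (λ α d x z → (α :* z :* d) :* x :+ d :* (x :* z) := ((x :* z) :+ α :* (x :* z)) :* d) refl (fromℕ a) δ (fromℕ X) (fromℕ (X ℕ.^ a)))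
            (cong (_* δ) (trans (cong₂ _+_ (sym (fromℕ-* X (X ℕ.^ a))) (trans (cong (_*_ (fromℕ a)) (sym (fromℕ-* X (X ℕ.^ a)))) (sym (fromℕ-* a (X ℕ.* X ℕ.^ a)))))
              (sym (fromℕ-+ (X ℕ.* X ℕ.^ a) (a ℕ.* (X ℕ.* X ℕ.^ a)))))))
          (abs-- (abs-* (subst (∣ v - ξ i j ^ a ∣≤_) (cong (_* δ) (fromℕ-* a (X ℕ.^ a))) (power-error r a)) (ξ≤X r))
                 (abs-* close (abs-* (j≤X r) hw)))

      -- Z₀ ζ bounds the error of one monomial, from ρᵏ ≠ m and from rounding y; Z₁ ζ bounds the
      -- error of all b D monomials with coefficients up to H.
      Z₀ Z₁ : ℕ
      Z₀ = Y ℕ.* (X ℕ.^ D ℕ.* (D ℕ.* C ℕ.+ E))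
      Z₁ = (b ℕ.* D) ℕ.* (H ℕ.* Z₀)

      X^≤ : ∀ {a} → a ℕ.< D → X ℕ.^ a ℕ.≤ X ℕ.^ D
      X^≤ a<D = ℕP.^-monoʳ-≤ X {{ℕ.>-nonZero 1≤X}} (ℕP.<⇒≤ a<D)

      monomial-error : ∀ {i j} → InRange i j → ∀ a l → a ℕ.< D → l ℕ.< b →
        ∣ fromℕ (y i j ℕ.^ l) * ev ρ (point i j R.^ a) - ξ i j ^ a * expo l i j ∣≤ (fromℕ Z₀ * ζ)
      monomial-error {i} {j} r a l a<D l<b = subst₂ ∣_∣≤_
        (solve 4 (λ y e x p → y :* (e :- x) :+ x :* (y :- p) := y :* e :- x :* p) refl (fromℕ (y i j ℕ.^ l)) (ev ρ (point i j R.^ a)) (ξ i j ^ a) (expo l i j))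
        eq
        (abs-+ (abs-* (abs-of-nonNeg (fromℕ-nonNeg (y i j ℕ.^ l)) (fromℕ-mono hy))
                      (abs-weaken (power-error r a) (*-monoˡ δ 0≤δ (fromℕ-mono (ℕP.*-mono-≤ (ℕP.<⇒≤ a<D) (X^≤ a<D))))))
               (abs-* (abs-weaken (ξ^≤ r a) (fromℕ-mono (X^≤ a<D)))
                      (y^-error Y E l i j hy (hE i j l (proj₁ r) (proj₂ r) l<b))))
        where
        open Solver
        hy = hY i j l (proj₁ r) (proj₂ r) l<b
        l₁ : ∀ Y D X C E → Y ℕ.* (D ℕ.* X ℕ.* C) ℕ.+ X ℕ.* (Y ℕ.* E) ≡ Y ℕ.* (X ℕ.* (D ℕ.* C ℕ.+ E))
        l₁ = solve-∀
        XD = X ℕ.^ D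
        eq : fromℕ Y * (fromℕ (D ℕ.* XD) * δ) + fromℕ XD * (fromℕ (Y ℕ.* E) * ζ) ≡ fromℕ Z₀ * ζ
        eq = trans (solve 6 (λ y d c z x e → y :* (d :* (c :* z)) :+ x :* (e :* z) := (y :* (d :* c) :+ x :* e) :* z) refl
                      (fromℕ Y) (fromℕ (D ℕ.* XD)) (fromℕ C) ζ (fromℕ XD) (fromℕ (Y ℕ.* E)))
             (cong (_* ζ) (trans (cong₂ _+_ (trans (cong (_*_ (fromℕ Y)) (sym (fromℕ-* (D ℕ.* XD) C))) (sym (fromℕ-* Y (D ℕ.* XD ℕ.* C)))) (sym (fromℕ-* XD (Y ℕ.* E))))
               (trans (sym (fromℕ-+ (Y ℕ.* (D ℕ.* XD ℕ.* C)) (XD ℕ.* (Y ℕ.* E)))) (cong fromℕ (l₁ Y D XD C E)))))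

      1≤M : 1 ℕ.≤ M
      1≤M = ℕP.≤-<-trans ℕ.z≤n m<M

      1≤U : 1 ℕ.≤ U
      1≤U = ℕP.*-mono-≤ (ℕP.*-mono-≤ 1≤b 1≤D) (ℕP.*-mono-≤ 1≤H (ℕP.*-mono-≤ (ℕP.m^n>0 X {{ℕ.>-nonZero 1≤X}} D) 1≤Y))

      1≤Λ : 1 ℕ.≤ Λ
      1≤Λ = ℕP.*-mono-≤ {1} {60} (ℕ.s≤s ℕ.z≤n) (ℕP.*-mono-≤ (ℕP.m^n>0 U {{ℕ.>-nonZero 1≤U}} 3) (ℕP.m^n>0 M {{ℕ.>-nonZero 1≤M}} 4))

      λ' : Carrier
      λ' = proj₁ (recip Λ 1≤Λ)
      Λλ≡1 : fromℕ Λ * λ' ≡ 1#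
      Λλ≡1 = proj₁ (proj₂ (recip Λ 1≤Λ))
      0≤λ : 0# ≤ λ'
      0≤λ = proj₂ (proj₂ (recip Λ 1≤Λ))

      ζ-small : ∀ Z → Λ ℕ.* Z ℕ.≤ Q → fromℕ Z * ζ ≤ λ'
      ζ-small Z h = *-cancel (1≤fromℕ 1≤Λ) (
        fromℕ Λ * (fromℕ Z * ζ)      ≡⟨ trans (sym (*-assoc _ _ _)) (cong (_* ζ) (sym (fromℕ-* Λ Z))) ⟩'
        fromℕ (Λ ℕ.* Z) * ζ          ≤⟨ *-monoˡ ζ 0≤ζ (fromℕ-mono h) ⟩
        fromℕ Q * ζ                  ≡⟨ trans Qζ≡1 (sym Λλ≡1) ⟩'
        fromℕ Λ * λ' □)

      module _ (c c' : ℕ → ℕ → ℕ) (hc : ∀ a l → c a l ℕ.< H) (hc' : ∀ a l → c' a l ℕ.< H) where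

        d : ℕ → ℕ → ℤ
        d a l = + c a l ℤ.- + c' a l

        d≤H : ∀ a l → ℤ.∣ d a l ∣ ℕ.≤ H
        d≤H a l = subst (λ z → ℤ.∣ z ∣ ℕ.≤ H) (sym (ℤP.m-n≡m⊖n (c a l) (c' a l)))
          (ℕP.≤-trans (ℤP.∣m⊝n∣≤m⊔n (c a l) (c' a l)) (ℕP.⊔-lub (ℕP.<⇒≤ (hc a l)) (ℕP.<⇒≤ (hc' a l))))

        column : ℕ → ℕ → ℕ → R.Carrier
        column i j l = ZE.coeff-poly (λ a → d a l) D (point i j)

        total : ℕ → ℕ → R.Carrier
        total i j = R.sum b (λ l → column i j l R.* ZE.Y i j R.^ l)

        total-Bd : ∀ {i j} → InRange i j → Bd U (total i j)
        total-Bd {i} {j} r = subst (λ V → Bd V (total i j)) (sym (eq b D H (X ℕ.^ D) Y))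
          (Bd-sum b _ (λ l l<b → subst (Bd (Y ℕ.* (D ℕ.* (H ℕ.* X ℕ.^ D)))) (sym (Y^-fromℤ i j l (column i j l)))
            (Bd-ℤ {c = + (y i j ℕ.^ l)} (hY i j l (proj₁ r) (proj₂ r) l<b) (Bd-sum D _ (λ a a<D → Bd-ℤ {c = d a l} (d≤H a l) (Bd-mono (X^≤ a<D) (point-Bd r a)))))))
          where
          eq : ∀ b D H X Y → (b ℕ.* D) ℕ.* (H ℕ.* (X ℕ.* Y)) ≡ b ℕ.* (Y ℕ.* (D ℕ.* (H ℕ.* X)))
          eq = solve-∀

        ev-total : ∀ i j → ev ρ (total i j) ≡ dsum (λ a l → fromℤ (d a l) * (fromℕ (y i j ℕ.^ l) * ev ρ (point i j R.^ a)))
        ev-total i j = trans (ev-sum b _) (sum-cong b (λ l _ → begin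
          ev ρ (column i j l R.* ZE.Y i j R.^ l)                       ≡⟨ cong (ev ρ) (Y^-fromℤ i j l (column i j l)) ⟩
          ev ρ (R.fromℤ (+ (y i j ℕ.^ l)) R.* column i j l)            ≡⟨ ev-ℤ ρ (+ (y i j ℕ.^ l)) (column i j l) ⟩
          fromℕ (y i j ℕ.^ l) * ev ρ (column i j l)                    ≡⟨ cong (_*_ _) (ev-sum D _) ⟩
          fromℕ (y i j ℕ.^ l) * sum D (λ a → ev ρ (R.fromℤ (d a l) R.* point i j R.^ a)) ≡⟨ sym (sum-* D _ _) ⟩
          sum D (λ a → fromℕ (y i j ℕ.^ l) * ev ρ (R.fromℤ (d a l) R.* point i j R.^ a))
            ≡⟨ sum-cong D (λ a _ → trans (cong (_*_ _) (ev-ℤ ρ (d a l) _))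
                 (solve 3 (λ y d e → y :* (d :* e) := d :* (y :* e)) refl (fromℕ (y i j ℕ.^ l)) (fromℤ (d a l)) (ev ρ (point i j R.^ a)))) ⟩
          sum D (λ a → fromℤ (d a l) * (fromℕ (y i j ℕ.^ l) * ev ρ (point i j R.^ a))) ∎))
          where
          open ≡-Reasoning
          open Solver

        value-difference : ∀ i j → value c i j - value c' i j ≡ dsum (λ a l → fromℤ (d a l) * (ξ i j ^ a * expo l i j))
        value-difference i j = trans (cong (_+_ (value c i j)) (sym (dsum-neg _))) (trans (sym (dsum-+ _ _)) (dsum-cong (λ a l _ _ →
          trans (solve 3 (λ c c' x → c :* x :+ :- (c' :* x) := (c :+ :- c') :* x) refl (fromℕ (c a l)) (fromℕ (c' a l)) (ξ i j ^ a * expo l i j))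
            (cong (_* (ξ i j ^ a * expo l i j)) (sym (trans (fromℤ-+ (+ c a l) (ℤ.- + c' a l)) (cong (_+_ (fromℕ (c a l))) (fromℤ-neg (+ c' a l)))))))))
          where open Solver

        total-error : ∀ {i j} → InRange i j → ∣ ev ρ (total i j) - (value c i j - value c' i j) ∣≤ (fromℕ Z₁ * ζ)
        total-error {i} {j} r = subst₂ ∣_∣≤_
          (sym (trans (cong₂ _-_ (ev-total i j) (value-difference i j)) (trans (cong (_+_ _) (sym (dsum-neg _))) (trans (sym (dsum-+ _ _)) (dsum-cong (λ a l _ _ →
            solve 3 (λ d x y → d :* x :+ :- (d :* y) := d :* (x :- y)) refl (fromℤ (d a l)) (fromℕ (y i j ℕ.^ l) * ev ρ (point i j R.^ a)) (ξ i j ^ a * expo l i j)))))))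
          (trans (solve 4 (λ n h z e → n :* (h :* (z :* e)) := (n :* (h :* z)) :* e) refl (fromℕ (b ℕ.* D)) (fromℕ H) (fromℕ Z₀) ζ)
            (cong (_* ζ) (trans (cong (_*_ (fromℕ (b ℕ.* D))) (sym (fromℕ-* H Z₀))) (sym (fromℕ-* (b ℕ.* D) (H ℕ.* Z₀))))))
          (dsum-abs (λ a l a<D l<b → abs-* (abs-fromℤ {d a l} (d≤H a l)) (monomial-error r a l a<D l<b)))
          where open Solver

        -- Passing from grid data to exact points costs λ' on top of the 3 λ' of `small-values`, and
        -- ρᵏ - m is itself at most λ'. With the constant of `liouville` this makes 6 K · 5 λ' =
        -- 1/2.
        total≡0 : ∀ {i j} → InRange i j → ∣ value c i j - value c' i j ∣≤ (λ' + (λ' + λ')) → total i j ≡ R.0#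
        total≡0 {i} {j} r small = liouville 1≤U 1≤M (ℕP.<⇒≤ m<M) 0≤ρ ρ≤M (total-Bd r)
          (subst (∣_∣≤ (λ' + (λ' + (λ' + λ')))) (solve 2 (λ x y → (x :- y) :+ y := x) refl (ev ρ (total i j)) (value c i j - value c' i j))
            (abs-+ (abs-weaken (total-error r) (ζ-small Z₁ (ℕP.≤-trans (ℕP.*-monoʳ-≤ Λ (ℕP.m≤n+m Z₁ C)) mesh≤Q))) small))
          (abs-weaken close (ζ-small C (ℕP.≤-trans (ℕP.*-monoʳ-≤ Λ (ℕP.m≤m+n C Z₁)) mesh≤Q)))
          (λ h → 1+≰ {1#} (≤-trans (+-mono h h) (≤-reflexive (trans (eq K) (trans (sym (*-assoc _ _ _)) (trans (cong (_* λ') (sym ΛK)) Λλ≡1))))))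
          where
          open Solver
          K = fromℕ U ^ 3 * fromℕ M ^ 4
          0≤K : 0# ≤ K
          0≤K = *-nonNeg (^-nonNeg 3 (fromℕ-nonNeg U)) (^-nonNeg 4 (fromℕ-nonNeg M))
          ΛK : fromℕ Λ ≡ fromℕ 60 * K
          ΛK = trans (fromℕ-* 60 (U ℕ.^ 3 ℕ.* M ℕ.^ 4)) (cong (_*_ (fromℕ 60)) (trans (fromℕ-* (U ℕ.^ 3) (M ℕ.^ 4)) (cong₂ _*_ (fromℕ-^ U 3) (fromℕ-^ M 4))))
          eq : ∀ K → fromℕ 6 * K * (λ' + (λ' + (λ' + λ')) + λ') + fromℕ 6 * K * (λ' + (λ' + (λ' + λ')) + λ') ≡ fromℕ 60 * (K * λ')
          eq K = solve 2 (λ k e → con (+ 6) :* k :* (e :+ (e :+ (e :+ e)) :+ e) :+ con (+ 6) :* k :* (e :+ (e :+ (e :+ e)) :+ e) := con (+ 60) :* (k :* e)) refl K λ'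

        coefficients-agree : (∀ i j → 2 ℕ.* i ℕ.+ n ℕ.* j ℕ.≤ Parameters.R P → ∣ value c i j - value c' i j ∣≤ (λ' + (λ' + λ'))) →
          ∀ a l → a ℕ.< D → l ℕ.< b → c a l ≡ c' a l
        coefficients-agree small a l a<D l<b = ℤP.+-injective (ℤP.i-j≡0⇒i≡j (+ c a l) (+ c' a l)
          (ZE.zero-estimate d D b I J hZero (λ i j i< j< → total≡0 (i< , j<) (small i j (hR i j i< j<))) a l a<D l<b))

      contradiction : ⊥
      contradiction = conclude (small-values λ' Λλ≡1 0≤λ 1≤Λ)
        where
        conclude : (Σ (ℕ → ℕ → ℕ) λ c → Σ (ℕ → ℕ → ℕ) λ c' →
          (∀ a l → c a l ℕ.< H) × (∀ a l → c' a l ℕ.< H) ×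
          ¬ (∀ a l → a ℕ.< D → l ℕ.< b → c a l ≡ c' a l) ×
          (∀ i j → 2 ℕ.* i ℕ.+ n ℕ.* j ℕ.≤ Parameters.R P → ∣ value c i j - value c' i j ∣≤ (λ' + (λ' + λ')))) → ⊥
        conclude (c , c' , hc , hc' , ne , small) = ne (coefficients-agree c c' hc hc' small)

-- An explicit choice of all degrees, heights and grid sizes.

module ParameterChoice where

  open NewtonSeries using (ℕ^-distrib-*)
  open Transcendence using (Parameters)
  open import Data.Nat
  open import Data.Nat.Properties
  open import Data.Nat.Tactic.RingSolver using (solve-∀)
  open import Data.Product using (Σ; _,_)
  open import Relation.Binary.PropositionalEquality hiding (J)

  -- Everything is a power of one large number G; τ D is the length of the Newton
  -- series and b the degree in y.
  module Choice (n B m M G τ b : ℕ) (1≤n : 1 ≤ n) (1≤B : 1 ≤ B) (m<M : m < M)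
    (G-lin : 2 * (B + M) ≤ G) (G-n : 2 * (2 + n) ≤ G) (G-y : (2 * n) ^ (2 * b) ≤ G)
    (G-norm : 60 * M ^ 4 ≤ G) (G-b : 2 ^ suc b ≤ G) (G-τ : 2 * τ ≤ G)
    (1≤b : 1 ≤ b) (hτ : 49 ≤ τ) (hb : (6 * τ + 38) * τ < b) where

    D : ℕ
    -- The zero estimate compares 2 ^ b * D with I * I = G ^ 8; the one power of G in between
    -- absorbs 2 ^ b.
    D = G ^ 7

    b<G : b < G
    b<G = <-≤-trans (lem b) (≤-trans (^-monoʳ-≤ 2 (n≤1+n b)) G-b)
      where
      lem : ∀ b → b < 2 ^ b
      lem zero    = s≤s z≤n
      lem (suc b) = ≤-trans (+-mono-≤ (m^n>0 2 b) (lem b)) (≤-reflexive (cong (2 ^ b +_) (sym (+-identityʳ (2 ^ b)))))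

    2≤G : 2 ≤ G
    2≤G = ≤-trans (s≤s 1≤b) b<G

    instance
      G≢0 : NonZero G
      G≢0 = >-nonZero (≤-trans (s≤s z≤n) 2≤G)
      D≢0 : NonZero D
      D≢0 = m^n≢0 G 7

    G^-mono : ∀ {e f} → e ≤ f → G ^ e ≤ G ^ f
    G^-mono = ^-monoʳ-≤ G

    8≤D : 8 ≤ D
    8≤D = ≤-trans (m≤n+m 8 120) (^-monoˡ-≤ 7 2≤G)

    pw-* : ∀ {x y e f} → x ≤ G ^ (D * e) → y ≤ G ^ (D * f) → x * y ≤ G ^ (D * (e + f))
    pw-* {x} {y} {e} {f} p q = ≤-trans (*-mono-≤ p q)
      (≤-reflexive (trans (sym (^-distribˡ-+-* G (D * e) (D * f))) (cong (G ^_) (sym (*-distribˡ-+ D e f)))))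

    pw-small : ∀ {x} → x ≤ G ^ 8 → x ≤ G ^ (D * 1)
    pw-small p = ≤-trans p (G^-mono (≤-trans 8≤D (≤-reflexive (sym (*-identityʳ D)))))

    pw-^D : ∀ {x} e → x ≤ G ^ e → x ^ D ≤ G ^ (D * e)
    pw-^D e p = ≤-trans (^-monoˡ-≤ D p) (≤-reflexive (trans (^-*-assoc G e D) (cong (G ^_) (*-comm e D))))

    G≤G^ : ∀ e → 1 ≤ e → G ≤ G ^ e
    G≤G^ e 1≤e = ≤-trans (≤-reflexive (sym (^-identityʳ G))) (G^-mono 1≤e)

    I X R H Y E T Gam N : ℕ
    I = G ^ 4
    X = G ^ 5
    R = G ^ 5
    H = G ^ (D * 1)
    Y = G ^ (D * 1)
    E = 2 ^ ((2 * I + I) * b)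
    T = D * τ
    -- One unit of the exponent for (2 B) ^ a, τ for (2 ^ b) ^ s and 8 for (2 s) ^ a. The boxes then
    -- need 6 τ + 37 units; `N` has one more for strictness.
    Gam = G ^ (D * (τ + 9))
    N = G ^ (D * (6 * τ + 38))

    bD≤ : b * D ≤ G ^ (D * 1)
    bD≤ = pw-small (*-monoˡ-≤ D (<⇒≤ b<G))

    U Λ : ℕ
    U = (b * D) * (H * (X ^ D * Y))
    Λ = 60 * (U ^ 3 * M ^ 4)

    U≤ : U ≤ G ^ (D * 8)
    U≤ = pw-* {e = 1} {7} bD≤ (pw-* {e = 1} {6} ≤-refl (pw-* {e = 5} {1} (pw-^D 5 ≤-refl) ≤-refl))

    Λ≤ : Λ ≤ G ^ (D * 25)
    Λ≤ = ≤-trans (≤-reflexive (lem (U ^ 3) (M ^ 4))) (pw-* {e = 1} {24} (pw-small (≤-trans G-norm (G≤G^ 8 (s≤s z≤n))))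
      (pw-* {e = 8} {16} U≤ (pw-* {e = 8} {8} U≤ (≤-trans (≤-reflexive (*-identityʳ U)) U≤))))
      where
      lem : ∀ u v → 60 * (u * v) ≡ (60 * v) * u
      lem = solve-∀

    i<⇒ : ∀ {i} → i < b + I → i ≤ 2 * I
    i<⇒ i< = ≤-trans (<⇒≤ i<) (≤-trans (+-monoˡ-≤ I (≤-trans (<⇒≤ b<G) (G≤G^ 4 (s≤s z≤n)))) (≤-reflexive (cong (I +_) (sym (+-identityʳ I)))))

    I≤2I : I ≤ 2 * I
    I≤2I = m≤m+n I (I + 0)

    hX : ∀ i j → i < b + I → j < I → B * i + M * j ≤ X
    hX i j i< j< = begin
      B * i + M * j             ≤⟨ +-mono-≤ (*-monoʳ-≤ B (i<⇒ i<)) (*-monoʳ-≤ M (≤-trans (<⇒≤ j<) I≤2I)) ⟩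
      B * (2 * I) + M * (2 * I) ≡⟨ lem B M I ⟩
      (2 * (B + M)) * I         ≤⟨ *-monoˡ-≤ I G-lin ⟩
      G * I                     ∎
      where
      open ≤-Reasoning
      lem : ∀ B M I → B * (2 * I) + M * (2 * I) ≡ (2 * (B + M)) * I
      lem = solve-∀

    hR : ∀ i j → i < b + I → j < I → 2 * i + n * j ≤ R
    hR i j i< j< = begin
      2 * i + n * j             ≤⟨ +-mono-≤ (*-monoʳ-≤ 2 (i<⇒ i<)) (*-monoʳ-≤ n (≤-trans (<⇒≤ j<) I≤2I)) ⟩
      2 * (2 * I) + n * (2 * I) ≡⟨ lem n I ⟩
      (2 * (2 + n)) * I         ≤⟨ *-monoˡ-≤ I G-n ⟩
      G * I                     ∎
      where
      open ≤-Reasoning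
      lem : ∀ n I → 2 * (2 * I) + n * (2 * I) ≡ (2 * (2 + n)) * I
      lem = solve-∀

    instance
      n≢0 : NonZero n
      n≢0 = >-nonZero 1≤n

    hY : ∀ i j k → i < b + I → j < I → k < b → (2 ^ i * n ^ j) ^ k ≤ Y
    hY i j k i< j< k<b = begin
      (2 ^ i * n ^ j) ^ k             ≤⟨ ^-monoʳ-≤ (2 ^ i * n ^ j) {{m*n≢0 (2 ^ i) (n ^ j) {{m^n≢0 2 i}} {{m^n≢0 n j}}}} (<⇒≤ k<b) ⟩
      (2 ^ i * n ^ j) ^ b             ≤⟨ ^-monoˡ-≤ b (*-mono-≤ (^-monoʳ-≤ 2 (i<⇒ i<)) (^-monoʳ-≤ n (≤-trans (<⇒≤ j<) I≤2I))) ⟩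
      (2 ^ (2 * I) * n ^ (2 * I)) ^ b ≡⟨ cong (_^ b) (sym (ℕ^-distrib-* 2 n (2 * I))) ⟩
      ((2 * n) ^ (2 * I)) ^ b         ≡⟨ trans (^-*-assoc (2 * n) (2 * I) b) (trans (cong ((2 * n) ^_) (lem I b)) (sym (^-*-assoc (2 * n) (2 * b) I))) ⟩
      ((2 * n) ^ (2 * b)) ^ I         ≤⟨ ^-monoˡ-≤ I G-y ⟩
      G ^ I                           ≤⟨ G^-mono (≤-trans (G^-mono {4} {7} (m≤n+m 4 3)) (≤-reflexive (sym (*-identityʳ D)))) ⟩
      Y                               ∎
      where
      open ≤-Reasoning
      lem : ∀ I b → 2 * I * b ≡ 2 * b * I
      lem = solve-∀

    hE : ∀ i j k → i < b + I → j < I → k < b → 2 ^ ((i + j) * k) ≤ E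
    hE i j k i< j< k<b = ^-monoʳ-≤ 2 (*-mono-≤ (+-mono-≤ (i<⇒ i<) (<⇒≤ j<)) (<⇒≤ k<b))

    2B≤G : 2 * B ≤ G
    2B≤G = ≤-trans (*-monoʳ-≤ 2 (m≤m+n B M)) G-lin

    2T≤ : 2 * T ≤ G ^ 8
    2T≤ = ≤-trans (≤-reflexive (lem D τ)) (*-monoˡ-≤ D G-τ)
      where
      lem : ∀ D τ → 2 * (D * τ) ≡ (2 * τ) * D
      lem = solve-∀

    2^b≤G : 2 ^ b ≤ G
    2^b≤G = ≤-trans (^-monoʳ-≤ 2 (n≤1+n b)) G-b

    instance
      2B≢0 : NonZero (2 * B)
      2B≢0 = >-nonZero (≤-trans 1≤B (m≤m+n B (B + 0)))

    2B^≤ : ∀ a → a ≤ D → (2 * B) ^ a ≤ G ^ (D * 1)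
    2B^≤ a a≤D = ≤-trans (^-monoʳ-≤ (2 * B) a≤D) (pw-^D 1 (≤-trans 2B≤G (G≤G^ 1 ≤-refl)))

    hGam : ∀ a s → a < D → s < T → (2 * B) ^ a * ((2 ^ b) ^ s * (2 * s) ^ a) ≤ Gam
    hGam a s a<D s<T = subst (λ e → (2 * B) ^ a * ((2 ^ b) ^ s * (2 * s) ^ a) ≤ G ^ (D * e)) (+-comm 9 τ)
      (≤-trans (*-mono-≤ (2B^≤ a (<⇒≤ a<D)) (≤-trans (*-mono-≤ K^s s^a) (≤-reflexive (sym (^-distribˡ-+-* G (D * τ) (D * 8))))))
        (≤-reflexive (trans (sym (^-distribˡ-+-* G (D * 1) (D * τ + D * 8))) (cong (G ^_) (lem D τ)))))
      where
      lem : ∀ D τ → D * 1 + (D * τ + D * 8) ≡ D * (9 + τ)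
      lem = solve-∀
      K^s : (2 ^ b) ^ s ≤ G ^ (D * τ)
      K^s = ≤-trans (^-monoˡ-≤ s 2^b≤G) (G^-mono (<⇒≤ s<T))
      s^a : (2 * s) ^ a ≤ G ^ (D * 8)
      s^a = ≤-trans (^-monoˡ-≤ a (≤-trans (*-monoʳ-≤ 2 (<⇒≤ s<T)) 2T≤)) (≤-trans (^-monoʳ-≤ (G ^ 8) {{m^n≢0 G 8}} (<⇒≤ a<D)) (pw-^D 8 ≤-refl))

    hN : (b * D) * (H * Gam) * (Λ * (T * R ^ T)) < N
    hN = ≤-<-trans (≤-trans (pw-* {e = 1 + (1 + (τ + 9))} {25 + (1 + 5 * τ)}
        (pw-* {e = 1} {1 + (τ + 9)} bD≤ (pw-* {e = 1} {τ + 9} ≤-refl ≤-refl))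
        (pw-* {e = 25} {1 + 5 * τ} Λ≤ (pw-* {e = 1} {5 * τ} (pw-small (≤-trans (m≤m+n T (T + 0)) 2T≤)) R^T)))
        (≤-reflexive (cong (λ e → G ^ (D * e)) (lem τ))))
      (^-monoʳ-< G 2≤G (*-monoʳ-< D (+-monoʳ-< (6 * τ) (s≤s ≤-refl))))
      where
      lem : ∀ τ → 1 + (1 + (τ + 9)) + (25 + (1 + 5 * τ)) ≡ 6 * τ + 37
      lem = solve-∀
      lem' : ∀ D τ → 5 * (D * τ) ≡ D * (5 * τ)
      lem' = solve-∀
      R^T : R ^ T ≤ G ^ (D * (5 * τ))
      R^T = ≤-reflexive (trans (^-*-assoc G 5 T) (cong (G ^_) (lem' D τ)))

    -- The last r factors of the factorial exceed D = G ^ 7, whereas the estimate to be beaten grows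
    -- only by G ^ 6 per index; this is what settles the tail.
    ^≤! : ∀ r → D ^ r ≤ (D + r) !
    ^≤! zero    = 1≤n! (D + 0)
    ^≤! (suc r) = ≤-trans (*-mono-≤ {D} {suc (D + r)} (m≤n⇒m≤1+n (m≤m+n D r)) (^≤! r)) (≤-reflexive (cong _! (sym (+-suc D r))))

    hTail : ∀ a s → a < D → T ≤ s →
      (Λ * ((b * D) * (H * (2 * B) ^ D)) * 2 ^ suc s) * ((R * 2 ^ b) ^ s * (2 * R) ^ a) ≤ (s ∸ a) !
    hTail a s a<D T≤s = begin
      (L * 2 ^ suc s) * ((R * 2 ^ b) ^ s * (2 * R) ^ a)
        ≡⟨ trans (lem₁ L (2 ^ s) ((R * 2 ^ b) ^ s) ((2 * R) ^ a)) (cong (λ t → (2 * L) * (t * (2 * R) ^ a)) (sym (ℕ^-distrib-* 2 (R * 2 ^ b) s))) ⟩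
      (2 * L) * ((2 * (R * 2 ^ b)) ^ s * (2 * R) ^ a)
        ≤⟨ *-mono-≤ (pw-* {e = 1} {28} (pw-small (≤-trans 2≤G (G≤G^ 8 (s≤s z≤n)))) L≤) (*-mono-≤ first second) ⟩
      G ^ (D * 29) * (G ^ (6 * s) * G ^ (D * 6))
        ≡⟨ trans (cong (G ^ (D * 29) *_) (sym (^-distribˡ-+-* G (6 * s) (D * 6)))) (trans (sym (^-distribˡ-+-* G (D * 29) (6 * s + D * 6))) (cong (G ^_) (lem₂ D s))) ⟩
      G ^ (6 * s + D * 35)   ≤⟨ G^-mono exponents ⟩
      G ^ (7 * r)            ≡⟨ sym (^-*-assoc G 7 r) ⟩
      D ^ r                  ≤⟨ ^≤! r ⟩
      (D + r) !              ≡⟨ cong _! D+r ⟩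
      (s ∸ a) !              ∎
      where
      open ≤-Reasoning
      L = Λ * ((b * D) * (H * (2 * B) ^ D))
      L≤ : L ≤ G ^ (D * 28)
      L≤ = pw-* {e = 25} {3} Λ≤ (pw-* {e = 1} {2} bD≤ (pw-* {e = 1} {1} ≤-refl (2B^≤ D ≤-refl)))
      lem₁ : ∀ L x y z → (L * (2 * x)) * (y * z) ≡ (2 * L) * ((x * y) * z)
      lem₁ = solve-∀
      lem₂ : ∀ D s → D * 29 + (6 * s + D * 6) ≡ 6 * s + D * 35
      lem₂ = solve-∀
      lem₃ : ∀ R K → 2 * (R * K) ≡ (2 * K) * R
      lem₃ = solve-∀
      first : (2 * (R * 2 ^ b)) ^ s ≤ G ^ (6 * s)
      first = ≤-trans (^-monoˡ-≤ s (≤-trans (≤-reflexive (lem₃ R (2 ^ b))) (*-monoˡ-≤ R G-b))) (≤-reflexive (^-*-assoc G 6 s))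
      second : (2 * R) ^ a ≤ G ^ (D * 6)
      second = ≤-trans (^-monoˡ-≤ a (*-monoˡ-≤ R 2≤G)) (≤-trans (^-monoʳ-≤ (G ^ 6) {{m^n≢0 G 6}} (<⇒≤ a<D)) (pw-^D 6 ≤-refl))
      49D≤s : D * 49 ≤ s
      49D≤s = ≤-trans (*-monoʳ-≤ D hτ) T≤s
      a+D≤s : a + D ≤ s
      a+D≤s = ≤-trans (+-monoˡ-≤ D (<⇒≤ a<D)) (≤-trans (≤-trans (≤-reflexive (lem₄ D)) (*-monoʳ-≤ D (m≤n+m 2 47))) 49D≤s)
        where
        lem₄ : ∀ D → D + D ≡ D * 2
        lem₄ = solve-∀
      r = s ∸ (a + D)
      a+D+r : a + D + r ≡ s
      a+D+r = m+[n∸m]≡n a+D≤s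
      D+r : D + r ≡ s ∸ a
      D+r = trans (sym (m+n∸m≡n a (D + r))) (cong (_∸ a) (trans (sym (+-assoc a D r)) a+D+r))
      -- From a + D < 2 D the exponent 7 r is at least 7 s - 14 D, so what is required is s ≥ 14 D +
      -- 35 D. This is the origin of the bound 49 on τ.
      exponents : 6 * s + D * 35 ≤ 7 * r
      exponents = +-cancelˡ-≤ (D * 14) _ _ (begin
        D * 14 + (6 * s + D * 35)  ≡⟨ lem₅ D s ⟩
        D * 49 + 6 * s             ≤⟨ +-monoˡ-≤ (6 * s) 49D≤s ⟩
        7 * s                      ≡⟨ cong (7 *_) (sym a+D+r) ⟩
        7 * (a + D + r)            ≤⟨ *-monoʳ-≤ 7 (+-monoˡ-≤ r (+-monoˡ-≤ D (<⇒≤ a<D))) ⟩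
        7 * (D + D + r)            ≡⟨ lem₆ D r ⟩
        D * 14 + 7 * r             ∎)
        where
        lem₅ : ∀ D s → D * 14 + (6 * s + D * 35) ≡ D * 49 + 6 * s
        lem₅ = solve-∀
        lem₆ : ∀ D r → 7 * (D + D + r) ≡ D * 14 + 7 * r
        lem₆ = solve-∀

    hPigeon : N ^ T < (H ^ b) ^ D
    hPigeon = begin-strict
      N ^ T                                ≡⟨ ^-*-assoc G (D * (6 * τ + 38)) T ⟩
      G ^ (D * (6 * τ + 38) * (D * τ))     ≡⟨ cong (G ^_) (lem₁ D τ) ⟩
      G ^ (D * D * ((6 * τ + 38) * τ))     <⟨ ^-monoʳ-< G 2≤G (*-monoʳ-< (D * D) {{m*n≢0 D D}} hb) ⟩
      G ^ (D * D * b)                      ≡⟨ cong (G ^_) (lem₂ D b) ⟩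
      G ^ (D * 1 * b * D)                  ≡⟨ trans (sym (^-*-assoc G (D * 1 * b) D)) (cong (_^ D) (sym (^-*-assoc G (D * 1) b))) ⟩
      (H ^ b) ^ D                          ∎
      where
      open ≤-Reasoning
      lem₁ : ∀ D τ → D * (6 * τ + 38) * (D * τ) ≡ D * D * ((6 * τ + 38) * τ)
      lem₁ = solve-∀
      lem₂ : ∀ D b → D * D * b ≡ D * 1 * b * D
      lem₂ = solve-∀

    hZero : 2 ^ b * D < I * I
    hZero = begin-strict
      2 ^ b * D   <⟨ *-monoˡ-< D (<-≤-trans (^-monoʳ-< 2 ≤-refl (n<1+n b)) G-b) ⟩
      G * D       ≡⟨ ^-distribˡ-+-* G 4 4 ⟩
      I * I       ∎
      where open ≤-Reasoning

    parameters : Parameters n B m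
    parameters = record
      { b = b ; D = D ; H = H ; T = T ; R = R ; I = I ; J = I ; M = M ; X = X ; Y = Y ; E = E ; Gam = Gam ; N = N
      ; 1≤b = 1≤b ; 1≤D = m^n>0 G 7 ; 1≤H = m^n>0 G (D * 1) ; 1≤R = m^n>0 G 5 ; 1≤X = m^n>0 G 5 ; 1≤Y = m^n>0 G (D * 1)
      ; D≤T = ≤-trans (≤-reflexive (sym (*-identityʳ D))) (*-monoʳ-≤ D (≤-trans (s≤s z≤n) hτ))
      ; m<M = m<M ; hX = hX ; hY = hY ; hE = hE ; hR = hR ; hGam = hGam ; hN = hN ; hTail = hTail
      ; hPigeon = hPigeon ; hZero = hZero }

  parameters-from : ∀ n B m M τ b → 1 ≤ n → 1 ≤ B → m < M → 1 ≤ b → 49 ≤ τ → (6 * τ + 38) * τ < b →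
    Σ (Parameters n B m) λ P → Parameters.M P ≡ M
  parameters-from n B m M τ b 1≤n 1≤B m<M 1≤b hτ hb = Choice.parameters n B m M (c₁ + (c₂ + (c₃ + (c₄ + (c₅ + c₆))))) τ b 1≤n 1≤B m<M
      (m≤m+n c₁ _)
      (≤-trans (m≤m+n c₂ _) (m≤n+m _ c₁))
      (≤-trans (m≤m+n c₃ _) (≤-trans (m≤n+m _ c₂) (m≤n+m _ c₁)))
      (≤-trans (m≤m+n c₄ _) (≤-trans (m≤n+m _ c₃) (≤-trans (m≤n+m _ c₂) (m≤n+m _ c₁))))
      (≤-trans (m≤m+n c₅ _) (≤-trans (m≤n+m _ c₄) (≤-trans (m≤n+m _ c₃) (≤-trans (m≤n+m _ c₂) (m≤n+m _ c₁)))))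
      (≤-trans (m≤n+m c₆ c₅) (≤-trans (m≤n+m _ c₄) (≤-trans (m≤n+m _ c₃) (≤-trans (m≤n+m _ c₂) (m≤n+m _ c₁)))))
      1≤b hτ hb , refl
    where
    c₁ = 2 * (B + M)
    c₂ = 2 * (2 + n)
    c₃ = (2 * n) ^ (2 * b)
    c₄ = 60 * M ^ 4
    c₅ = 2 ^ suc b
    c₆ = 2 * τ

  abstract
    parameters : ∀ n B m M → 1 ≤ n → 1 ≤ B → m < M → Σ (Parameters n B m) λ P → Parameters.M P ≡ M
    -- τ = 49 is the least value allowed by the tail, and 16269 = (6 · 49 + 38) · 49 + 1 the least b
    -- for which the pigeonhole count succeeds. Abstractness keeps powers such as 2 ^ 16270 from
    -- being evaluated.
    parameters n B m M 1≤n 1≤B m<M = parameters-from n B m M 49 16269 1≤n 1≤B m<M (s≤s z≤n) ≤-refl ≤-refl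

-- Comparisons with powers of log₂ n through fractions, and the case of a rational root.

module LogComparison where

  open import Defs using (LeMulLog; LtMulLog; MulLogLe; MulLogLt)
  open NewtonSeries using (ℕ^-distrib-*)
  open OrderedField
  open Pigeonhole using (bernoulli; Exponent)
  open import Data.Empty using (⊥-elim)
  open import Data.Integer as ℤ using (ℤ; +_)
  import Data.Integer.Properties as ℤP
  open import Data.Nat
  open import Data.Nat.Properties
  open import Data.Nat.Coprimality using (Coprime; coprime-divisor; coprime-/gcd)
  open import Data.Nat.Divisibility
  open import Data.Nat.DivMod using (m/n*n≡m)
  open import Data.Nat.GCD using (gcd; gcd[m,n]∣m; gcd[m,n]∣n; gcd[m,n]≢0)
  open import Data.Nat.Tactic.RingSolver using (solve-∀)
  open import Data.Product using (Σ; _×_; _,_; proj₂)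
  import Data.Rational as ℚ
  import Data.Rational.Properties as ℚP
  open import Data.Sum using (_⊎_; inj₁; inj₂)
  open import Relation.Binary.Definitions using (tri<; tri≈; tri>)
  open import Relation.Binary.PropositionalEquality hiding (J)
  open import Relation.Nullary using (¬_; yes; no)

  abstract
    rationals : OField
    rationals = record
      { cring = record { isCommutativeRing = ℚP.+-*-isCommutativeRing }
      ; _≤_ = ℚ._≤_ ; ≤-refl = ℚP.≤-refl ; ≤-trans = ℚP.≤-trans ; ≤-total = ℚP.≤-total ; _≤?_ = ℚP._≤?_
      ; +-monoˡ = λ z → ℚP.+-monoˡ-≤ z
      ; *-nonNeg = λ {x} {y} p q → ℚP.nonNegative⁻¹ (x ℚ.* y) {{ℚP.nonNeg*nonNeg⇒nonNeg x {{ℚ.nonNegative p}} y {{ℚ.nonNegative q}}}}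
      ; 1≰0 = λ p → ℚP.<-irrefl refl (ℚP.<-≤-trans (ℚP.positive⁻¹ ℚ.1ℚ) p)
      ; inverse = λ x x≰0 → (ℚ.1/ x) {{ℚP.pos⇒nonZero x {{ℚ.positive (ℚP.≰⇒> x≰0)}}}} , ℚP.*-inverseʳ x {{ℚP.pos⇒nonZero x {{ℚ.positive (ℚP.≰⇒> x≰0)}}}} }

  ^-cancelˡ-≤ : ∀ k → 0 < k → ∀ {a b} → a ^ k ≤ b ^ k → a ≤ b
  ^-cancelˡ-≤ k 0<k {a} {b} h with a ≤? b
  ... | yes p = p
  ... | no ¬p = ⊥-elim (<-irrefl refl (<-≤-trans (^-monoˡ-< k {{>-nonZero 0<k}} (≰⇒> ¬p)) h))

  ^-cancelˡ-< : ∀ k {a b} → a ^ k < b ^ k → a < b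
  ^-cancelˡ-< k {a} {b} h with b ≤? a
  ... | yes p = ⊥-elim (<-irrefl refl (<-≤-trans h (^-monoˡ-≤ k p)))
  ... | no ¬p = ≰⇒> ¬p

  2^-cancel-≤ : ∀ {a b} → 2 ^ a ≤ 2 ^ b → a ≤ b
  2^-cancel-≤ {a} {b} h with a ≤? b
  ... | yes p = p
  ... | no ¬p = ⊥-elim (<-irrefl refl (<-≤-trans (^-monoʳ-< 2 ≤-refl (≰⇒> ¬p)) h))

  ^-^-comm : ∀ x a b → (x ^ a) ^ b ≡ (x ^ b) ^ a
  ^-^-comm x a b = trans (^-*-assoc x a b) (trans (cong (x ^_) (*-comm a b)) (sym (^-*-assoc x b a)))

  swap-fractions : ∀ B p q k → B * p ^ k * q ^ k ≡ B * (p * q) ^ k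
  swap-fractions B p q k = trans (*-assoc B (p ^ k) (q ^ k)) (cong (B *_) (sym (ℕ^-distrib-* p q k)))

  module _ {n A B k : ℕ} where

    -- The witness p/q lies between (A/B)^(1/k) and log₂ n, so every fraction below the root is
    -- below p/q and therefore below log₂ n.
    Lt⇒Le : LtMulLog n A B k → LeMulLog n A B k
    Lt⇒Le (p , q , 0<q , A<B , lt) p' q' 0<q' B<A = ^-cancelˡ-≤ q 0<q (begin
      (2 ^ p') ^ q     ≡⟨ ^-*-assoc 2 p' q ⟩
      2 ^ (p' * q)     ≤⟨ ^-monoʳ-≤ 2 (<⇒≤ p'q<pq') ⟩
      2 ^ (p * q')     ≡⟨ sym (^-*-assoc 2 p q') ⟩
      (2 ^ p) ^ q'     ≤⟨ ^-monoˡ-≤ q' (<⇒≤ lt) ⟩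
      (n ^ q) ^ q'     ≡⟨ ^-^-comm n q q' ⟩
      (n ^ q') ^ q     ∎)
      where
      open ≤-Reasoning
      p'q<pq' : p' * q < p * q'
      p'q<pq' = ^-cancelˡ-< k (*-cancelˡ-< B _ _ (begin-strict
        B * (p' * q) ^ k      ≡⟨ sym (swap-fractions B p' q k) ⟩
        B * p' ^ k * q ^ k    <⟨ *-monoˡ-< (q ^ k) {{m^n≢0 q k {{>-nonZero 0<q}}}} B<A ⟩
        A * q' ^ k * q ^ k    ≡⟨ trans (*-assoc A _ _) (trans (cong (A *_) (*-comm (q' ^ k) (q ^ k))) (sym (*-assoc A _ _))) ⟩
        A * q ^ k * q' ^ k    ≤⟨ *-monoˡ-≤ (q' ^ k) (<⇒≤ A<B) ⟩
        B * p ^ k * q' ^ k    ≡⟨ swap-fractions B p q' k ⟩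
        B * (p * q') ^ k      ∎))

    MulLogLt⇒Le : MulLogLt n B A k → MulLogLe n B A k
    MulLogLt⇒Le (p , q , 0<q , lt , B<A) p' q' 0<q' le = *-cancelʳ-≤ _ _ (q ^ k) {{m^n≢0 q k {{>-nonZero 0<q}}}} (begin
      B * p' ^ k * q ^ k   ≡⟨ swap-fractions B p' q k ⟩
      B * (p' * q) ^ k     ≤⟨ *-monoʳ-≤ B (^-monoˡ-≤ k p'q≤pq') ⟩
      B * (p * q') ^ k     ≡⟨ sym (swap-fractions B p q' k) ⟩
      B * p ^ k * q' ^ k   ≤⟨ *-monoˡ-≤ (q' ^ k) (<⇒≤ B<A) ⟩
      A * q ^ k * q' ^ k   ≡⟨ trans (*-assoc A _ _) (trans (cong (A *_) (*-comm (q ^ k) (q' ^ k))) (sym (*-assoc A _ _))) ⟩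
      A * q' ^ k * q ^ k   ∎)
      where
      open ≤-Reasoning
      p'q≤pq' : p' * q ≤ p * q'
      p'q≤pq' = 2^-cancel-≤ (begin
        2 ^ (p' * q)    ≡⟨ sym (^-*-assoc 2 p' q) ⟩
        (2 ^ p') ^ q    ≤⟨ ^-monoˡ-≤ q le ⟩
        (n ^ q') ^ q    ≡⟨ ^-^-comm n q' q ⟩
        (n ^ q) ^ q'    ≤⟨ ^-monoˡ-≤ q' (<⇒≤ lt) ⟩
        (2 ^ p) ^ q'    ≡⟨ ^-*-assoc 2 p q' ⟩
        2 ^ (p * q')    ∎)

  -- The two strict alternatives carry a separating fraction; the third, both weak inequalities
  -- together, says that log₂ n equals the k-th root of A/B.
  Trichotomy : ℕ → ℕ → ℕ → ℕ → Set
  Trichotomy n A B k = LtMulLog n A B k ⊎ MulLogLt n B A k ⊎ (LeMulLog n A B k × MulLogLe n B A k)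

  -- Bernoulli at exponent Q + 1. It turns a gap of one between integers into a factor 2 between
  -- their powers, which is room to move the exponent of 2 by one and so to separate strictly.
  double-power : ∀ Q → 1 ≤ Q → 2 * Q ^ suc Q < suc Q ^ suc Q
  double-power Q 1≤Q = *-cancelˡ-< Q _ _ (begin-strict
    Q * (2 * Q ^ suc Q)          ≡⟨ lem Q (Q ^ suc Q) ⟩
    (Q + Q) * Q ^ suc Q          <⟨ *-monoˡ-< (Q ^ suc Q) {{m^n≢0 Q (suc Q) {{>-nonZero 1≤Q}}}} (+-monoʳ-< Q (n<1+n Q)) ⟩
    (Q + suc Q) * Q ^ suc Q      ≤⟨ bernoulli Q (suc Q) ⟩
    Q * suc Q ^ suc Q            ∎)
    where
    open ≤-Reasoning
    lem : ∀ Q x → Q * (2 * x) ≡ (Q + Q) * x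
    lem = solve-∀

  -- the case (A / B) ^ (1/k) = t / s, where 2ᵗ and nˢ are compared directly
  rational-case : ∀ n A B k t s → 0 < k → 1 ≤ n → 1 ≤ B → 0 < s → A * s ^ k ≡ B * t ^ k → Trichotomy n A B k
  rational-case n A B k t s 0<k 1≤n 1≤B 0<s root with <-cmp (2 ^ t) (n ^ s)
  -- With N = 2ᵗ + 1 the fraction (t N + 1) / (s N) exceeds the root t/s and, by `double-power`, is
  -- still below log₂ n.
  ... | tri< lt _ _ = inj₁ (suc (t * N) , s * N , *-mono-≤ 0<s z<s , A<B , 2p<)
    where
    open ≤-Reasoning
    Q = 2 ^ t
    N = suc Q
    A<B : A * (s * N) ^ k < B * suc (t * N) ^ k
    A<B = begin-strict
      A * (s * N) ^ k      ≡⟨ sym (swap-fractions A s N k) ⟩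
      A * s ^ k * N ^ k    ≡⟨ cong (_* N ^ k) root ⟩
      B * t ^ k * N ^ k    ≡⟨ swap-fractions B t N k ⟩
      B * (t * N) ^ k      <⟨ *-monoʳ-< B {{>-nonZero 1≤B}} (^-monoˡ-< k {{>-nonZero 0<k}} (n<1+n (t * N))) ⟩
      B * suc (t * N) ^ k  ∎
    2p< : 2 ^ suc (t * N) < n ^ (s * N)
    2p< = begin-strict
      2 * 2 ^ (t * N)   ≡⟨ cong (2 *_) (sym (^-*-assoc 2 t N)) ⟩
      2 * Q ^ N         <⟨ double-power Q (m^n>0 2 t) ⟩
      suc Q ^ N         ≤⟨ ^-monoˡ-≤ N lt ⟩
      (n ^ s) ^ N       ≡⟨ ^-*-assoc n s N ⟩
      n ^ (s * N)       ∎
  ... | tri> _ _ gt = inj₂ (inj₁ (p , s * N , *-mono-≤ 0<s z<s , *-cancelˡ-< 2 _ _ n<2p , B<A))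
    where
    open ≤-Reasoning
    Q = n ^ s
    N = suc Q
    1≤Q : 1 ≤ Q
    1≤Q = m^n>0 n {{>-nonZero 1≤n}} s
    1≤t : 1 ≤ t
    1≤t = lem t gt
      where
      lem : ∀ t → Q < 2 ^ t → 1 ≤ t
      lem zero    h = ⊥-elim (<-irrefl refl (<-≤-trans h 1≤Q))
      lem (suc t) h = s≤s z≤n
    p = pred (t * N)
    p+1 : suc p ≡ t * N
    p+1 = suc-pred (t * N) {{>-nonZero (*-mono-≤ 1≤t (s≤s z≤n))}}
    n<2p : 2 * n ^ (s * N) < 2 * 2 ^ p
    n<2p = begin-strict
      2 * n ^ (s * N)   ≡⟨ cong (2 *_) (sym (^-*-assoc n s N)) ⟩
      2 * Q ^ N         <⟨ double-power Q 1≤Q ⟩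
      suc Q ^ N         ≤⟨ ^-monoˡ-≤ N gt ⟩
      (2 ^ t) ^ N       ≡⟨ trans (^-*-assoc 2 t N) (cong (2 ^_) (sym p+1)) ⟩
      2 * 2 ^ p         ∎
    B<A : B * p ^ k < A * (s * N) ^ k
    B<A = begin-strict
      B * p ^ k            <⟨ *-monoʳ-< B {{>-nonZero 1≤B}} (^-monoˡ-< k {{>-nonZero 0<k}} (subst (p <_) p+1 (n<1+n p))) ⟩
      B * (t * N) ^ k      ≡⟨ sym (swap-fractions B t N k) ⟩
      B * t ^ k * N ^ k    ≡⟨ cong (_* N ^ k) (sym root) ⟩
      A * s ^ k * N ^ k    ≡⟨ swap-fractions A s N k ⟩
      A * (s * N) ^ k      ∎
  ... | tri≈ _ eq _ = inj₂ (inj₂ (le , ge))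
    where
    open ≤-Reasoning
    cross : ∀ q → A * q ^ k * s ^ k ≡ B * (t * q) ^ k
    cross q = trans (*-assoc A _ _) (trans (cong (A *_) (*-comm (q ^ k) (s ^ k))) (trans (sym (*-assoc A _ _))
      (trans (cong (_* q ^ k) root) (swap-fractions B t q k))))
    le : LeMulLog n A B k
    le p q 0<q B<A = ^-cancelˡ-≤ s 0<s (begin
      (2 ^ p) ^ s    ≡⟨ ^-*-assoc 2 p s ⟩
      2 ^ (p * s)    ≤⟨ ^-monoʳ-≤ 2 (<⇒≤ (^-cancelˡ-< k (*-cancelˡ-< B _ _ ps<tq))) ⟩
      2 ^ (t * q)    ≡⟨ sym (^-*-assoc 2 t q) ⟩
      (2 ^ t) ^ q    ≡⟨ cong (_^ q) eq ⟩
      (n ^ s) ^ q    ≡⟨ ^-^-comm n s q ⟩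
      (n ^ q) ^ s    ∎)
      where
      ps<tq : B * (p * s) ^ k < B * (t * q) ^ k
      ps<tq = begin-strict
        B * (p * s) ^ k      ≡⟨ sym (swap-fractions B p s k) ⟩
        B * p ^ k * s ^ k    <⟨ *-monoˡ-< (s ^ k) {{m^n≢0 s k {{>-nonZero 0<s}}}} B<A ⟩
        A * q ^ k * s ^ k    ≡⟨ cross q ⟩
        B * (t * q) ^ k      ∎
    ge : MulLogLe n B A k
    ge p q 0<q 2p≤ = *-cancelʳ-≤ _ _ (s ^ k) {{m^n≢0 s k {{>-nonZero 0<s}}}} (begin
      B * p ^ k * s ^ k    ≡⟨ swap-fractions B p s k ⟩
      B * (p * s) ^ k      ≤⟨ *-monoʳ-≤ B (^-monoˡ-≤ k (2^-cancel-≤ ps≤tq)) ⟩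
      B * (t * q) ^ k      ≡⟨ sym (cross q) ⟩
      A * q ^ k * s ^ k    ∎)
      where
      ps≤tq : 2 ^ (p * s) ≤ 2 ^ (t * q)
      ps≤tq = begin
        2 ^ (p * s)    ≡⟨ sym (^-*-assoc 2 p s) ⟩
        (2 ^ p) ^ s    ≤⟨ ^-monoˡ-≤ s 2p≤ ⟩
        (n ^ q) ^ s    ≡⟨ ^-^-comm n q s ⟩
        (n ^ s) ^ q    ≡⟨ cong (_^ q) (sym eq) ⟩
        (2 ^ t) ^ q    ≡⟨ ^-*-assoc 2 t q ⟩
        2 ^ (t * q)    ∎

  module _ {n Q : ℕ} (1≤Q : 1 ≤ Q) (e₂ : Exponent Q 2) (eₙ : Exponent Q n) where
    open Exponent e₂ using () renaming (p to p₂; lower to lower₂; upper to upper₂)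
    open Exponent eₙ using () renaming (p to pₙ; lower to lowerₙ; upper to upperₙ)

    private
      instance
        Q≢0 : NonZero Q
        Q≢0 = >-nonZero 1≤Q

      scale : ∀ g p e → (g * Q ^ p) ^ e ≡ g ^ e * Q ^ (p * e)
      scale g p e = trans (ℕ^-distrib-* g (Q ^ p) e) (cong (g ^ e *_) (^-*-assoc Q p e))

    -- Both 2 and n are compared with powers of 1 + 1/Q; eliminating the base gives log₂ n < (pₙ +
    -- 1)/p₂, and `log-lower` gives the companion pₙ/(p₂ + 1) < log₂ n.
    log-upper : 1 ≤ p₂ → n ^ p₂ < 2 ^ suc pₙ
    log-upper 1≤p₂ = *-cancelʳ-< (Q ^ (suc pₙ * p₂)) _ _ (begin-strict
      n ^ p₂ * Q ^ (suc pₙ * p₂)          ≡⟨ sym (scale n (suc pₙ) p₂) ⟩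
      (n * Q ^ suc pₙ) ^ p₂               <⟨ ^-monoˡ-< p₂ {{>-nonZero 1≤p₂}} upperₙ ⟩
      (suc Q ^ suc pₙ) ^ p₂               ≡⟨ ^-^-comm (suc Q) (suc pₙ) p₂ ⟩
      (suc Q ^ p₂) ^ suc pₙ               ≤⟨ ^-monoˡ-≤ (suc pₙ) lower₂ ⟩
      (2 * Q ^ p₂) ^ suc pₙ               ≡⟨ trans (scale 2 p₂ (suc pₙ)) (cong (λ e → 2 ^ suc pₙ * Q ^ e) (*-comm p₂ (suc pₙ))) ⟩
      2 ^ suc pₙ * Q ^ (suc pₙ * p₂)      ∎)
      where open ≤-Reasoning

    log-lower : 1 ≤ pₙ → 2 ^ pₙ < n ^ suc p₂
    log-lower 1≤pₙ = *-cancelʳ-< (Q ^ (suc p₂ * pₙ)) _ _ (begin-strict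
      2 ^ pₙ * Q ^ (suc p₂ * pₙ)          ≡⟨ sym (scale 2 (suc p₂) pₙ) ⟩
      (2 * Q ^ suc p₂) ^ pₙ               <⟨ ^-monoˡ-< pₙ {{>-nonZero 1≤pₙ}} upper₂ ⟩
      (suc Q ^ suc p₂) ^ pₙ               ≡⟨ ^-^-comm (suc Q) (suc p₂) pₙ ⟩
      (suc Q ^ pₙ) ^ suc p₂               ≤⟨ ^-monoˡ-≤ (suc p₂) lowerₙ ⟩
      (n * Q ^ pₙ) ^ suc p₂               ≡⟨ trans (scale n pₙ (suc p₂)) (cong (λ e → n ^ suc p₂ * Q ^ e) (*-comm pₙ (suc p₂))) ⟩
      n ^ suc p₂ * Q ^ (suc p₂ * pₙ)      ∎)
      where open ≤-Reasoning

  coprime-power : ∀ {s t} k → Coprime s t → s ∣ t ^ k → s ∣ 1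
  coprime-power zero    c d = d
  coprime-power (suc k) c d = coprime-power k c (coprime-divisor c d)

  -- The rational root theorem: in lowest terms the denominator divides a power of the numerator,
  -- hence is 1.
  integer-root : ∀ k m t s → 0 < k → 0 < s → t ^ k ≡ m * s ^ k → Σ ℕ λ r → r ^ k ≡ m
  integer-root (suc k) m t s _ 0<s e = t' , trans e'' (trans (cong (λ z → m * z ^ suc k) s'≡1) (trans (cong (m *_) (^-zeroˡ (suc k))) (*-identityʳ m)))
    where
    g = gcd s t
    instance
      g≢0 : NonZero g
      g≢0 = ≢-nonZero (gcd[m,n]≢0 s t (inj₁ (m<n⇒n≢0 0<s)))
    s' = s / g
    t' = t / g
    es : s' * g ≡ s
    es = m/n*n≡m (gcd[m,n]∣m s t)
    et : t' * g ≡ t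
    et = m/n*n≡m (gcd[m,n]∣n s t)
    e' : t' ^ suc k * g ^ suc k ≡ (m * s' ^ suc k) * g ^ suc k
    e' = trans (sym (ℕ^-distrib-* t' g (suc k))) (trans (cong (_^ suc k) et) (trans e
      (trans (cong (λ z → m * z ^ suc k) (sym es)) (trans (cong (m *_) (ℕ^-distrib-* s' g (suc k))) (sym (*-assoc m _ _))))))
    e'' : t' ^ suc k ≡ m * s' ^ suc k
    e'' = *-cancelʳ-≡ _ _ (g ^ suc k) {{m^n≢0 g (suc k)}} e'
    s'≡1 : s' ≡ 1
    s'≡1 = ∣1⇒≡1 (coprime-power (suc k) (coprime-/gcd s t) (subst (s' ∣_) (sym e'') (∣-trans (m∣m*n (s' ^ k)) (n∣m*n m))))

  no-rational-root : ∀ k m → 0 < k → (∀ r → ¬ (r ^ k ≡ m)) → ∀ t s → ℤ.∣ t ∣ ^ k ≡ m * ℤ.∣ s ∣ ^ k → s ≡ + 0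
  no-rational-root k m 0<k none t s e with ℤ.∣ s ∣ in eq
  ... | zero  = ℤP.∣i∣≡0⇒i≡0 eq
  ... | suc z = ⊥-elim (none _ (proj₂ (integer-root k m ℤ.∣ t ∣ (suc z) 0<k z<s e)))

-- If neither fraction separates, then ρᵏ is within a constant times 1/Q of m.

module Closeness where

  open LogComparison
  open NewtonSeries using (module Expansion)
  open OrderedField
  open Pigeonhole using (Exponent; exponent-two)
  open Grid using (module GridPoints)
  open import Data.Integer using (+_)
  open import Data.Nat as ℕ using (ℕ; zero; suc)
  import Data.Nat.Properties as ℕP
  open import Data.Nat.Tactic.RingSolver using (solve-∀)
  open import Data.Product using (_,_)
  open import Relation.Binary.PropositionalEquality hiding (J)

  module CloseApproximation (F : OField) (Q n B : ℕ) (1≤Q : 1 ℕ.≤ Q) (1≤n : 1 ℕ.≤ n) (1≤B : 1 ℕ.≤ B)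
                   (e₂ : Exponent Q 2) (eₙ : Exponent Q n) where
    open OFieldTheory F
    open Expansion F
    open GridPoints F Q n B 1≤Q 1≤n 1≤B e₂ eₙ

    -- Convexity of z ↦ zᵏ: the value at x + ε y lies below the chord over [x, x + y]. A shift by ε
    -- in the base thus costs an explicit constant times ε in the power.
    power-convex : ∀ {x y ε} k → 0# ≤ x → 0# ≤ y → 0# ≤ ε → ε ≤ 1# →
      (x + ε * y) ^ k ≤ x ^ k + ε * ((x + y) ^ k - x ^ k)
    power-convex {x} {y} {ε} zero 0≤x 0≤y 0≤ε ε≤1 =
      ≤-reflexive (solve 2 (λ o e → o := o :+ e :* (o :- o)) refl 1# ε)
      where open Solver
    power-convex {x} {y} {ε} (suc k) 0≤x 0≤y 0≤ε ε≤1 =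
      (x + ε * y) * (x + ε * y) ^ k                    ≤⟨ *-monoʳ _ (+-nonNeg 0≤x (*-nonNeg 0≤ε 0≤y)) (power-convex k 0≤x 0≤y 0≤ε ε≤1) ⟩
      (x + ε * y) * (z + ε * S)                        ≡⟨ solve 5 (λ x e y z s → (x :+ e :* y) :* (z :+ e :* s) := x :* z :+ e :* (x :* s :+ y :* z :+ e :* (y :* s))) refl x ε y z S ⟩'
      x * z + ε * (x * S + y * z + ε * (y * S))        ≤⟨ +-monoʳ _ (*-monoʳ ε 0≤ε (+-monoʳ _ (≤-trans (*-monoˡ (y * S) (*-nonNeg 0≤y 0≤S) ε≤1) (≤-reflexive (*-identityˡ _))))) ⟩
      x * z + ε * (x * S + y * z + y * S)              ≡⟨ solve 5 (λ x e y z w → x :* z :+ e :* (x :* (w :- z) :+ y :* z :+ y :* (w :- z)) := x :* z :+ e :* ((x :+ y) :* w :- x :* z)) refl x ε y z ((x + y) ^ k) ⟩'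
      x * z + ε * ((x + y) * (x + y) ^ k - x * z) □
      where
      open Solver
      z = x ^ k
      S = (x + y) ^ k - z
      0≤S : 0# ≤ S
      0≤S = x-y≥0 (^-mono k 0≤x (≤-trans (≤-reflexive (sym (+-identityʳ x))) (+-monoʳ x 0≤y)))

    1/p₂≤1 : 1/p₂ ≤ 1#
    1/p₂≤1 = ≤-trans (≤-reflexive (sym (*-identityˡ 1/p₂))) (≤-trans (*-monoˡ 1/p₂ 0≤1/p₂ (1≤fromℕ 1≤p₂)) (≤-reflexive p₂/p₂≡1))

    1/p₂≤2ζ : 1/p₂ ≤ fromℕ 2 * ζ
    1/p₂≤2ζ =
      1/p₂                               ≡⟨ sym (trans (cong (_* 1/p₂) Qζ≡1) (*-identityˡ _)) ⟩'
      (fromℕ Q * ζ) * 1/p₂               ≤⟨ *-monoˡ 1/p₂ 0≤1/p₂ (*-monoˡ ζ 0≤ζ (fromℕ-mono (exponent-two Q e₂))) ⟩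
      (fromℕ (2 ℕ.* p₂) * ζ) * 1/p₂      ≡⟨ trans (cong (λ t → (t * ζ) * 1/p₂) (fromℕ-* 2 p₂)) (solve 4 (λ t p z e → ((t :* p) :* z) :* e := (p :* e) :* (t :* z)) refl (fromℕ 2) (fromℕ p₂) ζ 1/p₂) ⟩'
      (fromℕ p₂ * 1/p₂) * (fromℕ 2 * ζ)  ≡⟨ trans (cong (_* (fromℕ 2 * ζ)) p₂/p₂≡1) (*-identityˡ _) ⟩'
      fromℕ 2 * ζ □
      where open Solver

    ρ≤ : ∀ M → 2 ℕ.* n ℕ.* B ℕ.≤ M → ρ ≤ fromℕ M
    ρ≤ M h = ≤-trans (*-monoˡ 1/p₂ 0≤1/p₂ (fromℕ-mono le))
      (≤-reflexive (trans (cong (_* 1/p₂) (fromℕ-* M p₂)) (trans (*-assoc _ _ _) (trans (cong (_*_ _) p₂/p₂≡1) (*-identityʳ _)))))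
      where
      lem : ∀ B n p → B ℕ.* (n ℕ.* (2 ℕ.* p)) ≡ 2 ℕ.* n ℕ.* B ℕ.* p
      lem = solve-∀
      le : B ℕ.* pₙ ℕ.≤ M ℕ.* p₂
      le = ℕP.≤-trans (ℕP.*-monoʳ-≤ B (ℕP.≤-trans (ℕP.<⇒≤ pₙ<) (ℕP.*-monoʳ-≤ n (exponent-two Q e₂))))
        (ℕP.≤-trans (ℕP.≤-reflexive (lem B n p₂)) (ℕP.*-monoˡ-≤ p₂ h))

    -- The two summands bound the chord slopes in the upper and the lower estimate of ρᵏ - m; the
    -- factor 2 comes from 1/p₂ ≤ 2 ζ.
    slack : ℕ → ℕ → ℕ → ℕ
    slack k m M = 2 ℕ.* (m ℕ.* 2 ℕ.^ k ℕ.+ (M ℕ.+ B) ℕ.^ k)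

    -- Division by p₂ᵏ turns the hypotheses into ρᵏ ≤ m (1 + 1/p₂)ᵏ and m ≤ (ρ + B/p₂)ᵏ, to which
    -- `power-convex` applies with ε = 1/p₂.
    close : ∀ k m M → ρ ≤ fromℕ M → (B ℕ.* pₙ) ℕ.^ k ℕ.≤ m ℕ.* suc p₂ ℕ.^ k → m ℕ.* p₂ ℕ.^ k ℕ.≤ (B ℕ.* suc pₙ) ℕ.^ k →
      ∣ ρ ^ k - fromℕ m ∣≤ (fromℕ (slack k m M) * ζ)
    close k m M ρ≤M h₁ h₂ = upper , lower
      where
      open Solver
      ε = 1/p₂
      m' = fromℕ m
      a = fromℕ (m ℕ.* 2 ℕ.^ k)
      b = fromℕ ((M ℕ.+ B) ℕ.^ k)
      0≤a = fromℕ-nonNeg (m ℕ.* 2 ℕ.^ k)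
      0≤b = fromℕ-nonNeg ((M ℕ.+ B) ℕ.^ k)
      total : a * ε + b * ε ≤ fromℕ (slack k m M) * ζ
      total = ≤-trans (≤-reflexive (sym (distribʳ _ _ _))) (≤-trans (*-monoʳ (a + b) (+-nonNeg 0≤a 0≤b) 1/p₂≤2ζ)
        (≤-reflexive (trans (solve 4 (λ a b t z → (a :+ b) :* (t :* z) := (t :* (a :+ b)) :* z) refl a b (fromℕ 2) ζ)
          (cong (_* ζ) (trans (cong (_*_ (fromℕ 2)) (sym (fromℕ-+ (m ℕ.* 2 ℕ.^ k) ((M ℕ.+ B) ℕ.^ k)))) (sym (fromℕ-* 2 (m ℕ.* 2 ℕ.^ k ℕ.+ (M ℕ.+ B) ℕ.^ k))))))))
      scaled : ∀ x → fromℕ (x ℕ.^ k) * ε ^ k ≡ (fromℕ x * ε) ^ k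
      scaled x = trans (cong (_* ε ^ k) (fromℕ-^ x k)) (sym (^-distrib-* _ ε k))
      suc-p₂ : fromℕ (suc p₂) * ε ≡ 1# + ε * 1#
      suc-p₂ = trans (distribʳ _ _ _) (trans (cong₂ _+_ (trans (*-identityˡ ε) (sym (*-identityʳ ε))) p₂/p₂≡1) (+-comm _ _))
      suc-pₙ : fromℕ (B ℕ.* suc pₙ) * ε ≡ ρ + ε * fromℕ B
      suc-pₙ = trans (cong (λ t → fromℕ t * ε) (ℕP.*-suc B pₙ)) (trans (cong (_* ε) (fromℕ-+ B (B ℕ.* pₙ)))
        (solve 3 (λ b x e → (b :+ x) :* e := x :* e :+ e :* b) refl (fromℕ B) (fromℕ (B ℕ.* pₙ)) ε))
      ρ^≤ : ρ ^ k ≤ m' + a * ε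
      ρ^≤ =
        ρ ^ k                                             ≡⟨ sym (scaled (B ℕ.* pₙ)) ⟩'
        fromℕ ((B ℕ.* pₙ) ℕ.^ k) * ε ^ k                  ≤⟨ *-monoˡ _ (^-nonNeg k 0≤1/p₂) (fromℕ-mono h₁) ⟩
        fromℕ (m ℕ.* suc p₂ ℕ.^ k) * ε ^ k                ≡⟨ trans (cong (_* ε ^ k) (fromℕ-* m _)) (trans (*-assoc _ _ _) (cong (_*_ m') (trans (scaled (suc p₂)) (cong (_^ k) suc-p₂)))) ⟩'
        m' * (1# + ε * 1#) ^ k                            ≤⟨ *-monoʳ m' (fromℕ-nonNeg m) (power-convex k 0≤1 0≤1 0≤1/p₂ 1/p₂≤1) ⟩
        m' * (1# ^ k + ε * ((1# + 1#) ^ k - 1# ^ k))      ≡⟨ cong (λ t → m' * (t + ε * ((1# + 1#) ^ k - t))) (1^ k) ⟩'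
        m' * (1# + ε * ((1# + 1#) ^ k - 1#))              ≤⟨ *-monoʳ m' (fromℕ-nonNeg m) (+-monoʳ 1# (*-monoʳ ε 0≤1/p₂
                                                               (≤-trans (+-monoʳ _ (≤-trans (neg-mono 0≤1) (≤-reflexive -0≡0))) (≤-reflexive (+-identityʳ _))))) ⟩
        m' * (1# + ε * (1# + 1#) ^ k)                     ≡⟨ trans (distribˡ _ _ _) (cong₂ _+_ (*-identityʳ m') (trans (solve 3 (λ m e t → m :* (e :* t) := (m :* t) :* e) refl m' ε ((1# + 1#) ^ k))
                                                               (cong (_* ε) (trans (cong (λ t → m' * (1# + t) ^ k) (sym fromℕ-1)) (trans (cong (_*_ m') (sym (fromℕ-^ 2 k))) (sym (fromℕ-* m (2 ℕ.^ k)))))))) ⟩'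
        m' + a * ε □
      m≤ : m' ≤ ρ ^ k + b * ε
      m≤ =
        m'                                                ≡⟨ sym (trans (cong (_* ε ^ k) (fromℕ-* m _)) (trans (*-assoc _ _ _) (trans (cong (_*_ m') (trans (scaled p₂) (trans (cong (_^ k) p₂/p₂≡1) (1^ k)))) (*-identityʳ m')))) ⟩'
        fromℕ (m ℕ.* p₂ ℕ.^ k) * ε ^ k                    ≤⟨ *-monoˡ _ (^-nonNeg k 0≤1/p₂) (fromℕ-mono h₂) ⟩
        fromℕ ((B ℕ.* suc pₙ) ℕ.^ k) * ε ^ k              ≡⟨ trans (scaled (B ℕ.* suc pₙ)) (cong (_^ k) suc-pₙ) ⟩'
        (ρ + ε * fromℕ B) ^ k                             ≤⟨ power-convex k 0≤ρ (fromℕ-nonNeg B) 0≤1/p₂ 1/p₂≤1 ⟩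
        ρ ^ k + ε * ((ρ + fromℕ B) ^ k - ρ ^ k)           ≤⟨ +-monoʳ _ (*-monoʳ ε 0≤1/p₂
                                                               (≤-trans (+-monoʳ _ (≤-trans (neg-mono (^-nonNeg k 0≤ρ)) (≤-reflexive -0≡0))) (≤-trans (≤-reflexive (+-identityʳ _))
                                                                 (≤-trans (^-mono k (+-nonNeg 0≤ρ (fromℕ-nonNeg B)) (+-monoˡ (fromℕ B) ρ≤M)) (≤-reflexive (trans (cong (_^ k) (sym (fromℕ-+ M B))) (sym (fromℕ-^ (M ℕ.+ B) k)))))))) ⟩
        ρ ^ k + ε * b                                     ≡⟨ cong (_+_ (ρ ^ k)) (*-comm ε b) ⟩'
        ρ ^ k + b * ε □
      upper : ρ ^ k - m' ≤ fromℕ (slack k m M) * ζ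
      upper = ≤-trans (+-monoˡ (- m') ρ^≤) (≤-trans (≤-reflexive (solve 2 (λ m x → m :+ x :- m := x) refl m' (a * ε)))
        (≤-trans (≤-trans (≤-reflexive (sym (+-identityʳ _))) (+-monoʳ _ (*-nonNeg 0≤b 0≤1/p₂))) total))
      lower : - (ρ ^ k - m') ≤ fromℕ (slack k m M) * ζ
      lower = ≤-trans (≤-reflexive (solve 2 (λ r m → :- (r :- m) := m :- r) refl (ρ ^ k) m')) (≤-trans (+-monoˡ (- (ρ ^ k)) m≤) (≤-trans (≤-reflexive (solve 2 (λ m x → m :+ x :- m := x) refl (ρ ^ k) (b * ε)))
        (≤-trans (≤-trans (≤-reflexive (sym (+-identityˡ _))) (+-monoˡ _ (*-nonNeg 0≤a 0≤1/p₂))) total)))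

-- Deciding the position of log₂ n relative to a square or cube root.

module Comparison where

  open LogComparison
  open Closeness using (module CloseApproximation)
  open NewtonSeries using (ℕ^-distrib-*)
  open OrderedField
  open Pigeonhole using (Exponent; exponent)
  open Grid using (module GridPoints)
  open NumberRings using (NumberRing; module Quadratic; module Cubic)
  open Transcendence using (Parameters; module Contradiction)
  open ParameterChoice using (parameters)
  open import Data.Empty using (⊥; ⊥-elim)
  open import Data.Integer as ℤ using (ℤ; +_)
  import Data.Integer.Properties as ℤP
  open import Data.Nat as ℕ using (ℕ; zero; suc)
  import Data.Nat.Properties as ℕP
  open import Data.Nat.Tactic.RingSolver using (solve-∀)
  open import Data.Product using (Σ; _,_)
  open import Data.Sum using (inj₁; inj₂)
  open import Relation.Binary.PropositionalEquality hiding (J)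
  open import Relation.Nullary using (¬_; yes; no)

  -- B times the (k + 1)-th root of A/B is a (k + 1)-th root of the integer B ^ k * A. The scaling
  -- makes β integral, as the number rings require.
  scale-inequality : ∀ B k x y {A} → A ℕ.* x ℕ.^ suc k ℕ.≤ B ℕ.* y ℕ.^ suc k → (B ℕ.^ k ℕ.* A) ℕ.* x ℕ.^ suc k ℕ.≤ (B ℕ.* y) ℕ.^ suc k
  scale-inequality B k x y {A} h = begin
    (B ℕ.^ k ℕ.* A) ℕ.* x ℕ.^ suc k    ≡⟨ ℕP.*-assoc (B ℕ.^ k) A _ ⟩
    B ℕ.^ k ℕ.* (A ℕ.* x ℕ.^ suc k)    ≤⟨ ℕP.*-monoʳ-≤ (B ℕ.^ k) h ⟩
    B ℕ.^ k ℕ.* (B ℕ.* y ℕ.^ suc k)    ≡⟨ lem (B ℕ.^ k) B (y ℕ.^ suc k) ⟩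
    B ℕ.^ suc k ℕ.* y ℕ.^ suc k        ≡⟨ sym (ℕ^-distrib-* B y (suc k)) ⟩
    (B ℕ.* y) ℕ.^ suc k                ∎
    where
    open ℕP.≤-Reasoning
    lem : ∀ a b c → a ℕ.* (b ℕ.* c) ≡ (b ℕ.* a) ℕ.* c
    lem = solve-∀

  scale-inequality′ : ∀ B k x y {A} → B ℕ.* y ℕ.^ suc k ℕ.≤ A ℕ.* x ℕ.^ suc k → (B ℕ.* y) ℕ.^ suc k ℕ.≤ (B ℕ.^ k ℕ.* A) ℕ.* x ℕ.^ suc k
  scale-inequality′ B k x y {A} h = begin
    (B ℕ.* y) ℕ.^ suc k                ≡⟨ ℕ^-distrib-* B y (suc k) ⟩
    B ℕ.^ suc k ℕ.* y ℕ.^ suc k        ≡⟨ lem (B ℕ.^ k) B (y ℕ.^ suc k) ⟩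
    B ℕ.^ k ℕ.* (B ℕ.* y ℕ.^ suc k)    ≤⟨ ℕP.*-monoʳ-≤ (B ℕ.^ k) h ⟩
    B ℕ.^ k ℕ.* (A ℕ.* x ℕ.^ suc k)    ≡⟨ sym (ℕP.*-assoc (B ℕ.^ k) A _) ⟩
    (B ℕ.^ k ℕ.* A) ℕ.* x ℕ.^ suc k    ∎
    where
    open ℕP.≤-Reasoning
    lem : ∀ a b c → (b ℕ.* a) ℕ.* c ≡ a ℕ.* (b ℕ.* c)
    lem = solve-∀

  module IrrationalCase (n A B k m Q : ℕ) (1≤n : 1 ℕ.≤ n) (1≤B : 1 ℕ.≤ B) (m≡ : m ≡ B ℕ.^ k ℕ.* A)
    (NR : NumberRing rationals (suc k) m) (P : Parameters n B m) (2nB≤M : 2 ℕ.* n ℕ.* B ℕ.≤ Parameters.M P)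
    (1≤Q : 1 ℕ.≤ Q) (mesh≤Q : Parameters.mesh P (2 ℕ.* (m ℕ.* 2 ℕ.^ suc k ℕ.+ (Parameters.M P ℕ.+ B) ℕ.^ suc k)) ℕ.≤ Q)
    (e₂ : Exponent Q 2) (eₙ : Exponent Q n) where

    M : ℕ
    M = Parameters.M P
    module Cl = CloseApproximation rationals Q n B 1≤Q 1≤n 1≤B e₂ eₙ
    module Gr = GridPoints rationals Q n B 1≤Q 1≤n 1≤B e₂ eₙ
    p₂ pₙ : ℕ
    p₂ = Exponent.p e₂
    pₙ = Exponent.p eₙ

    not-close : (B ℕ.* pₙ) ℕ.^ suc k ℕ.≤ m ℕ.* suc p₂ ℕ.^ suc k → m ℕ.* p₂ ℕ.^ suc k ℕ.≤ (B ℕ.* suc pₙ) ℕ.^ suc k → ⊥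
    not-close h₁ h₂ = Contradiction.contradiction rationals (suc k) m n B Q NR 1≤n 1≤B 1≤Q e₂ eₙ P (Cl.slack (suc k) m M) (Cl.ρ≤ M 2nB≤M)
      (Cl.close (suc k) m M (Cl.ρ≤ M 2nB≤M) h₁ h₂) mesh≤Q

    positive : ∀ q x → x ℕ.< B ℕ.* q ℕ.^ suc k → 1 ℕ.≤ q
    positive zero    x lt = ⊥-elim (ℕP.n≮0 (subst (x ℕ.<_) (ℕP.*-zeroʳ B) lt))
    positive (suc q) x lt = ℕ.s≤s ℕ.z≤n

    -- If neither of the bounds (pₙ + 1)/p₂ and pₙ/(p₂ + 1) for log₂ n separates it from the root,
    -- the two are too close for the mesh, contrary to `not-close`. As Q is fixed beforehand, a
    -- single test suffices.
    decide : Trichotomy n A B (suc k)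
    decide with A ℕ.* p₂ ℕ.^ suc k ℕP.≤? B ℕ.* suc pₙ ℕ.^ suc k | B ℕ.* pₙ ℕ.^ suc k ℕP.≤? A ℕ.* suc p₂ ℕ.^ suc k
    ... | no above | _ = inj₂ (inj₁ (suc pₙ , p₂ , Gr.1≤p₂ , log-upper 1≤Q e₂ eₙ Gr.1≤p₂ , ℕP.≰⇒> above))
    ... | yes h₂ | no below = inj₁ (pₙ , suc p₂ , ℕ.s≤s ℕ.z≤n , ℕP.≰⇒> below , log-lower 1≤Q e₂ eₙ (positive pₙ (A ℕ.* suc p₂ ℕ.^ suc k) (ℕP.≰⇒> below)))
    ... | yes h₂ | yes h₁ = ⊥-elim (not-close
        (subst (λ m → (B ℕ.* pₙ) ℕ.^ suc k ℕ.≤ m ℕ.* suc p₂ ℕ.^ suc k) (sym m≡) (scale-inequality′ B k (suc p₂) pₙ {A} h₁))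
        (subst (λ m → m ℕ.* p₂ ℕ.^ suc k ℕ.≤ (B ℕ.* suc pₙ) ℕ.^ suc k) (sym m≡) (scale-inequality B k p₂ (suc pₙ) {A} h₂)))

  irrational-case : ∀ n A B k m → 1 ℕ.≤ n → 1 ℕ.≤ B → m ≡ B ℕ.^ k ℕ.* A → NumberRing rationals (suc k) m → Trichotomy n A B (suc k)
  -- M has to exceed m and to bound ρ, which is at most 2 n B; the sum does both.
  irrational-case n A B k m 1≤n 1≤B m≡ NR = go (parameters n B m (suc m ℕ.+ 2 ℕ.* n ℕ.* B) 1≤n 1≤B (ℕP.m≤m+n (suc m) (2 ℕ.* n ℕ.* B)))
    where
    go : (Σ (Parameters n B m) λ P → Parameters.M P ≡ suc m ℕ.+ 2 ℕ.* n ℕ.* B) → Trichotomy n A B (suc k)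
    go (P , M≡) = at (suc (Parameters.mesh P (2 ℕ.* (m ℕ.* 2 ℕ.^ suc k ℕ.+ (Parameters.M P ℕ.+ B) ℕ.^ suc k)))) (ℕP.n≤1+n _) (ℕ.s≤s ℕ.z≤n)
      where
      at : ∀ q → Parameters.mesh P (2 ℕ.* (m ℕ.* 2 ℕ.^ suc k ℕ.+ (Parameters.M P ℕ.+ B) ℕ.^ suc k)) ℕ.≤ q → 1 ℕ.≤ q → Trichotomy n A B (suc k)
      at q h 1≤q = IrrationalCase.decide n A B k m q 1≤n 1≤B m≡ NR P (subst (2 ℕ.* n ℕ.* B ℕ.≤_) (sym M≡) (ℕP.m≤n+m (2 ℕ.* n ℕ.* B) (suc m)))
        1≤q h (exponent q 2 1≤q (ℕ.s≤s ℕ.z≤n)) (exponent q n 1≤q 1≤n)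

  -- The root of A/B is rational exactly when B ^ k * A is a perfect power r ^ (k + 1), the root
  -- being r/B; a bounded search for r decides which argument applies.
  compare-with-log : ∀ n A B k → 1 ℕ.≤ n → 1 ℕ.≤ B →
    (∀ m → (∀ r → ¬ (r ℕ.^ suc k ≡ m)) → NumberRing rationals (suc k) m) → Trichotomy n A B (suc k)
  compare-with-log n A B k 1≤n 1≤B ring with ℕP.anyUpTo? (λ r → r ℕ.^ suc k ℕP.≟ m) (suc m)
    where m = B ℕ.^ k ℕ.* A
  ... | yes (r , _ , e) = rational-case n A B (suc k) r B (ℕ.s≤s ℕ.z≤n) 1≤n 1≤B 1≤B (trans (lem A B (B ℕ.^ k)) (cong (B ℕ.*_) (sym e)))
    where
    lem : ∀ A B x → A ℕ.* (B ℕ.* x) ≡ B ℕ.* (x ℕ.* A)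
    lem = solve-∀
  ... | no none = irrational-case n A B k m 1≤n 1≤B refl (ring m (λ r e → none (r , ℕ.s≤s (bound r e) , e)))
    where
    m = B ℕ.^ k ℕ.* A
    bound : ∀ r → r ℕ.^ suc k ≡ m → r ℕ.≤ m
    bound zero    e = ℕ.z≤n
    bound (suc r) e = subst (suc r ℕ.≤_) e (ℕP.m≤m*n (suc r) (suc r ℕ.^ k) {{ℕP.m^n≢0 (suc r) k}})

  quadraticRing : ∀ m → (∀ r → ¬ (r ℕ.^ 2 ≡ m)) → NumberRing rationals 2 m
  quadraticRing m none = Quadratic.numberRing m (λ t s e → no-rational-root 2 m (ℕ.s≤s ℕ.z≤n) none t s (trans (sq t)
      (trans (cong ℤ.∣_∣ e) (trans (ℤP.abs-* (+ m) (s ℤ.* s)) (cong (m ℕ.*_) (sym (sq s))))))) rationals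
    where
    sq : ∀ i → ℤ.∣ i ∣ ℕ.^ 2 ≡ ℤ.∣ i ℤ.* i ∣
    sq i = trans (cong (ℤ.∣ i ∣ ℕ.*_) (ℕP.*-identityʳ ℤ.∣ i ∣)) (sym (ℤP.abs-* i i))

  abs-cube : ∀ i → ℤ.∣ i ℤ.* (i ℤ.* i) ∣ ≡ ℤ.∣ i ∣ ℕ.^ 3
  abs-cube i = trans (ℤP.abs-* i (i ℤ.* i)) (trans (cong (ℤ.∣ i ∣ ℕ.*_) (ℤP.abs-* i i)) (lem ℤ.∣ i ∣))
    where
    lem : ∀ x → x ℕ.* (x ℕ.* x) ≡ x ℕ.^ 3
    lem x = cong (λ z → x ℕ.* (x ℕ.* z)) (sym (ℕP.*-identityʳ x))

  abs-cube-root : ∀ m t s → t ℤ.* (t ℤ.* t) ≡ + m ℤ.* (s ℤ.* (s ℤ.* s)) → ℤ.∣ t ∣ ℕ.^ 3 ≡ m ℕ.* ℤ.∣ s ∣ ℕ.^ 3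
  abs-cube-root m t s e = begin
    ℤ.∣ t ∣ ℕ.^ 3                    ≡⟨ sym (abs-cube t) ⟩
    ℤ.∣ t ℤ.* (t ℤ.* t) ∣            ≡⟨ cong ℤ.∣_∣ e ⟩
    ℤ.∣ + m ℤ.* (s ℤ.* (s ℤ.* s)) ∣  ≡⟨ ℤP.abs-* (+ m) (s ℤ.* (s ℤ.* s)) ⟩
    m ℕ.* ℤ.∣ s ℤ.* (s ℤ.* s) ∣      ≡⟨ cong (m ℕ.*_) (abs-cube s) ⟩
    m ℕ.* ℤ.∣ s ∣ ℕ.^ 3              ∎
    where open ≡-Reasoning

  cubicRing : ∀ m → (∀ r → ¬ (r ℕ.^ 3 ≡ m)) → NumberRing rationals 3 m
  cubicRing m none = Cubic.numberRing m (λ t s e → no-rational-root 3 m (ℕ.s≤s ℕ.z≤n) none t s (abs-cube-root m t s e)) rationals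

  abstract
    compare-with-log² : ∀ n A B → 1 ℕ.≤ n → 1 ℕ.≤ B → Trichotomy n A B 2
    compare-with-log² n A B 1≤n 1≤B = compare-with-log n A B 1 1≤n 1≤B quadraticRing

    compare-with-log³ : ∀ n A B → 1 ℕ.≤ n → 1 ℕ.≤ B → Trichotomy n A B 3
    compare-with-log³ n A B 1≤n 1≤B = compare-with-log n A B 2 1≤n 1≤B cubicRing

-- Walks, shortest distances, BFS trees and greedy domination.

module Walks where

  open import Defs
  open import Data.Bool using (true; false; T)
  open import Data.Empty using (⊥; ⊥-elim)
  open import Data.Fin as Fin using (Fin; toℕ)
  import Data.Fin.Properties as FinP
  open import Data.List using (List; []; _∷_; map; _++_)
  open import Data.List.Membership.Propositional using (_∈_)
  open import Data.List.Membership.Propositional.Properties using (∈-∃++; ∈-++⁻; ∈-++⁺ˡ; ∈-++⁺ʳ)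
  open import Data.List.Properties using (map-++)
  open import Data.List.Relation.Unary.All as All using (All; []; _∷_)
  open import Data.List.Relation.Unary.AllPairs using ([]; _∷_)
  open import Data.List.Relation.Unary.Any using (here; there)
  open import Data.List.Relation.Unary.Unique.Propositional using (Unique)
  open import Data.Nat
  open import Data.Nat.ListAction using (sum)
  open import Data.Nat.ListAction.Properties using (sum-++)
  open import Data.Nat.Properties
  open import Data.Product using (Σ; ∃; _×_; _,_; proj₁; proj₂)
  open import Data.Sum using (_⊎_; inj₁; inj₂)
  open import Relation.Binary.PropositionalEquality
  open import Relation.Nullary using (Dec; yes; no)
  open import Relation.Nullary.Decidable using (map′; _×-dec_)

  least : (P : ℕ → Set) → (∀ k → Dec (P k)) → ∀ m → P m → Σ ℕ λ d → d ≤ m × P d × (∀ k → P k → d ≤ k)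
  least P P? m Pm with anyUpTo? P? m
  ... | no none = m , ≤-refl , Pm , λ k Pk → ≮⇒≥ (λ k<m → none (k , k<m , Pk))
  least P P? (suc m) Pm | yes (k , s≤s k≤m , Pk) = descend m k k≤m Pk
    where
    descend : ∀ m k → k ≤ m → P k → Σ ℕ λ d → d ≤ suc m × P d × (∀ k → P k → d ≤ k)
    descend m k k≤m Pk with anyUpTo? P? k
    ... | no none = k , m≤n⇒m≤1+n k≤m , Pk , λ l Pl → ≮⇒≥ (λ l<k → none (l , l<k , Pl))
    descend zero    .zero z≤n Pk | yes (l , () , Pl)
    descend (suc m) k k≤m Pk | yes (l , l<k , Pl) with descend m l (≤-pred (<-≤-trans l<k k≤m)) Pl
    ... | d , d≤ , r = d , m≤n⇒m≤1+n d≤ , r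

  module _ {n : ℕ} where

    Symmetric : Edges n → Set
    Symmetric E = ∀ {u v} → E u v → E v u

    Sym-symmetric : (E : Edges n) → Symmetric (Sym E)
    Sym-symmetric E (inj₁ e) = inj₂ e
    Sym-symmetric E (inj₂ e) = inj₁ e

    walk-++ : ∀ {E : Edges n} {u v w k l} → Walk E u v k → Walk E v w l → Walk E u w (k + l)
    walk-++ wnil        q = q
    walk-++ (wcons e p) q = wcons e (walk-++ p q)

    walk-snoc : ∀ {E : Edges n} {u v w k} → Walk E u v k → E v w → Walk E u w (suc k)
    walk-snoc wnil        e = wcons e wnil
    walk-snoc (wcons f p) e = wcons f (walk-snoc p e)

    walk-reverse : ∀ {E : Edges n} → Symmetric E → ∀ {u v k} → Walk E u v k → Walk E v u k
    walk-reverse s wnil        = wnil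
    walk-reverse s (wcons e p) = walk-snoc (walk-reverse s p) (s e)

    walk-map : ∀ {E F : Edges n} → (∀ {u v} → E u v → F u v) → ∀ {u v k} → Walk E u v k → Walk F u v k
    walk-map f wnil        = wnil
    walk-map f (wcons e p) = wcons (f e) (walk-map f p)

    walk-split : ∀ {E : Edges n} {u v} k l → Walk E u v (k + l) → Σ (Fin n) λ w → Walk E u w k × Walk E w v l
    walk-split zero    l p = _ , wnil , p
    walk-split (suc k) l (wcons e p) with walk-split k l p
    ... | w , q , r = w , wcons e q , r

    wwalk-snoc : ∀ {E : Edges n} {wt u v w k s} → WWalk E wt u v k s → E v w → WWalk E wt u w (suc k) (s + wt w)
    wwalk-snoc {wt = wt} {w = w} wwnil e = wwcons e wwnil
    wwalk-snoc {E = E} {wt = wt} {u = u} {w = w} (wwcons {s = s} f p) e =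
      subst (WWalk E wt u w _) (sym (+-assoc (wt u) s (wt w))) (wwcons f (wwalk-snoc p e))

    IsDist-unique : ∀ {E : Edges n} {u v d d'} → IsDist E u v d → IsDist E u v d' → d ≡ d'
    IsDist-unique (p , m) (p' , m') = ≤-antisym (m _ p') (m' _ p)

    module Decidable {E : Edges n} (E? : ∀ u v → Dec (E u v)) where

      walk? : ∀ k u v → Dec (Walk E u v k)
      walk? zero u v = map′ (λ { refl → wnil }) (λ { wnil → refl }) (u Fin.≟ v)
      walk? (suc k) u v = map′ (λ { (w , e , p) → wcons e p }) (λ { (wcons e p) → _ , e , p })
        (FinP.any? (λ w → E? u w ×-dec walk? k w v))

      shortest : ∀ {u v k} → Walk E u v k → Σ ℕ λ d → IsDist E u v d × d ≤ k
      shortest {u} {v} {k} p with least (Walk E u v) (λ l → walk? l u v) k p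
      ... | d , d≤k , q , m = d , (q , m) , d≤k

      -- a shortest walk repeats no vertex
      dist-< : ∀ {u v d} → IsDist E u v d → d < n
      dist-< {u} {v} {d} (p , m) with d <? n
      ... | yes d<n = d<n
      ... | no d≮n = ⊥-elim (repeat (FinP.pigeonhole (s≤s (≮⇒≥ d≮n)) (λ i → proj₁ (cut i))))
        where
        cut : (i : Fin (suc d)) → Σ (Fin n) λ w → Walk E u w (toℕ i) × Walk E w v (d ∸ toℕ i)
        cut i = walk-split (toℕ i) (d ∸ toℕ i) (subst (Walk E u v) (sym (m+[n∸m]≡n (≤-pred (FinP.toℕ<n i)))) p)
        repeat : (∃ λ i → ∃ λ j → i Fin.< j × proj₁ (cut i) ≡ proj₁ (cut j)) → ⊥
        repeat (i , j , i<j , e) = <-irrefl refl (begin-strict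
          d                        ≤⟨ m _ (walk-++ (proj₁ (proj₂ (cut i))) (subst (λ w → Walk E w v (d ∸ toℕ j)) (sym e) (proj₂ (proj₂ (cut j))))) ⟩
          toℕ i + (d ∸ toℕ j)      <⟨ +-monoˡ-< (d ∸ toℕ j) i<j ⟩
          toℕ j + (d ∸ toℕ j)      ≡⟨ m+[n∸m]≡n (≤-pred (FinP.toℕ<n j)) ⟩
          d                        ∎)
          where open ≤-Reasoning

      reachable? : ∀ u v → Dec (Σ ℕ λ d → IsDist E u v d)
      reachable? u v with anyUpTo? (λ k → walk? k u v) n
      ... | yes (k , _ , p) = yes (proj₁ (shortest p) , proj₁ (proj₂ (shortest p)))
      ... | no none = no λ { (d , D) → none (d , dist-< D , proj₁ D) }

      BFSEdge? : ∀ r par x y → Dec (BFSEdge E r par x y)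
      BFSEdge? r par x y with reachable? r y
      ... | no none = no λ { (d , D , _) → none (suc d , D) }
      ... | yes (zero , D) = no λ { (d , D' , _) → 0≢1+n (IsDist-unique D D') }
      ... | yes (suc d , D) = map′ (λ e → d , D , e) (λ { (_ , _ , e) → e }) (x Fin.≟ par y)

    module Tree {E : Edges n} {r : Fin n} {par : Fin n → Fin n} (bfs : IsBFS E r par) where

      dist-zero : ∀ {u} → IsDist E r u 0 → r ≡ u
      dist-zero (wnil , _) = refl

      tree-walk : ∀ d {u} → IsDist E r u d → Walk (Sym (BFSEdge E r par)) r u d
      tree-walk zero    D with dist-zero D
      ... | refl = wnil
      tree-walk (suc d) {u} D = walk-snoc (tree-walk d (proj₂ (bfs u d D))) (inj₁ (d , D , refl))

      Anc-trans : ∀ {a b c} → Anc E r par a b → Anc E r par b c → Anc E r par a c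
      Anc-trans p here        = p
      Anc-trans p (there e q) = there e (Anc-trans p q)

      Anc-par : ∀ {w u d} → IsDist E r w (suc d) → Anc E r par w u → Anc E r par (par w) u
      Anc-par e p = Anc-trans (there e here) p

      Anc? : (E? : ∀ u v → Dec (E u v)) → ∀ d {u} → IsDist E r u d → ∀ a → Dec (Anc E r par a u)
      Anc? E? d {u} D a with a Fin.≟ u
      ... | yes refl = yes here
      Anc? E? zero    {u} D a | no a≢u = no λ { here → a≢u refl ; (there D' _) → 0≢1+n (IsDist-unique D D') }
      Anc? E? (suc d) {u} D a | no a≢u with Anc? E? d (proj₂ (bfs u d D)) a
      ... | yes p = yes (there D p)
      ... | no ¬p = no λ { here → a≢u refl ; (there _ p) → ¬p p }

      Anc-walk : ∀ {w u} → Anc E r par w u → ∀ {d} → IsDist E r u d → Σ ℕ λ p → Σ ℕ λ q → IsDist E r w p × Walk E w u q × p + q ≡ d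
      Anc-walk here {d} D = d , 0 , D , wnil , +-identityʳ d
      Anc-walk {u = u} (there {d = d} D' a) {d₁} D with IsDist-unique D D'
      ... | refl with Anc-walk a (proj₂ (bfs u d D))
      ...   | p , q , P , Q , e = p , suc q , P , walk-snoc Q (proj₁ (bfs u d D)) , trans (+-suc p q) (cong suc e)

      -- The route passes through the root. Tree paths from there are shortest, so any walks from
      -- the root to u and v bound its two legs.
      hub : Symmetric E → (E? : ∀ u v → Dec (E u v)) → ∀ {u v k l} → Walk E r u k → Walk E r v l →
        Σ ℕ λ j → j ≤ k + l × Walk (Sym (BFSEdge E r par)) u v j
      hub s E? p q with Decidable.shortest E? p | Decidable.shortest E? q
      ... | d , D , d≤k | d' , D' , d'≤l = d + d' , +-mono-≤ d≤k d'≤l ,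
        walk-++ (walk-reverse (Sym-symmetric (BFSEdge E r par)) (tree-walk d D)) (tree-walk d' D')

    GE-sym : ∀ (G : Graph n) V' → Symmetric (GE G V')
    GE-sym G V' {u} {v} h with V' u | V' v
    ... | true | true = subst T (adj-sym G u v) h
    ... | true | false = h
    ... | false | _ = ⊥-elim h

  sum-⊆ : {A : Set} (wt : A → ℕ) (xs ys : List A) → Unique ys → (∀ y → y ∈ ys → y ∈ xs) → sum (map wt ys) ≤ sum (map wt xs)
  sum-⊆ wt xs []       u h = z≤n
  sum-⊆ wt xs (y ∷ ys) (y∉ ∷ u) h with ∈-∃++ (h y (here refl))
  ... | as , bs , refl = begin
    wt y + sum (map wt ys)                            ≤⟨ +-monoʳ-≤ (wt y) (sum-⊆ wt (as ++ bs) ys u sub) ⟩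
    wt y + sum (map wt (as ++ bs))                    ≡⟨ cong (wt y +_) (trans (cong sum (map-++ wt as bs)) (sum-++ (map wt as) (map wt bs))) ⟩
    wt y + (sum (map wt as) + sum (map wt bs))        ≡⟨ trans (sym (+-assoc (wt y) _ _)) (trans (cong (_+ sum (map wt bs)) (+-comm (wt y) _)) (+-assoc (sum (map wt as)) (wt y) _)) ⟩
    sum (map wt as) + (wt y + sum (map wt bs))        ≡⟨ sym (trans (cong sum (map-++ wt as (y ∷ bs))) (sum-++ (map wt as) (map wt (y ∷ bs)))) ⟩
    sum (map wt (as ++ y ∷ bs))                       ∎
    where
    open ≤-Reasoning
    sub : ∀ z → z ∈ ys → z ∈ as ++ bs
    sub z z∈ys with ∈-++⁻ as (h z (there z∈ys))
    ... | inj₁ z∈as = ∈-++⁺ˡ z∈as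
    ... | inj₂ (here refl) = ⊥-elim (All.lookup y∉ z∈ys refl)
    ... | inj₂ (there z∈bs) = ∈-++⁺ʳ as z∈bs

  greedy-dominates : ∀ {n} {A : Set} {Cand : Fin n → Set} {Tgt : A → Set} {Cov : Fin n → A → Set} {D xs} →
    Greedy Cand Tgt Cov D xs → ∀ a → Tgt a → D a ⊎ Σ (Fin n) λ x → x ∈ xs × Cov x a
  greedy-dominates (done h) a t = inj₁ (h a t)
  greedy-dominates (pick x _ _ _ _ _ g) a t with greedy-dominates g a t
  ... | inj₁ (inj₁ d) = inj₁ d
  ... | inj₁ (inj₂ c) = inj₂ (x , here refl , c)
  ... | inj₂ (y , y∈ , c) = inj₂ (y , there y∈ , c)

-- The stretch bound for the constructed subgraph.

module Spanner where

  open import Defs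
  open Walks
  open LogComparison using (Lt⇒Le; MulLogLt⇒Le)
  open Comparison using (compare-with-log²; compare-with-log³)
  open NewtonSeries using (ℕ^-distrib-*)
  open import Data.Bool using (true; false; T; _∧_)
  open import Data.Bool.Properties using (T?; T-∧)
  open import Data.Empty using (⊥-elim)
  open import Data.Fin as Fin using (Fin; zero; suc)
  import Data.Fin.Properties as FinP
  open import Data.List using (List; []; _∷_; map)
  open import Data.List.Membership.Propositional using (_∈_)
  import Data.List.Membership.DecPropositional as DecMembership
  open import Data.List.Relation.Unary.All as All using (All; []; _∷_)
  open import Data.List.Relation.Unary.AllPairs using ([]; _∷_)
  open import Data.List.Relation.Unary.Any using (here; there)
  open import Data.List.Relation.Unary.Unique.Propositional using (Unique)
  open import Data.Nat
  open import Data.Nat.ListAction using (sum)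
  open import Data.Nat.Properties
  open import Data.Nat.Tactic.RingSolver using (solve-∀)
  open import Data.Product using (Σ; _×_; _,_; proj₁; proj₂)
  open import Data.Sum using (_⊎_; inj₁; inj₂)
  open import Function.Bundles using (module Equivalence)
  open import Relation.Binary.PropositionalEquality
  open import Relation.Nullary using (¬_; Dec; yes; no)
  open import Relation.Nullary.Decidable using (map′; _×-dec_; _⊎-dec_)

  fifth-power-ratio : ∀ x z e C {Z W} → 1 ≤ e → z ^ 5 * Z ≤ e ^ 5 * W → x * e ≤ z * C → x ^ 5 * Z ≤ C ^ 5 * W
  fifth-power-ratio x z e C {Z} {W} 1≤e hz h = *-cancelʳ-≤ (x ^ 5 * Z) (C ^ 5 * W) (e ^ 5) {{m^n≢0 e 5 {{>-nonZero 1≤e}}}} (begin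
    x ^ 5 * Z * e ^ 5       ≡⟨ trans (swap₃ (x ^ 5) Z (e ^ 5)) (cong (_* Z) (sym (ℕ^-distrib-* x e 5))) ⟩
    (x * e) ^ 5 * Z         ≤⟨ *-monoˡ-≤ Z (^-monoˡ-≤ 5 h) ⟩
    (z * C) ^ 5 * Z         ≡⟨ trans (cong (_* Z) (ℕ^-distrib-* z C 5)) (swap₃ (z ^ 5) (C ^ 5) Z) ⟩
    z ^ 5 * Z * C ^ 5       ≤⟨ *-monoˡ-≤ (C ^ 5) hz ⟩
    e ^ 5 * W * C ^ 5       ≡⟨ rotate (e ^ 5) W (C ^ 5) ⟩
    C ^ 5 * W * e ^ 5       ∎)
    where
    open ≤-Reasoning
    swap₃ : ∀ a b c → a * b * c ≡ a * c * b
    swap₃ = solve-∀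
    rotate : ∀ a b c → a * b * c ≡ c * b * a
    rotate = solve-∀

  -- With t the fifth root of W/Z this says that x ≤ c t and y ≤ d t add up. The mediant (x + y)/(c
  -- + d) does not exceed the larger of x/c and y/d, so the corresponding hypothesis alone suffices
  -- and no root is taken.
  fifth-power-+ : ∀ x y c d {Z W} → 1 ≤ c → 1 ≤ d → x ^ 5 * Z ≤ c ^ 5 * W → y ^ 5 * Z ≤ d ^ 5 * W → (x + y) ^ 5 * Z ≤ (c + d) ^ 5 * W
  fifth-power-+ x y c d 1≤c 1≤d hx hy with ≤-total (x * d) (y * c)
  ... | inj₁ xd≤yc = fifth-power-ratio (x + y) y d (c + d) 1≤d hy
    (≤-trans (≤-reflexive (*-distribʳ-+ d x y)) (≤-trans (+-monoˡ-≤ (y * d) xd≤yc) (≤-reflexive (sym (*-distribˡ-+ y c d)))))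
  ... | inj₂ yc≤xd = fifth-power-ratio (x + y) x c (c + d) 1≤c hx
    (≤-trans (≤-reflexive (*-distribʳ-+ c x y)) (≤-trans (+-monoʳ-≤ (x * c) yc≤xd) (≤-reflexive (sym (*-distribˡ-+ x c d)))))

  -- f ≤ c · n^(3/5) (log₂ n)^(2/5).  A record, because the unfolded literal c ^ 5 * n ^ 3 is a sum
  -- of up to 5⁵ terms.
  record AtMost (n c f : ℕ) : Set where
    constructor at-most
    field bound : LeMulLog n (f ^ 5) (c ^ 5 * n ^ 3) 2

  record Above (n c f : ℕ) : Set where
    constructor above
    field bound : MulLogLt n (c ^ 5 * n ^ 3) (f ^ 5) 2

  -- At a given fraction p/q either one summand exceeds its own bound and its hypothesis already
  -- yields 2 ^ p ≤ n ^ q, or both bounds hold there and add up, against the assumption on x + y.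
  AtMost-+ : ∀ n {x y c d} → 1 ≤ c → 1 ≤ d → AtMost n c x → AtMost n d y → AtMost n (c + d) (x + y)
  AtMost-+ n {x} {y} {c} {d} 1≤c 1≤d (at-most hx) (at-most hy) = at-most sum-bound
    where
    sum-bound : LeMulLog n ((x + y) ^ 5) ((c + d) ^ 5 * n ^ 3) 2
    sum-bound p q 0<q lt with c ^ 5 * n ^ 3 * p ^ 2 <? x ^ 5 * q ^ 2 | d ^ 5 * n ^ 3 * p ^ 2 <? y ^ 5 * q ^ 2
    ... | yes lx | _      = hx p q 0<q lx
    ... | no _   | yes ly = hy p q 0<q ly
    ... | no ¬lx | no ¬ly = ⊥-elim (<-irrefl refl (<-≤-trans lt (≤-trans
        (fifth-power-+ x y c d {q ^ 2} {n ^ 3 * p ^ 2} 1≤c 1≤d (≤-trans (≮⇒≥ ¬lx) (≤-reflexive (*-assoc (c ^ 5) (n ^ 3) (p ^ 2))))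
                                                 (≤-trans (≮⇒≥ ¬ly) (≤-reflexive (*-assoc (d ^ 5) (n ^ 3) (p ^ 2)))))
        (≤-reflexive (sym (*-assoc ((c + d) ^ 5) (n ^ 3) (p ^ 2)))))))

  AtMost-mono : ∀ n {c x y} → x ≤ y → AtMost n c y → AtMost n c x
  AtMost-mono n x≤y (at-most h) = at-most λ p q 0<q lt → h p q 0<q (<-≤-trans lt (*-monoˡ-≤ (q ^ 2) (^-monoˡ-≤ 5 x≤y)))

  AtMost-1 : ∀ n {f} → LeMulLog n (f ^ 5) (n ^ 3) 2 → AtMost n 1 f
  AtMost-1 n {f} h = at-most (subst (λ B → LeMulLog n (f ^ 5) B 2) (sym (*-identityˡ (n ^ 3))) h)

  Above⇒¬AtMost : ∀ n c f → Above n c f → ¬ AtMost n c f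
  Above⇒¬AtMost n c f (above (p , q , 0<q , nq<2p , B<A)) (at-most h) = <-irrefl refl (<-≤-trans nq<2p (h p q 0<q B<A))

  AtMost-≤ : ∀ n {c d f} → c ≤ d → AtMost n c f → AtMost n d f
  AtMost-≤ n {c} {d} {f} c≤d (at-most le) = at-most λ p q 0<q lt → le p q 0<q (≤-<-trans (*-monoˡ-≤ (p ^ 2) (*-monoˡ-≤ (n ^ 3) (^-monoˡ-≤ 5 c≤d))) lt)

  LtMulLog⇒¬Le : ∀ n A B k → LtMulLog n A B k → ¬ MulLogLe n B A k
  LtMulLog⇒¬Le n A B k (p , q , 0<q , A<B , lt) h = <-irrefl refl (<-≤-trans A<B (h p q 0<q (<⇒≤ lt)))

  split-≤ : ∀ n A B → 1 ≤ n → 1 ≤ B → LeMulLog n A B 2 ⊎ MulLogLt n B A 2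
  split-≤ n A B 1≤n 1≤B with compare-with-log² n A B 1≤n 1≤B
  ... | inj₁ lt               = inj₁ (Lt⇒Le {n} {A} {B} {2} lt)
  ... | inj₂ (inj₁ gt)        = inj₂ gt
  ... | inj₂ (inj₂ (le , _))  = inj₁ le

  split-≥ : ∀ n A B → 1 ≤ n → 1 ≤ B → MulLogLe n B A 3 ⊎ LtMulLog n A B 3
  split-≥ n A B 1≤n 1≤B with compare-with-log³ n A B 1≤n 1≤B
  ... | inj₁ lt               = inj₂ lt
  ... | inj₂ (inj₁ gt)        = inj₁ (MulLogLt⇒Le {n} {A} {B} {3} gt)
  ... | inj₂ (inj₂ (_ , ge))  = inj₁ ge

  -- Since log₂ n ≥ 1, the degree bound n^(3/5)/(log₂ n)^(3/5) left by step 1 is at most n^(3/5) (log₂ n)^(2/5).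
  low-degree : ∀ n {x} → 2 ≤ n → MulLogLt n (x ^ 5) (n ^ 3) 3 → AtMost n 1 x
  low-degree n {x} 2≤n (p , q , 0<q , nq<2p , lt) = AtMost-1 n {x} λ p' q' 0<q' lt' →
    ≤-trans (^-monoʳ-≤ 2 (<⇒≤ (square-cancel p' q' (*-cancelˡ-< (n ^ 3) (p' ^ 2) (q' ^ 2) (<-≤-trans lt' (*-monoˡ-≤ (q' ^ 2) (<⇒≤ x<n)))))))
      (^-monoˡ-≤ q' 2≤n)
    where
    q<p : q < p
    q<p = ≰⇒> λ p≤q → <-irrefl refl (<-≤-trans nq<2p (≤-trans (^-monoʳ-≤ 2 p≤q) (^-monoˡ-≤ q 2≤n)))
    x<n : x ^ 5 < n ^ 3
    x<n = *-cancelʳ-< (p ^ 3) (x ^ 5) (n ^ 3) (<-≤-trans lt (*-monoʳ-≤ (n ^ 3) (^-monoˡ-≤ 3 (<⇒≤ q<p))))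
    square-cancel : ∀ a b → a ^ 2 < b ^ 2 → a < b
    square-cancel a b h = ≰⇒> λ b≤a → <-irrefl refl (<-≤-trans h (^-monoˡ-≤ 2 b≤a))

  module _ {n : ℕ} (G : Graph n) where

    GE? : ∀ V' u v → Dec (GE G V' u v)
    GE? V' u v = T? (adjIn G V' u v)

    GE-split : ∀ V' {u v} → GE G V' u v → T (V' u) × T (V' v) × T (adj G u v)
    GE-split V' {u} {v} e with Equivalence.to (T-∧ {V' u} {V' v ∧ adj G u v}) e
    ... | p , q = p , Equivalence.to (T-∧ {V' v} {adj G u v}) q

    GE-intro : ∀ V' {u v} → T (V' u) → T (V' v) → T (adj G u v) → GE G V' u v
    GE-intro V' {u} {v} p q r = Equivalence.from (T-∧ {V' u} {V' v ∧ adj G u v}) (p , Equivalence.from (T-∧ {V' v} {adj G u v}) (q , r))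

    Touches : VSet n → Fin n → Fin n → Set
    Touches V' r w = Σ ℕ λ h → h ≤ 1 × Walk (GE G V') r w h

    removed⇒touches : ∀ V' r w → T (V' r) → T (V' w) → ¬ T (remove G V' r w) → Touches V' r w
    removed⇒touches V' r w r∈ w∈ gone with w Fin.≟ r
    ... | yes refl = 0 , z≤n , wnil
    ... | no _ with T? (adj G r w)
    ...   | yes e = 1 , ≤-refl , wcons (GE-intro V' r∈ w∈ e) wnil
    ...   | no ¬e with V' w | adj G r w
    ...     | true | true  = ⊥-elim (¬e _)
    ...     | true | false = ⊥-elim (gone _)

    -- Only the removal of one of its vertices can destroy the walk, and a removed vertex lies
    -- within one step of r; the walk is cut at such a vertex.
    survive : ∀ V' r → T (V' r) → ∀ {u v k} → Walk (GE G V') u v k →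
      Walk (GE G (remove G V' r)) u v k ⊎
      Σ (Fin n) λ w → Σ ℕ λ i → Σ ℕ λ j → Walk (GE G V') u w i × Walk (GE G V') w v j × i + j ≡ k × Touches V' r w
    survive V' r r∈ wnil = inj₁ wnil
    survive V' r r∈ {u} (wcons {w = x} {ℓ = k} e p) with survive V' r r∈ p
    ... | inj₂ (w , i , j , q , q' , eq , t) = inj₂ (w , suc i , j , wcons e q , q' , cong suc eq , t)
    ... | inj₁ p' with GE-split V' e | T? (remove G V' r u) | T? (remove G V' r x)
    ...   | u∈ , x∈ , a | no gone | _       = inj₂ (u , 0 , suc k , wnil , wcons e p , refl , removed⇒touches V' r u r∈ u∈ gone)
    ...   | u∈ , x∈ , a | yes _   | no gone = inj₂ (x , 1 , k , wcons e wnil , p , refl , removed⇒touches V' r x r∈ x∈ gone)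
    ...   | u∈ , x∈ , a | yes u∈' | yes x∈' = inj₁ (wcons (GE-intro (remove G V' r) u∈' x∈' a) p')

    step1-walk : ∀ {V' E Vf} → Step1 G V' E Vf → ∀ {u v k} → Walk (GE G V') u v k →
      Walk (GE G Vf) u v k ⊎ Σ ℕ λ j → j ≤ 2 + k × Walk (Sym E) u v j
    step1-walk (stop _) p = inj₁ p
    step1-walk {V'} (grow r par r∈ _ _ bfs rest) p with survive V' r r∈ p
    ... | inj₁ p' with step1-walk rest p'
    ...   | inj₁ q = inj₁ q
    ...   | inj₂ (j , j≤ , q) = inj₂ (j , j≤ , walk-map (λ { (inj₁ e) → inj₁ (inj₂ e) ; (inj₂ e) → inj₂ (inj₂ e) }) q)
    -- Both legs from the root r can go through w, at distance h ≤ 1 from it, so the detour costs 2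
    -- h.
    step1-walk {V'} (grow r par r∈ _ _ bfs rest) p | inj₂ (w , i , j , q , q' , refl , h , h≤1 , t)
      with Tree.hub bfs (GE-sym G V') (GE? V') (walk-++ t (walk-reverse (GE-sym G V') q)) (walk-++ t q')
    ... | l , l≤ , tw = inj₂ (l , ≤-trans l≤ (≤-trans (≤-reflexive (lem h i j)) (+-monoˡ-≤ (i + j) (+-mono-≤ h≤1 h≤1))) ,
            walk-map (λ { (inj₁ e) → inj₁ (inj₁ e) ; (inj₂ e) → inj₂ (inj₁ e) }) tw)
      where
      lem : ∀ h i j → (h + i) + (h + j) ≡ (h + h) + (i + j)
      lem = solve-∀

    BFSEdge⇒adj : ∀ V' {r par u v} → IsBFS (GE G V') r par → BFSEdge (GE G V') r par u v → T (adj G u v)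
    BFSEdge⇒adj V' bfs (d , D , refl) = proj₂ (proj₂ (GE-split V' (proj₁ (bfs _ d D))))

    step1-adj : ∀ {V' E Vf} → Step1 G V' E Vf → ∀ {u v} → E u v → T (adj G u v)
    step1-adj {V'} (grow r par _ _ _ bfs rest) (inj₁ e) = BFSEdge⇒adj V' bfs e
    step1-adj (grow r par _ _ _ bfs rest) (inj₂ e) = step1-adj rest e

    step1? : ∀ {V' E Vf} → Step1 G V' E Vf → ∀ u v → Dec (E u v)
    step1? (stop _) u v = no λ ()
    step1? {V'} (grow r par _ _ _ _ rest) u v = Decidable.BFSEdge? (GE? V') r par u v ⊎-dec step1? rest u v

    step1-degree : ∀ {V' E Vf} → Step1 G V' E Vf → ∀ v → T (Vf v) → MulLogLt n (deg G Vf v ^ 5) (n ^ 3) 3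
    step1-degree (stop h) = h
    step1-degree (grow _ _ _ _ _ _ rest) = step1-degree rest

  distinct⇒2≤ : ∀ {n} {u v : Fin n} → ¬ (u ≡ v) → 2 ≤ n
  distinct⇒2≤ {suc zero} {zero} {zero} h = ⊥-elim (h refl)
  distinct⇒2≤ {suc (suc n)} h = s≤s (s≤s z≤n)

  nonempty : ∀ {n} → Fin n → 1 ≤ n
  nonempty {suc n} _ = s≤s z≤n

  module Correctness {n : ℕ} (G : Graph n) (run : Run G) where
    open Run run
    open DecMembership (Fin._≟_ {n}) using (_∈?_)

    E : Edges n
    E = GE G V'

    E? : ∀ u v → Dec (E u v)
    E? = GE? G V'

    E-sym : Symmetric E
    E-sym = GE-sym G V'

    -- A wrapper from whose type the endpoints can be inferred, and behind which the large bounds in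
    -- `spannerOf` stay folded.
    record H (u v : Fin n) : Set where
      constructor edge
      field unwrap : spannerOf run u v

    H-sym : Symmetric (Sym H)
    H-sym = Sym-symmetric H

    degree : Fin n → ℕ
    degree = deg G V'

    open Decidable E? using (shortest; reachable?; BFSEdge?)

    1≤n³ : 1 ≤ n → 1 ≤ n ^ 3
    1≤n³ 1≤n = m^n>0 n {{>-nonZero 1≤n}} 3

    at-most? : ∀ c f → 1 ≤ n → 1 ≤ c → AtMost n c f ⊎ Above n c f
    at-most? c f 1≤n 1≤c = wrap (split-≤ n (f ^ 5) (c ^ 5 * n ^ 3) 1≤n (*-mono-≤ (m^n>0 c {{>-nonZero 1≤c}} 5) (1≤n³ 1≤n)))
      where
      wrap : LeMulLog n (f ^ 5) (c ^ 5 * n ^ 3) 2 ⊎ MulLogLt n (c ^ 5 * n ^ 3) (f ^ 5) 2 → AtMost n c f ⊎ Above n c f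
      wrap (inj₁ h) = inj₁ (at-most h)
      wrap (inj₂ h) = inj₂ (above h)

    heavy? : ∀ v → Heavy G V' v ⊎ Light G V' v
    heavy? v = split-≥ n (degree v ^ 5) (n ^ 2) 1≤n (m^n>0 n {{>-nonZero 1≤n}} 2)
      where 1≤n = nonempty v

    and-then : {A B : Set} → Dec A → (A → Dec B) → Dec (A × B)
    and-then (no ¬a) k = no λ h → ¬a (proj₁ h)
    and-then (yes a) k = map′ (a ,_) proj₂ (k a)

    H-adj : ∀ u v → spannerOf run u v → T (adj G u v)
    H-adj u v (inj₁ e) = step1-adj G step1 e
    H-adj u v (inj₂ (inj₁ (_ , _ , e))) = proj₂ (proj₂ (GE-split G V' e))
    H-adj u v (inj₂ (inj₂ (inj₁ (_ , _ , _ , e)))) = proj₂ (proj₂ (GE-split G V' e))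
    H-adj u v (inj₂ (inj₂ (inj₂ (inj₁ (r , r∈ , e))))) = BFSEdge⇒adj G V' (bfs6 r r∈) e
    H-adj u v (inj₂ (inj₂ (inj₂ (inj₂ (r , _ , r∈ , _ , _ , _ , _ , e))))) = BFSEdge⇒adj G V' (bfs4 r r∈) e

    path-edge? : ∀ x y v u → Dec (v ∈ S1 × u ∈ S1 × (Σ ℕ λ d → IsDist E v u d) × LeMulLog n (f v u ^ 5) (5 ^ 5 * n ^ 3) 2 ×
        Anc E v (par4 v) y u × BFSEdge E v (par4 v) x y)
    path-edge? x y v u = and-then (v ∈? S1) λ v∈ → and-then (u ∈? S1) λ _ → and-then (reachable? v u) λ { (d , D) →
        and-then (short? (at-most? 5 (f v u) (nonempty u) (s≤s z≤n))) λ _ → Tree.Anc? (bfs4 v v∈) E? d D y ×-dec BFSEdge? v (par4 v) x y }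
      where
      short? : AtMost n 5 (f v u) ⊎ Above n 5 (f v u) → Dec (LeMulLog n (f v u ^ 5) (5 ^ 5 * n ^ 3) 2)
      short? (inj₁ (at-most h)) = yes h
      short? (inj₂ gt)          = no λ h → Above⇒¬AtMost n 5 (f v u) gt (at-most h)

    -- The edges of steps 2, 3 and 7 depend on comparisons with log₂ n, which `heavy?` and
    -- `at-most?` decide. Decidable edges allow a shortest walk in H to be selected by search.
    H? : ∀ x y → Dec (spannerOf run x y)
    H? x y = step1? G step1 x y ⊎-dec (light-edge? ⊎-dec (heavy-edge? ⊎-dec (hub-edge? ⊎-dec
        FinP.any? (λ v → FinP.any? (λ u → path-edge? x y v u)))))
      where
      light-edge? : Dec (T (V' x) × Light G V' x × E x y)
      light-edge? = T? (V' x) ×-dec (light-dec (heavy? x) ×-dec E? x y)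
        where
        light-dec : Heavy G V' x ⊎ Light G V' x → Dec (Light G V' x)
        light-dec (inj₁ h) = no λ l → LtMulLog⇒¬Le n (degree x ^ 5) (n ^ 2) 3 l h
        light-dec (inj₂ l) = yes l
      heavy-edge? : Dec (T (V' x) × Heavy G V' x × y ≡ dom1 x × E x y)
      heavy-edge? = T? (V' x) ×-dec (heavy-dec (heavy? x) ×-dec (y Fin.≟ dom1 x ×-dec E? x y))
        where
        heavy-dec : Heavy G V' x ⊎ Light G V' x → Dec (Heavy G V' x)
        heavy-dec (inj₁ h) = yes h
        heavy-dec (inj₂ l) = no (LtMulLog⇒¬Le n (degree x ^ 5) (n ^ 2) 3 l)
      hub-edge? : Dec (Σ (Fin n) λ r → r ∈ S2 × BFSEdge E r (par6 r) x y)
      hub-edge? = FinP.any? (λ r → r ∈? S2 ×-dec BFSEdge? r (par6 r) x y)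

    light-edge : ∀ {x y} → Light G V' x → E x y → H x y
    light-edge l e = edge (inj₂ (inj₁ (proj₁ (GE-split G V' e) , l , e)))

    first-heavy : ∀ {u v k} → Walk E u v k → Walk (Sym H) u v k ⊎
      Σ (Fin n) λ a → Σ ℕ λ i → Σ ℕ λ j → Walk (Sym H) u a i × Walk E a v j × i + j ≡ k × T (V' a) × Heavy G V' a
    first-heavy wnil = inj₁ wnil
    first-heavy {u} (wcons {ℓ = k} e p) with heavy? u
    ... | inj₁ h = inj₂ (u , 0 , suc k , wnil , wcons e p , refl , proj₁ (GE-split G V' e) , h)
    ... | inj₂ l with first-heavy p
    ...   | inj₁ q = inj₁ (wcons (inj₁ (light-edge l e)) q)
    ...   | inj₂ (a , i , j , q , q' , eq , a∈ , h) = inj₂ (a , suc i , j , wcons (inj₁ (light-edge l e)) q , q' , cong suc eq , a∈ , h)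

    to-dominator : ∀ {a} → T (V' a) → Heavy G V' a → Σ ℕ λ h → h ≤ 1 × Walk E a (dom1 a) h × Walk (Sym H) a (dom1 a) h
    to-dominator {a} a∈ hv with dom1-ok a a∈ hv
    ... | _ , inj₁ eq = 0 , z≤n , subst (λ x → Walk E a x 0) (sym eq) wnil , subst (λ x → Walk (Sym H) a x 0) (sym eq) wnil
    ... | _ , inj₂ e  = 1 , ≤-refl , wcons e wnil , wcons (inj₁ (edge (inj₂ (inj₂ (inj₁ (a∈ , hv , refl , e)))))) wnil

    module Root (v : Fin n) (v∈ : v ∈ S1) where
      open Tree (bfs4 v v∈)

      -- Realises f v u as the weight of an actual walk, which can be prolonged by an edge and then
      -- compared with another value of f through `f-min`.
      tree-wwalk : ∀ d {u} → IsDist E v u d → WWalk E degree v u d (f v u)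
      tree-wwalk zero D with dist-zero D
      ... | refl = subst (WWalk E degree v v 0) (sym (f-root v v∈)) wwnil
      tree-wwalk (suc d) {u} D = subst (WWalk E degree v u (suc d)) (sym (f-step v v∈ u d D))
        (wwalk-snoc (tree-wwalk d (proj₂ (bfs4 v v∈ u d D))) (proj₁ (bfs4 v v∈ u d D)))

      path-in-H : ∀ {u d} → u ∈ S1 → IsDist E v u d → AtMost n 5 (f v u) → Walk (Sym H) v u d
      path-in-H {u} {d} u∈ D (at-most le) = go d D here
        where
        go : ∀ e {w} → IsDist E v w e → Anc E v (par4 v) w u → Walk (Sym H) v w e
        go zero W a with dist-zero W
        ... | refl = wnil
        go (suc e) {w} W a = walk-snoc (go e (proj₂ (bfs4 v v∈ w e W)) (Anc-par W a))
          (inj₁ (edge (inj₂ (inj₂ (inj₂ (inj₂ (v , u , v∈ , u∈ , (d , D) , le , a , (e , W , refl))))))))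

      Beyond : Fin n → Set
      Beyond u = Σ ℕ λ d → IsDist E v u (suc d) × Above n 1 (f v u) × AtMost n 1 (f v (par4 v u))

      -- Along the tree path f starts at the degree of v, which is at most X, and ends above X; the
      -- vertex where it passes X meets the first two threshold conditions on nodes of R.
      first-beyond : ∀ d {t} → 1 ≤ n → IsDist E v t d → AtMost n 1 (degree v) → ¬ AtMost n 1 (f v t) →
        Σ (Fin n) λ u → Anc E v (par4 v) u t × Beyond u
      first-beyond zero 1≤n D low ¬le with dist-zero D
      ... | refl = ⊥-elim (¬le (subst (AtMost n 1) (sym (f-root v v∈)) low))
      first-beyond (suc d) {t} 1≤n D low ¬le with at-most? 1 (f v (par4 v t)) 1≤n ≤-refl
      ... | inj₂ gt with first-beyond d 1≤n (proj₂ (bfs4 v v∈ t d D)) low (Above⇒¬AtMost n 1 (f v (par4 v t)) gt)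
      ...   | u , a , b = u , there D a , b
      first-beyond (suc d) {t} 1≤n D low ¬le | inj₁ le with at-most? 1 (f v t) 1≤n ≤-refl
      ...   | inj₁ le' = ⊥-elim (¬le le')
      ...   | inj₂ gt  = t , here , d , D , gt , le

      -- the path from u down to its descendant t, whose degrees add up to f v t − f v (par u)
      descent : ∀ {u t} → Anc E v (par4 v) u t → ∀ {d} → IsDist E v u (suc d) → Σ ℕ λ e → IsDist E v t (suc e) ×
        Σ (List (Fin n)) λ ys → Unique ys × f v t ≡ f v (par4 v u) + sum (map degree ys) ×
          All (λ y → (Σ ℕ λ i → i ≤ suc e × IsDist E v y i) × Anc E v (par4 v) u y) ys
      descent {u} here {d} D = d , D , u ∷ [] , [] ∷ [] ,
        trans (f-step v v∈ u d D) (cong (f v (par4 v u) +_) (sym (+-identityʳ (degree u)))) , ((suc d , ≤-refl , D) , here) ∷ []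
      descent {u} {t} (there {d = e₁} D₁ a) {d} D with descent a D
      ... | e , De , ys , uniq , eq , all with IsDist-unique (proj₂ (bfs4 v v∈ t e₁ D₁)) De
      ...   | refl = suc e , D₁ , t ∷ ys
            , All.map (λ { ((i , i≤ , I) , _) refl → <-irrefl refl (≤-trans (≤-reflexive (IsDist-unique D₁ I)) i≤) }) all ∷ uniq
            , trans (f-step v v∈ t (suc e) D₁) (trans (cong (_+ degree t) eq)
                (trans (+-assoc (f v (par4 v u)) _ _) (cong (f v (par4 v u) +_) (+-comm _ (degree t)))))
            , ((suc (suc e) , ≤-refl , D₁) , there D₁ a) ∷ All.map (λ { ((i , i≤ , I) , b) → (i , m≤n⇒m≤1+n i≤ , I) , b }) all

      -- The vertices from u down to t are distinct members of the subtree below u, so their degrees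
      -- form part of the sum s v u.
      f-descent : ∀ {u t d} → Anc E v (par4 v) u t → IsDist E v u (suc d) → f v t ≤ s v u + f v (par4 v u)
      f-descent {u} {t} {d} a D with descent a D | s-def v v∈ u (suc d) D
      ... | e , De , ys , uniq , eq , all | xs , _ , mem , s≡ = begin
        f v t                                      ≡⟨ eq ⟩
        f v (par4 v u) + sum (map degree ys)       ≤⟨ +-monoʳ-≤ (f v (par4 v u)) (sum-⊆ degree xs ys uniq inside) ⟩
        f v (par4 v u) + sum (map degree xs)       ≡⟨ trans (+-comm (f v (par4 v u)) _) (cong (_+ f v (par4 v u)) s≡) ⟩
        s v u + f v (par4 v u)                     ∎
        where
        open ≤-Reasoning
        inside : ∀ y → y ∈ ys → y ∈ xs
        inside y y∈ with All.lookup all y∈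
        ... | (i , _ , I) , b = proj₂ (mem y) ((i , I) , b)

      -- At the vertex u where f passes X, a bound s v u ≤ 3 X would give f v t ≤ 3 X + X. Hence s v
      -- u exceeds 3 X and (v, u) is a node of R; the hub that dominates it is adjacent to the path
      -- from v to u, an initial part of the path to t.
      hub-on-path : ∀ {t d} → 1 ≤ n → IsDist E v t d → AtMost n 1 (degree v) → ¬ AtMost n 4 (f v t) →
        Σ (Fin n) λ x → x ∈ S2 × Σ ℕ λ p → Σ ℕ λ q → p + q ≡ d × Walk E x v (suc p) × Walk E x t (suc q)
      hub-on-path {t} {d} 1≤n D low ¬le with first-beyond d 1≤n D low (λ le → ¬le (AtMost-≤ n {1} {4} {f v t} (s≤s z≤n) le))
      ... | u , a , d' , D' , beyond , par-low with at-most? 3 (s v u) 1≤n (s≤s z≤n)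
      ...   | inj₁ s-low = ⊥-elim (¬le (AtMost-mono n {4} {f v t} {s v u + f v (par4 v u)} (f-descent a D') (AtMost-+ n {s v u} {f v (par4 v u)} {3} {1} (s≤s z≤n) ≤-refl s-low par-low)))
      ...   | inj₂ s-high with greedy-dominates greedy2 (v , u)
                  ( v∈ , proj₁ (proj₂ (GE-split G V' (proj₁ (bfs4 v v∈ u d' D')))) , (d' , D')
                  , subst (λ B → MulLogLt n B (f v u ^ 5) 2) (*-identityˡ (n ^ 3)) (Above.bound beyond)
                  , subst (λ B → LeMulLog n (f v (par4 v u) ^ 5) B 2) (*-identityˡ (n ^ 3)) (AtMost.bound par-low)
                  , Above.bound s-high )
      ...     | inj₂ (x , x∈ , _ , w , b , e) with Anc-walk (Anc-trans b a) D
      ...       | p , q , P , Q , eq = x , x∈ , p , q , eq , wcons e (walk-reverse E-sym (proj₁ P)) , wcons e Q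

    hub-edges : ∀ {x} → x ∈ S2 → ∀ {u v k} → Walk (Sym (BFSEdge E x (par6 x))) u v k → Walk (Sym H) u v k
    hub-edges x∈ wnil                = wnil
    hub-edges x∈ (wcons (inj₁ e) p) = wcons (inj₁ (edge (inj₂ (inj₂ (inj₂ (inj₁ (_ , x∈ , e))))))) (hub-edges x∈ p)
    hub-edges x∈ (wcons (inj₂ e) p) = wcons (inj₂ (edge (inj₂ (inj₂ (inj₂ (inj₁ (_ , x∈ , e))))))) (hub-edges x∈ p)

    low : ∀ {x} → 2 ≤ n → T (V' x) → AtMost n 1 (degree x)
    low {x} 2≤n x∈ = low-degree n {degree x} 2≤n (step1-degree G step1 x x∈)

    module BetweenDominators {a b a' b' : Fin n} {α β j : ℕ} (2≤n : 2 ≤ n) (a'∈ : a' ∈ S1) (b'∈ : b' ∈ S1)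
      (a'∈V' : T (V' a')) (b'∈V' : T (V' b')) (α≤1 : α ≤ 1) (β≤1 : β ≤ 1)
      (aa' : Walk E a a' α) (bb' : Walk E b b' β) (Haa' : Walk (Sym H) a a' α) (Hbb' : Walk (Sym H) b b' β)
      (p : Walk E a b j) where

      open Root a' a'∈

      1≤n : 1 ≤ n
      1≤n = ≤-trans (s≤s z≤n) 2≤n

      to-b : Σ ℕ λ d → IsDist E a' b d × d ≤ α + j
      to-b = shortest (walk-++ (walk-reverse E-sym aa') p)
      D : ℕ
      D = proj₁ to-b
      DB : IsDist E a' b D
      DB = proj₁ (proj₂ to-b)
      D≤ : D ≤ α + j
      D≤ = proj₂ (proj₂ to-b)
      to-b' : Σ ℕ λ d → IsDist E a' b' d × d ≤ D + β
      to-b' = shortest (walk-++ (proj₁ DB) bb')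
      D' : ℕ
      D' = proj₁ to-b'
      DB' : IsDist E a' b' D'
      DB' = proj₁ (proj₂ to-b')
      D'≤ : D' ≤ D + β
      D'≤ = proj₂ (proj₂ to-b')

      Goal : Set
      Goal = Σ ℕ λ l → l ≤ j + 5 × Walk (Sym H) a b l

      -- The hub x hangs off the tree path from a' to t by one edge. Visiting it adds 2 to d, and
      -- the connections from a to a' and from t to b add α and h.
      through-hub : ∀ {t d h} → IsDist E a' t d → Walk E t b h → ¬ AtMost n 4 (f a' t) → d + (α + h) + 2 ≤ j + 5 →
        Goal
      through-hub {t} {d} {h} T' tb ¬le bound with hub-on-path 1≤n T' (low 2≤n a'∈V') ¬le
      ... | x , x∈ , r , q , refl , xa' , xt with Tree.hub (bfs6 x x∈) E-sym E? (walk-++ xa' (walk-reverse E-sym aa')) (walk-++ xt tb)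
      ...   | l , l≤ , w = l , ≤-trans l≤ (≤-trans (≤-reflexive (lem r α q h)) bound)
              , hub-edges x∈ w
        where
        lem : ∀ r α q h → (suc r + α) + (suc q + h) ≡ (r + q) + (α + h) + 2
        lem = solve-∀

      result : Goal
      result with at-most? 5 (f a' b') 1≤n (s≤s z≤n)
      ... | inj₁ le = α + D' + β , bound
            , walk-++ (walk-++ Haa' (path-in-H b'∈ DB' le)) (walk-reverse H-sym Hbb')
        where
        lem : ∀ j → (1 + ((1 + j) + 1)) + 1 ≡ j + 4
        lem = solve-∀
        bound : α + D' + β ≤ j + 5
        bound = ≤-trans (+-mono-≤ (+-mono-≤ α≤1 (≤-trans D'≤ (+-mono-≤ (≤-trans D≤ (+-monoˡ-≤ j α≤1)) β≤1))) β≤1)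
          (≤-trans (≤-reflexive (lem j)) (+-monoʳ-≤ j (n≤1+n 4)))
      ... | inj₂ gt with D' ≤? D
      ...   | yes D'≤D = through-hub DB' (walk-reverse E-sym bb') (λ le → Above⇒¬AtMost n 5 (f a' b') gt (AtMost-≤ n {4} {5} {f a' b'} (n≤1+n 4) le)) bound
        where
        lem : ∀ j → (1 + j) + (1 + 1) + 2 ≡ j + 5
        lem = solve-∀
        bound : D' + (α + β) + 2 ≤ j + 5
        bound = ≤-trans (+-monoˡ-≤ 2 (+-mono-≤ (≤-trans D'≤D (≤-trans D≤ (+-monoˡ-≤ j α≤1))) (+-mono-≤ α≤1 β≤1))) (≤-reflexive (lem j))
      ...   | no D'≰D = through-hub DB wnil ¬le bound
        where
        lem : ∀ j → (1 + j) + (1 + 0) + 2 ≡ j + 4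
        lem = solve-∀
        bound : D + (α + 0) + 2 ≤ j + 5
        bound = ≤-trans (+-monoˡ-≤ 2 (+-mono-≤ (≤-trans D≤ (+-monoˡ-≤ j α≤1)) (+-monoˡ-≤ 0 α≤1))) (≤-trans (≤-reflexive (lem j)) (+-monoʳ-≤ j (n≤1+n 4)))
        -- b' is one step further than b, so the path to b followed by the edge b b' competes in the definition of f
        extended : ∀ {h} → h ≤ 1 → Walk E b b' h → D' ≤ D + h → WWalk E degree a' b' D' (f a' b + degree b')
        extended _ wnil h≤ = ⊥-elim (D'≰D (≤-trans h≤ (≤-reflexive (+-identityʳ D))))
        extended (s≤s z≤n) (wcons e wnil) h≤ = subst (λ k → WWalk E degree a' b' k (f a' b + degree b'))
          (≤-antisym (≰⇒> D'≰D) (≤-trans h≤ (≤-reflexive (+-comm D 1)))) (wwalk-snoc (tree-wwalk D DB) e)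
        ¬le : ¬ AtMost n 4 (f a' b)
        ¬le le = Above⇒¬AtMost n 5 (f a' b') gt (AtMost-mono n {5} {f a' b'} {f a' b + degree b'} (f-min a' a'∈ b' D' _ DB' (extended β≤1 bb' D'≤))
          (AtMost-+ n {f a' b} {degree b'} {4} {1} (s≤s z≤n) ≤-refl le (low 2≤n b'∈V')))

    V'-along : ∀ {x y h} → T (V' x) → Walk E x y h → T (V' y)
    V'-along x∈ wnil        = x∈
    V'-along x∈ (wcons e q) = V'-along (proj₁ (proj₂ (GE-split G V' e))) q

    between-heavy : ∀ {a b j} → T (V' a) → Heavy G V' a → T (V' b) → Heavy G V' b → 2 ≤ n → Walk E a b j →
      Σ ℕ λ l → l ≤ j + 5 × Walk (Sym H) a b l
    between-heavy {a} {b} a∈ ha b∈ hb 2≤n p = go (to-dominator a∈ ha) (to-dominator b∈ hb)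
      where
      go : (Σ ℕ λ h → h ≤ 1 × Walk E a (dom1 a) h × Walk (Sym H) a (dom1 a) h) →
           (Σ ℕ λ h → h ≤ 1 × Walk E b (dom1 b) h × Walk (Sym H) b (dom1 b) h) → _
      go (α , α≤1 , aa' , Haa') (β , β≤1 , bb' , Hbb') =
        BetweenDominators.result 2≤n (proj₁ (dom1-ok a a∈ ha)) (proj₁ (dom1-ok b b∈ hb))
          (V'-along a∈ aa') (V'-along b∈ bb') α≤1 β≤1 aa' bb' Haa' Hbb' p

    approximate : ∀ {u v k} → Walk E u v k → Σ ℕ λ l → l ≤ k + 5 × Walk (Sym H) u v l
    approximate {k = k} p with first-heavy p
    ... | inj₁ q = k , m≤m+n k 5 , q
    -- Run on the reversed remainder, `first-heavy` finds the last heavy vertex of the walk.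
    ... | inj₂ (a , i , j , ua , av , refl , a∈ , ha) with first-heavy (walk-reverse E-sym av)
    ...   | inj₁ va = i + j , m≤m+n (i + j) 5 , walk-++ ua (walk-reverse H-sym va)
    ...   | inj₂ (b , i' , j' , vb , ba , refl , b∈ , hb) with between-heavy-or-equal
      where
      between-heavy-or-equal : Σ ℕ λ l → l ≤ j' + 5 × Walk (Sym H) a b l
      -- Two distinct vertices give n ≥ 2 and so log₂ n ≥ 1, on which the degree bound `low` rests;
      -- equal ones need no path.
      between-heavy-or-equal with a Fin.≟ b
      ... | yes refl = 0 , z≤n , wnil
      ... | no a≢b = between-heavy a∈ ha b∈ hb (distinct⇒2≤ a≢b) (walk-reverse E-sym ba)
    ...     | l , l≤ , ab = i + (l + i') , ≤-trans (+-monoʳ-≤ i (+-monoˡ-≤ i' l≤)) (≤-reflexive (lem i j' i'))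
              , walk-++ ua (walk-++ ab (walk-reverse H-sym vb))
      where
      lem : ∀ i j' i' → i + ((j' + 5) + i') ≡ (i + (i' + j')) + 5
      lem = solve-∀

    approximate-G : ∀ {u v k} → Walk (GE G allV) u v k → Σ ℕ λ l → l ≤ k + 5 × Walk (Sym H) u v l
    approximate-G {k = k} p with step1-walk G step1 p
    ... | inj₁ q = approximate q
    ... | inj₂ (l , l≤ , q) = l , ≤-trans l≤ (≤-trans (≤-reflexive (+-comm 2 k)) (+-monoʳ-≤ k (s≤s (s≤s z≤n))))
          , walk-map (λ { (inj₁ e) → inj₁ (edge (inj₁ e)) ; (inj₂ e) → inj₂ (edge (inj₁ e)) }) q

    spanner : IsAdditiveSpanner G (spannerOf run) 5
    spanner = H-adj , λ u v d D → conclude (approximate-G (proj₁ D))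
      where
      symH? : ∀ u v → Dec (Sym (spannerOf run) u v)
      symH? u v = H? u v ⊎-dec H? v u
      conclude : ∀ {u v d} → (Σ ℕ λ l → l ≤ d + 5 × Walk (Sym H) u v l) →
        Σ ℕ λ d' → IsDist (Sym (spannerOf run)) u v d' × d' ≤ d + 5
      conclude (l , l≤ , w) = bounded (Decidable.shortest symH? (walk-map (λ { (inj₁ (edge e)) → inj₁ e ; (inj₂ (edge e)) → inj₂ e }) w))
        where
        bounded : (Σ ℕ λ d' → IsDist (Sym (spannerOf run)) _ _ d' × d' ≤ l) → _
        bounded (d' , D' , d'≤) = d' , D' , ≤-trans d'≤ l≤

open Spanner using (module Correctness)

theorem2 : ∀ {n : ℕ} (G : Graph n) (run : Run G) → IsAdditiveSpanner G (spannerOf run) 5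
theorem2 G run = Correctness.spanner G run
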